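{- Let $k \geq 3$ be an integer and let $n$ be a nonzero integer. If $|n|=1$, then $M_k(n) \leq r_k$, where $r_3=9$, $r_4=6$, $r_5=5$, and $r_k=4$ for $k\ge 6$. If $|n| \geq 2$, then $M_k\left(n,\frac{k}{k-2}\right) \leq u_k$, where $u_3=15$, $u_4=10$, $u_5=6$, $u_k=8$ for $6\leq k\leq 14$, and $u_k=5$ for $k \geq 15$.
   Context: For an integer $k\ge 2$ and a nonzero integer $n$, a set $C$ of distinct positive integers has property $D_k(n)$ (is a Diophantine tuple with property $D_k(n)$) if $cc'+n$ is the $k$-th power of an integer for all distinct $c,c'\in C$. Define $M_k(n)=\sup\{|C|: C\subset\mathbb{N}\text{ has property }D_k(n)\}$ and, for real $L>0$, $M_k(n;L)=\sup\{|C\cap[|n|^L,\infty)|: C\subset\mathbb{N}\text{ has property }D_k(n)\}$ (written $M_k(n,L)$). -}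

module Defs where

open import Data.Nat as ℕ using (ℕ; suc; _≤_)
import Data.Bool
open import Data.Integer as ℤ using (ℤ; +_)
open import Data.List using (List)
open import Data.List.Relation.Unary.All using (All)
open import Data.List.Relation.Unary.AllPairs using (AllPairs)
open import Data.Product using (∃-syntax; _×_)
open import Relation.Binary.PropositionalEquality using (_≡_; _≢_)

IsKthPower : ℕ → ℤ → Set
IsKthPower k m = ∃[ z ] z ℤ.^ k ≡ m

-- A finite list of distinct positive integers with property D_k(n):
-- c * c' + n is a k-th power for all distinct members c, c'.
-- (Multiplication is commutative, so checking each unordered pair once suffices.)
HasPropertyD : ℕ → ℤ → List ℕ → Set
HasPropertyD k n cs =
  AllPairs _≢_ cs ×
  All (λ c → 1 ≤ c) cs ×
  AllPairs (λ c c' → IsKthPower k (+ c ℤ.* + c' ℤ.+ n)) cs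

r : ℕ → ℕ
r 3 = 9
r 4 = 6
r 5 = 5
r _ = 4

u : ℕ → ℕ
u 3 = 15
u 4 = 10
u 5 = 6
u k with k ℕ.<ᵇ 15
... | Data.Bool.true = 8
... | Data.Bool.false = 5

{-# OPTIONS --safe #-}
-- Let a < b be members of a tuple with property D_k(n). Every further member c gives a solution (x, y) of the Thue
-- equation α x^k - β y^k = m, where {α, β} = {a, b} and m = |n| (b - a); put Q = β y^k, which is about a b c. For two
-- solutions with Q < Q′ the integers x y′ and y x′ are distinct, and comparing their k-th powers gives the gap
-- principle Q′ ≥ k^k α β Q^(k-1) / m^k.
--
-- Two large solutions are impossible however far apart they are. With A and B the values of the denominator and
-- numerator of the r-th diagonal Padé approximant of (1 + t)^(1/k) at t = m / Q, the integers x A y′ and y B x′, if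
-- distinct, exclude the range Q^((kr+1)/(k-1)) < Q′ < Q^(kr+k-1) up to lower-order factors. Consecutive approximants
-- are linearly independent, so the integers are distinct for r or for r + 1, and the ranges of consecutive r overlap
-- once Q is large compared with m and k.
--
-- Taking a and b to be the second and third smallest members, the gap principle alone makes Q large enough after
-- few further members. Only |n|^k ≤ c^(k-2) is used, which is trivial for |n| = 1, so r_k bounds both quantities.
module Submission where

open import Defs
open import Data.Nat using (ℕ; _≤_; _^_; _∸_)
open import Data.Integer using (ℤ; ∣_∣; 0ℤ)
open import Data.List using (List; length)
open import Data.List.Relation.Unary.All using (All)
open import Data.Product using (_×_)
open import Relation.Binary.PropositionalEquality using (_≡_; _≢_)

import Data.Nat as ℕ
import Data.Nat.Properties as ℕ
import Data.Nat.Tactic.RingSolver as ℕ-Solver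
import Data.Integer as ℤ
import Data.Integer.Properties as ℤ
import Data.Integer.Tactic.RingSolver as ℤ-Solver
import Algebra.Solver.Ring
import Algebra.Solver.Ring.AlmostCommutativeRing as ACR
import Data.List.Relation.Binary.Permutation.Setoid.Properties
import Data.List.Sort
import Relation.Binary.PropositionalEquality as ≡
open import Algebra.Bundles using (CommutativeRing)
open import Data.Bool as Bool using (true; false)
open import Data.Empty using (⊥; ⊥-elim)
open import Data.Integer using (1ℤ; -[1+_]) renaming (_+_ to _⊕_; _*_ to _⊗_; -_ to ⊖_; _-_ to _⊝_; +_ to pos; _^_ to _^ᶻ_)
open import Data.List using ([]; _∷_)
open import Data.List.Relation.Binary.Permutation.Propositional using (_↭_; ↭⇒↭ₛ; ↭-sym)
open import Data.List.Relation.Binary.Permutation.Propositional.Properties using (All-resp-↭; ↭-length)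
open import Data.List.Relation.Unary.All as All using ([]; _∷_)
open import Data.List.Relation.Unary.AllPairs as AllPairs using (AllPairs; []; _∷_)
open import Data.List.Relation.Unary.Linked.Properties using (Linked⇒AllPairs)
open import Data.Maybe using (Maybe; just; nothing)
open import Data.Nat using (zero; suc; _<_; z≤n; s≤s; _+_; _*_; >-nonZero; >-nonZero⁻¹)
open import Data.Nat.Combinatorics using (_C_; nCk+nC[k+1]≡[n+1]C[k+1]; nCn≡1; nC1≡n; k>n⇒nCk≡0)
open import Data.Nat.Induction using (<-rec)
open import Data.Product using (_,_; proj₁; proj₂; ∃-syntax)
open import Data.Sum using (_⊎_; inj₁; inj₂; [_,_]′)
open import Level using (0ℓ)
open import Relation.Binary.Definitions using (tri<; tri≈; tri>)
open import Relation.Binary.PropositionalEquality using (refl; sym; trans; cong; cong₂; subst; subst₂; module ≡-Reasoning)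
open import Relation.Nullary using (¬_; Dec; yes; no)

-- Power series

-- Everything stays in ℤ. The root is taken of 1 + k² t instead of 1 + t, and homogenised evaluation
-- at t = m / (k² Q) restores 1 + m / Q. Real roots never occur: integers are compared through their
-- k-th powers. The index at which the approximants take over is forced by exponents. Eliminating Q′
-- between `Large` at r and `Small` at r + 2 leaves Q² against Q^((k-2)(r+1)), up to powers of m and
-- constants. The second wins from r = 0 on if k ≥ 5, but only from r = 1 on if k = 4 and from r = 2
-- on if k = 3. Below that index only the gap principle is available, so for k = 3 and k = 4 further
-- members between the two solutions must push Q′ past the uncovered range. For k ≤ 5 members in
-- front of Q also serve to make Q outweigh m and the constants. The three smallest members, these
-- auxiliary ones, Q and Q′ together number r_k + 1: five for k ≥ 6, six for k = 5, seven for k = 4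
-- and ten for k = 3.

Series : Set
Series = ℕ → ℤ

tail : Series → Series
tail f n = f (suc n)

infixl 6 _✢_
infixl 7 _✶_ _·_

_✢_ : Series → Series → Series
(f ✢ g) n = f n ⊕ g n

neg : Series → Series
neg f n = ⊖ f n

_·_ : ℤ → Series → Series
(z · f) n = z ⊗ f n

const : ℤ → Series
const z zero    = z
const z (suc _) = 0ℤ

t : Series
t zero    = 0ℤ
t (suc n) = const 1ℤ n

_✶_ : Series → Series → Series
(f ✶ g) zero    = f 0 ⊗ g 0
(f ✶ g) (suc n) = f 0 ⊗ g (suc n) ⊕ (tail f ✶ g) n

-- The Euler derivation t d/dt.
θ : Series → Series
θ f n = pos n ⊗ f n

infixr 8 _↑_
_↑_ : Series → ℕ → Series
f ↑ zero    = const 1ℤ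
f ↑ (suc n) = f ✶ (f ↑ n)

✶-cong : ∀ {f f′ g g′} n → (∀ j → j ≤ n → f j ≡ f′ j) → (∀ j → j ≤ n → g j ≡ g′ j) →
         (f ✶ g) n ≡ (f′ ✶ g′) n
✶-cong zero    p q = cong₂ _⊗_ (p 0 z≤n) (q 0 z≤n)
✶-cong (suc n) p q = cong₂ _⊕_ (cong₂ _⊗_ (p 0 z≤n) (q (suc n) ℕ.≤-refl))
  (✶-cong n (λ j j≤n → p (suc j) (s≤s j≤n)) (λ j j≤n → q j (ℕ.m≤n⇒m≤1+n j≤n)))

-- The product recurses on its left factor; peeling the right factor instead is the symmetry that
-- commutativity rests on.
✶-sucʳ : ∀ f g n → (f ✶ g) (suc n) ≡ (f ✶ tail g) n ⊕ f (suc n) ⊗ g 0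
✶-sucʳ f g zero    = refl
✶-sucʳ f g (suc n) = trans (cong (f 0 ⊗ g (suc (suc n)) ⊕_) (✶-sucʳ (tail f) g n))
  (sym (ℤ.+-assoc (f 0 ⊗ g (suc (suc n))) ((tail f ✶ tail g) n) (f (suc (suc n)) ⊗ g 0)))

✶-comm : ∀ f g n → (f ✶ g) n ≡ (g ✶ f) n
✶-comm f g zero    = ℤ.*-comm (f 0) (g 0)
✶-comm f g (suc n) = trans (cong₂ _⊕_ (ℤ.*-comm (f 0) (g (suc n))) (✶-comm (tail f) g n))
  (trans (ℤ.+-comm (g (suc n) ⊗ f 0) ((g ✶ tail f) n)) (sym (✶-sucʳ g f n)))

·-✶ : ∀ z f g n → ((z · f) ✶ g) n ≡ z ⊗ (f ✶ g) n
·-✶ z f g zero    = ℤ.*-assoc z (f 0) (g 0)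
·-✶ z f g (suc n) = trans (cong₂ _⊕_ (ℤ.*-assoc z (f 0) (g (suc n))) (·-✶ z (tail f) g n))
  (sym (ℤ.*-distribˡ-+ z (f 0 ⊗ g (suc n)) ((tail f ✶ g) n)))

✶-distribʳ : ∀ h f g n → ((f ✢ g) ✶ h) n ≡ (f ✶ h) n ⊕ (g ✶ h) n
✶-distribʳ h f g zero    = ℤ.*-distribʳ-+ (h 0) (f 0) (g 0)
✶-distribʳ h f g (suc n) = trans
  (cong₂ _⊕_ (ℤ.*-distribʳ-+ (h (suc n)) (f 0) (g 0)) (✶-distribʳ h (tail f) (tail g) n))
  (interchange (f 0 ⊗ h (suc n)) (g 0 ⊗ h (suc n)) ((tail f ✶ h) n) ((tail g ✶ h) n))
  where
  interchange : ∀ a b c d → (a ⊕ b) ⊕ (c ⊕ d) ≡ (a ⊕ c) ⊕ (b ⊕ d)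
  interchange = ℤ-Solver.solve-∀

✶-assoc : ∀ f g h n → ((f ✶ g) ✶ h) n ≡ (f ✶ (g ✶ h)) n
✶-assoc f g h zero    = ℤ.*-assoc (f 0) (g 0) (h 0)
✶-assoc f g h (suc n) = trans
  (cong (f 0 ⊗ g 0 ⊗ h (suc n) ⊕_)
    (trans (✶-distribʳ h (f 0 · tail g) (tail f ✶ g) n)
      (cong₂ _⊕_ (·-✶ (f 0) (tail g) h n) (✶-assoc (tail f) g h n))))
  (regroup (f 0) (g 0) (h (suc n)) ((tail g ✶ h) n) ((tail f ✶ (g ✶ h)) n))
  where
  regroup : ∀ a b c d e → a ⊗ b ⊗ c ⊕ (a ⊗ d ⊕ e) ≡ a ⊗ (b ⊗ c ⊕ d) ⊕ e
  regroup = ℤ-Solver.solve-∀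

zero-✶ : ∀ f g n → (∀ j → f j ≡ 0ℤ) → (f ✶ g) n ≡ 0ℤ
zero-✶ f g zero    p rewrite p 0 = ℤ.*-zeroˡ (g 0)
zero-✶ f g (suc n) p rewrite p 0 | zero-✶ (tail f) g n (λ j → p (suc j)) | ℤ.*-zeroˡ (g (suc n)) = refl

const-✶ : ∀ z g n → (const z ✶ g) n ≡ z ⊗ g n
const-✶ z g zero    = refl
const-✶ z g (suc n) = trans (cong (z ⊗ g (suc n) ⊕_) (zero-✶ _ g n (λ _ → refl))) (ℤ.+-identityʳ _)

t-✶-suc : ∀ g n → (t ✶ g) (suc n) ≡ g n
t-✶-suc g n = trans (cong₂ _⊕_ (ℤ.*-zeroˡ (g (suc n))) (const-✶ 1ℤ g n))
  (trans (ℤ.+-identityˡ _) (ℤ.*-identityˡ (g n)))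

-- The Leibniz rule. The induction has to correct for θ not commuting with `tail`: the tail of θ f
-- is θ (tail f) + tail f.
θ-✶ : ∀ f g n → θ (f ✶ g) n ≡ (θ f ✶ g) n ⊕ (f ✶ θ g) n
θ-✶ f g zero = lemma (f 0) (g 0)
  where
  lemma : ∀ a b → 0ℤ ⊗ (a ⊗ b) ≡ 0ℤ ⊗ a ⊗ b ⊕ a ⊗ (0ℤ ⊗ b)
  lemma = ℤ-Solver.solve-∀
θ-✶ f g (suc n) = trans
  (expand (pos n) (f 0) (g (suc n)) ((tail f ✶ g) n) ((θ (tail f) ✶ g) n) ((tail f ✶ θ g) n) (θ-✶ (tail f) g n))
  (cong (_⊕ (f ✶ θ g) (suc n)) (cong (0ℤ ⊗ f 0 ⊗ g (suc n) ⊕_) (sym tail-θ)))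
  where
  expand : ∀ i a b c d e → i ⊗ c ≡ d ⊕ e →
    (1ℤ ⊕ i) ⊗ (a ⊗ b ⊕ c) ≡ (0ℤ ⊗ a ⊗ b ⊕ (d ⊕ c)) ⊕ (a ⊗ ((1ℤ ⊕ i) ⊗ b) ⊕ e)
  expand i a b c d e eq = trans (open₁ i a b c) (trans (cong (λ x → (1ℤ ⊕ i) ⊗ (a ⊗ b) ⊕ c ⊕ x) eq) (open₂ i a b c d e))
    where
    open₁ : ∀ i a b c → (1ℤ ⊕ i) ⊗ (a ⊗ b ⊕ c) ≡ (1ℤ ⊕ i) ⊗ (a ⊗ b) ⊕ c ⊕ i ⊗ c
    open₁ = ℤ-Solver.solve-∀
    open₂ : ∀ i a b c d e → (1ℤ ⊕ i) ⊗ (a ⊗ b) ⊕ c ⊕ (d ⊕ e) ≡ (0ℤ ⊗ a ⊗ b ⊕ (d ⊕ c)) ⊕ (a ⊗ ((1ℤ ⊕ i) ⊗ b) ⊕ e)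
    open₂ = ℤ-Solver.solve-∀
  tail-θ : (tail (θ f) ✶ g) n ≡ (θ (tail f) ✶ g) n ⊕ (tail f ✶ g) n
  tail-θ = trans (✶-cong n (λ j _ → split (pos j) (f (suc j))) (λ _ _ → refl)) (✶-distribʳ g (θ (tail f)) (tail f) n)
    where
    split : ∀ i a → (1ℤ ⊕ i) ⊗ a ≡ i ⊗ a ⊕ a
    split = ℤ-Solver.solve-∀

-- ℤ[[t]] / t^M.
module Mod (M : ℕ) where

  infix 4 _≋_
  record _≋_ (f g : Series) : Set where
    constructor up-to
    field coefficient : ∀ j → j < M → f j ≡ g j
  open _≋_ public

  exact : ∀ {f g} → (∀ j → f j ≡ g j) → f ≋ g
  exact p = up-to λ j _ → p j

  const0-zero : ∀ j → const 0ℤ j ≡ 0ℤ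
  const0-zero zero    = refl
  const0-zero (suc j) = refl

  ring : CommutativeRing 0ℓ 0ℓ
  ring = record
    { Carrier = Series ; _≈_ = _≋_ ; _+_ = _✢_ ; _*_ = _✶_ ; -_ = neg
    ; 0# = const 0ℤ ; 1# = const 1ℤ
    ; isCommutativeRing = record
      { isRing = record
        { +-isAbelianGroup = record
          { isGroup = record
            { isMonoid = record
              { isSemigroup = record
                { isMagma = record
                  { isEquivalence = record
                    { refl = exact λ _ → refl
                    ; sym = λ p → up-to λ j q → sym (coefficient p j q)
                    ; trans = λ p p′ → up-to λ j q → trans (coefficient p j q) (coefficient p′ j q) }
                  ; ∙-cong = λ p p′ → up-to λ j q → cong₂ _⊕_ (coefficient p j q) (coefficient p′ j q) }
                ; assoc = λ f g h → exact λ j → ℤ.+-assoc (f j) (g j) (h j) }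
              ; identity = (λ f → exact λ j → trans (cong (_⊕ f j) (const0-zero j)) (ℤ.+-identityˡ (f j)))
                         , (λ f → exact λ j → trans (cong (f j ⊕_) (const0-zero j)) (ℤ.+-identityʳ (f j))) }
            ; inverse = (λ f → exact λ j → trans (ℤ.+-inverseˡ (f j)) (sym (const0-zero j)))
                      , (λ f → exact λ j → trans (ℤ.+-inverseʳ (f j)) (sym (const0-zero j)))
            ; ⁻¹-cong = λ p → up-to λ j q → cong ⊖_ (coefficient p j q) }
          ; comm = λ f g → exact λ j → ℤ.+-comm (f j) (g j) }
        ; *-cong = λ p p′ → up-to λ j q → ✶-cong j (λ i i≤j → coefficient p i (ℕ.≤-<-trans i≤j q))
                                                  (λ i i≤j → coefficient p′ i (ℕ.≤-<-trans i≤j q))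
        ; *-assoc = λ f g h → exact (✶-assoc f g h)
        ; *-identity = (λ f → exact λ j → trans (const-✶ 1ℤ f j) (ℤ.*-identityˡ (f j)))
                     , (λ f → exact λ j → trans (✶-comm f (const 1ℤ) j) (trans (const-✶ 1ℤ f j) (ℤ.*-identityˡ (f j))))
        ; distrib = (λ h f g → exact λ j → trans (✶-comm h (f ✢ g) j) (trans (✶-distribʳ h f g j) (cong₂ _⊕_ (✶-comm f h j) (✶-comm g h j))))
                  , (λ h f g → exact (✶-distribʳ h f g)) }
      ; *-comm = λ f g → exact (✶-comm f g) } }

  open CommutativeRing ring public
    using (setoid; +-cong; *-cong; +-comm; *-comm; *-assoc; -‿cong; *-identityˡ; *-identityʳ)
    renaming (refl to ≋-refl; sym to ≋-sym; trans to ≋-trans)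

  almostRing : ACR.AlmostCommutativeRing 0ℓ 0ℓ
  almostRing = ACR.fromCommutativeRing ring

  const-homomorphism : CommutativeRing.rawRing ℤ.+-*-commutativeRing ACR.-Raw-AlmostCommutative⟶ almostRing
  const-homomorphism = record
    { ⟦_⟧ = const
    ; +-homo = λ x y → exact λ { zero → refl ; (suc j) → refl }
    ; *-homo = λ x y → exact λ { zero → refl ; (suc j) → sym (trans (const-✶ x (const y) (suc j)) (ℤ.*-zeroʳ x)) }
    ; -‿homo = λ x → exact λ { zero → refl ; (suc j) → refl }
    ; 0-homo = exact λ _ → refl
    ; 1-homo = exact λ _ → refl
    }

  const-≟ : ∀ x y → Maybe (const x ≋ const y)
  const-≟ x y with x ℤ.≟ y
  ... | yes refl = just (exact λ _ → refl)
  ... | no _     = nothing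

  module Solver = Algebra.Solver.Ring (CommutativeRing.rawRing ℤ.+-*-commutativeRing) almostRing const-homomorphism const-≟

-- Powers of series and the integral k-th root of 1 + k² t

mono : ℤ → ℕ → Series
mono z zero          = const z
mono z (suc d) zero    = 0ℤ
mono z (suc d) (suc j) = mono z d j

mono-✶-< : ∀ z d g j → j < d → (mono z d ✶ g) j ≡ 0ℤ
mono-✶-< z (suc d) g zero    _         = ℤ.*-zeroˡ (g 0)
mono-✶-< z (suc d) g (suc j) (s≤s j<d) =
  trans (cong₂ _⊕_ (ℤ.*-zeroˡ (g (suc j))) (mono-✶-< z d g j j<d)) refl

mono-✶-≡ : ∀ z d g → (mono z d ✶ g) d ≡ z ⊗ g 0
mono-✶-≡ z zero    g = refl
mono-✶-≡ z (suc d) g = trans (cong₂ _⊕_ (ℤ.*-zeroˡ (g (suc d))) (mono-✶-≡ z d g)) (ℤ.+-identityˡ _)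

↑-zero-coefficient : ∀ f n → f 0 ≡ 1ℤ → (f ↑ n) 0 ≡ 1ℤ
↑-zero-coefficient f zero    p = refl
↑-zero-coefficient f (suc n) p = cong₂ _⊗_ p (↑-zero-coefficient f n p)

-- The factor k² makes the coefficients of the k-th root integral.
φ : ℕ → Series
φ k = const 1ℤ ✢ const (pos (k * k)) ✶ t

module Powers (L : ℕ) where
  open Mod L public
  open Solver using (_:+_; _:*_; _:-_; _:=_; solve; con)
  open import Relation.Binary.Reasoning.Setoid setoid

  ✢-congˡ : ∀ h {f g} → f ≋ g → h ✢ f ≋ h ✢ g
  ✢-congˡ h p = +-cong (≋-refl {h}) p

  ✢-congʳ : ∀ h {f g} → f ≋ g → f ✢ h ≋ g ✢ h
  ✢-congʳ h p = +-cong p (≋-refl {h})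

  ✶-congˡ : ∀ h {f g} → f ≋ g → h ✶ f ≋ h ✶ g
  ✶-congˡ h p = *-cong (≋-refl {h}) p

  ✶-congʳ : ∀ h {f g} → f ≋ g → f ✶ h ≋ g ✶ h
  ✶-congʳ h p = *-cong p (≋-refl {h})

  θ-cong : ∀ {f g} → f ≋ g → θ f ≋ θ g
  θ-cong p = up-to λ j q → cong (pos j ⊗_) (coefficient p j q)

  θ-const : ∀ z → θ (const z) ≋ const 0ℤ
  θ-const z = exact λ { zero → ℤ.*-zeroˡ z ; (suc j) → ℤ.*-zeroʳ (pos (suc j)) }

  θ-product : ∀ f g → θ (f ✶ g) ≋ θ f ✶ g ✢ f ✶ θ g
  θ-product f g = exact (θ-✶ f g)

  θ-t : θ t ≋ t
  θ-t = exact λ { zero → refl ; (suc zero) → refl ; (suc (suc j)) → ℤ.*-zeroʳ (pos (suc (suc j))) }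

  ↑-cong : ∀ {f g} n → f ≋ g → f ↑ n ≋ g ↑ n
  ↑-cong zero    p = ≋-refl
  ↑-cong (suc n) p = *-cong p (↑-cong n p)

  ↑-+ : ∀ f m n → f ↑ (m + n) ≋ (f ↑ m) ✶ (f ↑ n)
  ↑-+ f zero    n = ≋-sym (*-identityˡ _)
  ↑-+ f (suc m) n = ≋-trans (✶-congˡ f (↑-+ f m n)) (≋-sym (*-assoc f (f ↑ m) (f ↑ n)))

  ✶-↑ : ∀ f g n → (f ✶ g) ↑ n ≋ (f ↑ n) ✶ (g ↑ n)
  ✶-↑ f g zero    = ≋-sym (*-identityˡ _)
  ✶-↑ f g (suc n) = ≋-trans (✶-congˡ (f ✶ g) (✶-↑ f g n))
    (solve 4 (λ f g F G → (f :* g) :* (F :* G) := (f :* F) :* (g :* G)) ≋-refl f g (f ↑ n) (g ↑ n))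

  const-suc : ∀ n → const (pos (suc n)) ≋ const 1ℤ ✢ const (pos n)
  const-suc n = exact λ { zero → refl ; (suc j) → refl }

  θ-↑ : ∀ f n → θ (f ↑ suc n) ≋ const (pos (suc n)) ✶ ((f ↑ n) ✶ θ f)
  θ-↑ f zero = begin
    θ (f ✶ const 1ℤ)                  ≈⟨ θ-cong (≋-trans (*-comm f _) (*-identityˡ f)) ⟩
    θ f                                ≈⟨ ≋-trans (*-identityˡ _) (*-identityˡ _) ⟨
    const 1ℤ ✶ (const 1ℤ ✶ θ f)      ∎
  θ-↑ f (suc n) = begin
    θ (f ✶ (f ↑ suc n))
      ≈⟨ θ-product f (f ↑ suc n) ⟩
    θ f ✶ (f ↑ suc n) ✢ f ✶ θ (f ↑ suc n)
      ≈⟨ ✢-congˡ (θ f ✶ (f ↑ suc n)) (✶-congˡ f (θ-↑ f n)) ⟩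
    θ f ✶ (f ✶ (f ↑ n)) ✢ f ✶ (const (pos (suc n)) ✶ ((f ↑ n) ✶ θ f))
      ≈⟨ solve 4 (λ f f₁ F c → f₁ :* (f :* F) :+ f :* (c :* (F :* f₁)) := (con 1ℤ :+ c) :* ((f :* F) :* f₁)) ≋-refl
           f (θ f) (f ↑ n) (const (pos (suc n))) ⟩
    (const 1ℤ ✢ const (pos (suc n))) ✶ ((f ✶ (f ↑ n)) ✶ θ f)
      ≈⟨ ✶-congʳ ((f ↑ suc n) ✶ θ f) (const-suc (suc n)) ⟨
    const (pos (suc (suc n))) ✶ ((f ↑ suc n) ✶ θ f) ∎

  const-cancel : ∀ n f g → const (pos (suc n)) ✶ f ≋ const (pos (suc n)) ✶ g → f ≋ g
  const-cancel n f g p = up-to λ j q → ℤ.*-cancelˡ-≡ (pos (suc n)) (f j) (g j)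
    (trans (sym (const-✶ _ f j)) (trans (coefficient p j q) (const-✶ _ g j)))

  const-* : ∀ m n → const (pos (m * n)) ≋ const (pos m) ✶ const (pos n)
  const-* m n = exact λ j → trans (cong (λ z → const z j) (ℤ.pos-* m n)) (lemma j)
    where
    lemma : ∀ j → const (pos m ⊗ pos n) j ≡ (const (pos m) ✶ const (pos n)) j
    lemma zero    = refl
    lemma (suc j) = sym (trans (const-✶ (pos m) (const (pos n)) (suc j)) (ℤ.*-zeroʳ (pos m)))

  θ-φ : ∀ k → θ (φ k) ≋ const (pos (k * k)) ✶ t
  θ-φ k = begin
    θ (φ k)                            ≈⟨ exact (λ j → ℤ.*-distribˡ-+ (pos j) (const 1ℤ j) ((const K ✶ t) j)) ⟩
    θ (const 1ℤ) ✢ θ (const K ✶ t)    ≈⟨ +-cong (θ-const 1ℤ) (θ-product (const K) t) ⟩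
    const 0ℤ ✢ (θ (const K) ✶ t ✢ const K ✶ θ t)
      ≈⟨ ✢-congˡ (const 0ℤ) (+-cong (✶-congʳ t (θ-const K)) (✶-congˡ (const K) θ-t)) ⟩
    const 0ℤ ✢ (const 0ℤ ✶ t ✢ const K ✶ t)
      ≈⟨ solve 2 (λ t c → con 0ℤ :+ (con 0ℤ :* t :+ c :* t) := c :* t) ≋-refl t (const K) ⟩
    const K ✶ t ∎
    where
    K : ℤ
    K = pos (k * k)

  -- Logarithmic derivatives add under multiplication: θ u / u = c t / φ becomes n c t / φ for the
  -- n-th power. Denominators are cleared throughout.
  ↑-logarithmic : ∀ k u c → φ k ✶ θ u ≋ const c ✶ (t ✶ u) → ∀ n →
    φ k ✶ θ (u ↑ n) ≋ const (pos n) ✶ (const c ✶ (t ✶ (u ↑ n)))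
  ↑-logarithmic k u c p zero = begin
    φ k ✶ θ (const 1ℤ)    ≈⟨ ✶-congˡ (φ k) (θ-const 1ℤ) ⟩
    φ k ✶ const 0ℤ        ≈⟨ solve 3 (λ x d t → x :* con 0ℤ := con 0ℤ :* (d :* (t :* con 1ℤ))) ≋-refl (φ k) (const c) t ⟩
    const 0ℤ ✶ (const c ✶ (t ✶ const 1ℤ)) ∎
  ↑-logarithmic k u c p (suc n) = begin
    φ k ✶ θ (u ↑ suc n)
      ≈⟨ ✶-congˡ (φ k) (θ-↑ u n) ⟩
    φ k ✶ (N ✶ ((u ↑ n) ✶ θ u))
      ≈⟨ solve 4 (λ x y U u₁ → x :* (y :* (U :* u₁)) := y :* (U :* (x :* u₁))) ≋-refl (φ k) N (u ↑ n) (θ u) ⟩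
    N ✶ ((u ↑ n) ✶ (φ k ✶ θ u))
      ≈⟨ ✶-congˡ N (✶-congˡ (u ↑ n) p) ⟩
    N ✶ ((u ↑ n) ✶ (const c ✶ (t ✶ u)))
      ≈⟨ solve 5 (λ y U d t u → y :* (U :* (d :* (t :* u))) := y :* (d :* (t :* (u :* U)))) ≋-refl N (u ↑ n) (const c) t u ⟩
    N ✶ (const c ✶ (t ✶ (u ↑ suc n))) ∎
    where
    N : Series
    N = const (pos (suc n))

  -- Newton's method needs just the constant and linear terms in δ. For δ divisible by k, both the
  -- linear term, which carries the exponent as a factor, and the remainder δ² R are divisible by k²
  -- when the exponent is k.
  binomial-remainder : ∀ f δ n → ∃[ R ] (f ✢ δ) ↑ suc n ≋
    f ↑ suc n ✢ (const (pos (suc n)) ✶ ((f ↑ n) ✶ δ) ✢ δ ✶ (δ ✶ R))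
  binomial-remainder f δ zero = const 0ℤ ,
    solve 2 (λ f d → (f :+ d) :* con 1ℤ := f :* con 1ℤ :+ (con 1ℤ :* (con 1ℤ :* d) :+ d :* (d :* con 0ℤ))) ≋-refl f δ
  binomial-remainder f δ (suc n) with binomial-remainder f δ n
  ... | R , p = N ✶ (f ↑ n) ✢ (f ✢ δ) ✶ R , (begin
    (f ✢ δ) ✶ ((f ✢ δ) ↑ suc n)
      ≈⟨ ✶-congˡ (f ✢ δ) p ⟩
    (f ✢ δ) ✶ (f ✶ (f ↑ n) ✢ (N ✶ ((f ↑ n) ✶ δ) ✢ δ ✶ (δ ✶ R)))
      ≈⟨ solve 5 (λ f d F c R → (f :+ d) :* (f :* F :+ (c :* (F :* d) :+ d :* (d :* R))) :=
           f :* (f :* F) :+ ((con 1ℤ :+ c) :* ((f :* F) :* d) :+ d :* (d :* (c :* F :+ (f :+ d) :* R)))) ≋-refl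
           f δ (f ↑ n) N R ⟩
    f ↑ suc (suc n) ✢ ((const 1ℤ ✢ N) ✶ ((f ↑ suc n) ✶ δ) ✢ δ ✶ (δ ✶ (N ✶ (f ↑ n) ✢ (f ✢ δ) ✶ R)))
      ≈⟨ ✢-congˡ (f ↑ suc (suc n)) (✢-congʳ (δ ✶ (δ ✶ (N ✶ (f ↑ n) ✢ (f ✢ δ) ✶ R))) (✶-congʳ ((f ↑ suc n) ✶ δ) (const-suc (suc n)))) ⟨
    f ↑ suc (suc n) ✢ (const (pos (suc (suc n))) ✶ ((f ↑ suc n) ✶ δ) ✢ δ ✶ (δ ✶ (N ✶ (f ↑ n) ✢ (f ✢ δ) ✶ R))) ∎)
    where
    N : Series
    N = const (pos (suc n))

  -- Hensel lifting: each step corrects one coefficient, and the error stays divisible by k².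
  approximate-root : ∀ k d → ∃[ f ] ∃[ q ] f 0 ≡ 1ℤ × (∀ j → j < suc d → q j ≡ 0ℤ) ×
    f ↑ suc k ≋ φ (suc k) ✢ const (pos (suc k * suc k)) ✶ q
  approximate-root k zero = const 1ℤ , neg t , refl , (λ { zero _ → refl ; (suc _) (s≤s ()) }) , (begin
    const 1ℤ ↑ suc k                 ≈⟨ 1↑ (suc k) ⟩
    const 1ℤ                         ≈⟨ solve 2 (λ c t → con 1ℤ := con 1ℤ :+ c :* t :+ c :* (Solver.:- t)) ≋-refl (const K) t ⟩
    φ (suc k) ✢ const K ✶ neg t     ∎)
    where
    K : ℤ
    K = pos (suc k * suc k)
    1↑ : ∀ n → const 1ℤ ↑ n ≋ const 1ℤ
    1↑ zero    = ≋-refl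
    1↑ (suc n) = ≋-trans (*-identityˡ _) (1↑ n)
  approximate-root k (suc d) with approximate-root k d
  ... | f , q , f0 , q0 , p = f ✢ N ✶ e , q ✢ ((f ↑ k) ✶ e ✢ e ✶ (e ✶ R)) , f′0 , q′0 , (begin
    (f ✢ N ✶ e) ↑ suc k
      ≈⟨ proj₂ (binomial-remainder f (N ✶ e) k) ⟩
    f ↑ suc k ✢ (N ✶ ((f ↑ k) ✶ (N ✶ e)) ✢ N ✶ e ✶ (N ✶ e ✶ R))
      ≈⟨ ✢-congʳ rest p ⟩
    φ (suc k) ✢ const K ✶ q ✢ (N ✶ ((f ↑ k) ✶ (N ✶ e)) ✢ N ✶ e ✶ (N ✶ e ✶ R))
      ≈⟨ ✢-congʳ rest (✢-congˡ (φ (suc k)) (✶-congʳ q (const-* (suc k) (suc k)))) ⟩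
    φ (suc k) ✢ (N ✶ N) ✶ q ✢ (N ✶ ((f ↑ k) ✶ (N ✶ e)) ✢ N ✶ e ✶ (N ✶ e ✶ R))
      ≈⟨ solve 6 (λ x n q F e R → x :+ (n :* n) :* q :+ (n :* (F :* (n :* e)) :+ n :* e :* (n :* e :* R)) :=
           x :+ (n :* n) :* (q :+ (F :* e :+ e :* (e :* R)))) ≋-refl (φ (suc k)) N q (f ↑ k) e R ⟩
    φ (suc k) ✢ (N ✶ N) ✶ (q ✢ ((f ↑ k) ✶ e ✢ e ✶ (e ✶ R)))
      ≈⟨ ✢-congˡ (φ (suc k)) (✶-congʳ (q ✢ ((f ↑ k) ✶ e ✢ e ✶ (e ✶ R))) (const-* (suc k) (suc k))) ⟨
    φ (suc k) ✢ const K ✶ (q ✢ ((f ↑ k) ✶ e ✢ e ✶ (e ✶ R))) ∎)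
    where
    K : ℤ
    K = pos (suc k * suc k)
    N e R rest : Series
    N = const (pos (suc k))
    -- The correction added to f is k e. As the power of f has constant term 1, its linear effect on
    -- q in degree d + 1 is exactly - q (d + 1), and lower degrees are untouched; the quadratic term
    -- starts in higher degree.
    e = mono (⊖ q (suc d)) (suc d)
    rest = N ✶ ((f ↑ k) ✶ (N ✶ e)) ✢ N ✶ e ✶ (N ✶ e ✶ R)
    R = proj₁ (binomial-remainder f (N ✶ e) k)
    f′0 : f 0 ⊕ pos (suc k) ⊗ 0ℤ ≡ 1ℤ
    f′0 = trans (cong₂ _⊕_ f0 (ℤ.*-zeroʳ (pos (suc k)))) refl
    q′0 : ∀ j → j < suc (suc d) → q j ⊕ (((f ↑ k) ✶ e) j ⊕ (e ✶ (e ✶ R)) j) ≡ 0ℤ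
    q′0 j (s≤s j≤1+d) with ℕ.m≤n⇒m<n∨m≡n j≤1+d
    ... | inj₁ j<1+d = cong₂ _⊕_ (q0 j j<1+d)
      (cong₂ _⊕_ (trans (✶-comm (f ↑ k) e j) (mono-✶-< _ (suc d) (f ↑ k) j j<1+d)) (mono-✶-< _ (suc d) (e ✶ R) j j<1+d))
    ... | inj₂ refl = trans (cong (q (suc d) ⊕_)
      (cong₂ _⊕_ (trans (✶-comm (f ↑ k) e (suc d)) (trans (mono-✶-≡ (⊖ q (suc d)) (suc d) (f ↑ k)) (cong (⊖ q (suc d) ⊗_) (↑-zero-coefficient f k f0))))
        (trans (mono-✶-≡ (⊖ q (suc d)) (suc d) (e ✶ R)) (cong (⊖ q (suc d) ⊗_) (ℤ.*-zeroˡ (R 0))))))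
      (cancel (q (suc d)))
      where
      cancel : ∀ x → x ⊕ (⊖ x ⊗ 1ℤ ⊕ ⊖ x ⊗ 0ℤ) ≡ 0ℤ
      cancel = ℤ-Solver.solve-∀

  root : ∀ k → ∃[ f ] f 0 ≡ 1ℤ × f ↑ suc k ≋ φ (suc k)
  root k with approximate-root k L
  ... | f , q , f0 , q0 , p = f , f0 , ≋-trans p (≋-trans
    (✢-congˡ (φ (suc k)) (✶-congˡ (const (pos (suc k * suc k))) (up-to λ j j<L → trans (q0 j (ℕ.m≤n⇒m≤1+n j<L)) (sym (const0-zero j)))))
    (solve 2 (λ x c → x :+ c :* con 0ℤ := x) ≋-refl (φ (suc k)) (const (pos (suc k * suc k)))))

  module _ (k : ℕ) (f : Series) (f↑k : f ↑ suc k ≋ φ (suc k)) where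

    private
      N : Series
      N = const (pos (suc k))

    -- Both sides of θ (f^k) = θ (1 + k² t) contain a factor k, which cancels over ℤ; the exponent k
    -- is `suc k` here.
    root-derivative : (f ↑ k) ✶ θ f ≋ N ✶ t
    root-derivative = const-cancel k _ _ (begin
      N ✶ ((f ↑ k) ✶ θ f)      ≈⟨ θ-↑ f k ⟨
      θ (f ↑ suc k)             ≈⟨ θ-cong f↑k ⟩
      θ (φ (suc k))             ≈⟨ θ-φ (suc k) ⟩
      const (pos (suc k * suc k)) ✶ t   ≈⟨ ✶-congʳ t (const-* (suc k) (suc k)) ⟩
      N ✶ N ✶ t                ≈⟨ *-assoc N N t ⟩
      N ✶ (N ✶ t) ∎)

    root-logarithmic : φ (suc k) ✶ θ f ≋ N ✶ (t ✶ f)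
    root-logarithmic = begin
      φ (suc k) ✶ θ f              ≈⟨ ✶-congʳ (θ f) f↑k ⟨
      f ✶ (f ↑ k) ✶ θ f            ≈⟨ *-assoc f (f ↑ k) (θ f) ⟩
      f ✶ ((f ↑ k) ✶ θ f)          ≈⟨ ✶-congˡ f root-derivative ⟩
      f ✶ (N ✶ t)                  ≈⟨ solve 3 (λ f n t → f :* (n :* t) := n :* (t :* f)) ≋-refl f N t ⟩
      N ✶ (t ✶ f) ∎

    -- Coefficientwise this links degree j + 1 of the power e + k of f to degree j of the power e.
    -- Raising the order of the approximant by one shifts the powers by k, so this compares the
    -- leading coefficients of consecutive approximants.
    root-power-shift : ∀ e → θ (f ↑ suc (e + k)) ≋ const (pos (suc (e + k))) ✶ (N ✶ (t ✶ (f ↑ e)))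
    root-power-shift e = begin
      θ (f ↑ suc (e + k))                       ≈⟨ θ-↑ f (e + k) ⟩
      E ✶ ((f ↑ (e + k)) ✶ θ f)                ≈⟨ ✶-congˡ E (✶-congʳ (θ f) (↑-+ f e k)) ⟩
      E ✶ ((f ↑ e) ✶ (f ↑ k) ✶ θ f)             ≈⟨ ✶-congˡ E (*-assoc (f ↑ e) (f ↑ k) (θ f)) ⟩
      E ✶ ((f ↑ e) ✶ ((f ↑ k) ✶ θ f))           ≈⟨ ✶-congˡ E (✶-congˡ (f ↑ e) root-derivative) ⟩
      E ✶ ((f ↑ e) ✶ (N ✶ t))                   ≈⟨ solve 4 (λ c F n t → c :* (F :* (n :* t)) := c :* (n :* (t :* F))) ≋-refl E (f ↑ e) N t ⟩
      E ✶ (N ✶ (t ✶ (f ↑ e))) ∎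
      where
      E : Series
      E = const (pos (suc (e + k)))

-- Padé approximants

C-absorption : ∀ n k → (suc n C suc k) * suc k ≡ (n C k) * suc n
C-absorption zero    zero    = refl
C-absorption zero    (suc k) = refl
C-absorption (suc n) zero    = trans (cong (_* 1) (nC1≡n (suc (suc n)))) (trans (ℕ.*-identityʳ _) (sym (ℕ.*-identityˡ _)))
C-absorption (suc n) (suc k) = begin
  (suc (suc n) C suc (suc k)) * suc (suc k)
    ≡⟨ cong (_* suc (suc k)) (nCk+nC[k+1]≡[n+1]C[k+1] (suc n) (suc k)) ⟨
  (x + y) * suc (suc k)
    ≡⟨ split x y k ⟩
  x + x * suc k + y * suc (suc k)
    ≡⟨ cong₂ (λ u v → x + u + v) (C-absorption n k) (C-absorption n (suc k)) ⟩
  x + (n C k) * suc n + (n C suc k) * suc n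
    ≡⟨ cong (λ z → z + (n C k) * suc n + (n C suc k) * suc n) (nCk+nC[k+1]≡[n+1]C[k+1] n k) ⟨
  (n C k) + (n C suc k) + (n C k) * suc n + (n C suc k) * suc n
    ≡⟨ join (n C k) (n C suc k) n ⟩
  ((n C k) + (n C suc k)) * suc (suc n)
    ≡⟨ cong (_* suc (suc n)) (nCk+nC[k+1]≡[n+1]C[k+1] n k) ⟩
  x * suc (suc n) ∎
  where
  open ≡-Reasoning
  x y : ℕ
  x = suc n C suc k
  y = suc n C suc (suc k)
  split : ∀ x y k → (x + y) * suc (suc k) ≡ x + x * suc k + y * suc (suc k)
  split = ℕ-Solver.solve-∀
  join : ∀ u v n → u + v + u * suc n + v * suc n ≡ (u + v) * suc (suc n)
  join = ℕ-Solver.solve-∀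

-- Absorption together with Pascal's rule: (n - k) C(n+1, k+1) = (n + 1) C(n, k+1), with the
-- subtraction moved to the other side.
C-step : ∀ n k → (n C suc k) * suc n + (suc n C suc k) * suc k ≡ (suc n C suc k) * suc n
C-step n k = begin
  (n C suc k) * suc n + (suc n C suc k) * suc k   ≡⟨ cong ((n C suc k) * suc n +_) (C-absorption n k) ⟩
  (n C suc k) * suc n + (n C k) * suc n           ≡⟨ join (n C k) (n C suc k) n ⟩
  ((n C k) + (n C suc k)) * suc n                   ≡⟨ cong (_* suc n) (nCk+nC[k+1]≡[n+1]C[k+1] n k) ⟩
  (suc n C suc k) * suc n ∎
  where
  open ≡-Reasoning
  join : ∀ u v n → v * suc n + u * suc n ≡ (u + v) * suc n
  join = ℕ-Solver.solve-∀

C-step-ℤ : ∀ n k → pos (n C suc k) ⊗ pos (suc n) ≡ pos (suc n C suc k) ⊗ (pos (suc n) ⊝ pos (suc k))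
C-step-ℤ n k = solve-for (pos (n C suc k) ⊗ pos (suc n)) (pos (suc n C suc k)) (pos (suc n)) (pos (suc k)) (begin
  pos (n C suc k) ⊗ pos (suc n) ⊕ pos (suc n C suc k) ⊗ pos (suc k)
    ≡⟨ cong₂ _⊕_ (ℤ.pos-* (n C suc k) (suc n)) (ℤ.pos-* (suc n C suc k) (suc k)) ⟨
  pos ((n C suc k) * suc n + (suc n C suc k) * suc k)
    ≡⟨ cong pos (C-step n k) ⟩
  pos ((suc n C suc k) * suc n)
    ≡⟨ ℤ.pos-* (suc n C suc k) (suc n) ⟩
  pos (suc n C suc k) ⊗ pos (suc n) ∎)
  where
  open ≡-Reasoning
  solve-for : ∀ x b c d → x ⊕ b ⊗ d ≡ b ⊗ c → x ≡ b ⊗ (c ⊝ d)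
  solve-for x b c d p = trans (add x (b ⊗ d)) (trans (cong (_⊝ b ⊗ d) p) (factor b c d))
    where
    add : ∀ x y → x ≡ x ⊕ y ⊝ y
    add = ℤ-Solver.solve-∀
    factor : ∀ b c d → b ⊗ c ⊝ b ⊗ d ≡ b ⊗ (c ⊝ d)
    factor = ℤ-Solver.solve-∀

✶-leading : ∀ f g j → (∀ i → i < j → g i ≡ 0ℤ) → (f ✶ g) j ≡ f 0 ⊗ g j
✶-leading f g zero    p = refl
✶-leading f g (suc j) p = trans (cong (f 0 ⊗ g (suc j) ⊕_) (trans
    (✶-cong {g′ = const 0ℤ} j (λ _ _ → refl) (λ i i≤j → trans (p i (s≤s i≤j)) (sym (const0 i))))
    (trans (✶-comm (tail f) (const 0ℤ) j) (trans (const-✶ 0ℤ (tail f) j) (ℤ.*-zeroˡ (tail f j))))))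
  (ℤ.+-identityʳ _)
  where
  const0 : ∀ j → const 0ℤ j ≡ 0ℤ
  const0 zero    = refl
  const0 (suc j) = refl

φ-✶-suc : ∀ k u j → (φ k ✶ u) (suc j) ≡ u (suc j) ⊕ pos (k * k) ⊗ u j
φ-✶-suc k u j = begin
  (φ k ✶ u) (suc j)
    ≡⟨ ✶-distribʳ u (const 1ℤ) (const K ✶ t) (suc j) ⟩
  (const 1ℤ ✶ u) (suc j) ⊕ (const K ✶ t ✶ u) (suc j)
    ≡⟨ cong₂ _⊕_ (trans (const-✶ 1ℤ u (suc j)) (ℤ.*-identityˡ _))
         (trans (✶-assoc (const K) t u (suc j)) (trans (const-✶ K (t ✶ u) (suc j)) (cong (K ⊗_) (t-✶-suc u j)))) ⟩
  u (suc j) ⊕ K ⊗ u j ∎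
  where
  open ≡-Reasoning
  K : ℤ
  K = pos (k * k)

-- The numerator and denominator of the r-th diagonal Padé approximant of (1 + x)^(1/k) have the coefficients
-- C(2r-j, r) C(r ± 1/k, j); here h is the power of the root whose j-th coefficient is k^(2j) C(r ± 1/k, j).
padé : ℕ → Series → Series
padé deg h j = pos ((2 * deg ∸ j) C deg) ⊗ h j

-- With h 0 = 1 and c = k s the solution is h j = k^(2j) C(s/k, j). Working from the recurrence
-- avoids binomial coefficients with rational upper argument.
BinomialRecurrence : ℕ → ℕ → ℤ → Series → Set
BinomialRecurrence k L c h = ∀ j → suc j < L → pos (suc j) ⊗ h (suc j) ≡ (c ⊝ pos (k * k) ⊗ pos j) ⊗ h j

logarithmic⇒recurrence : ∀ k L c h → (let open Mod L) → φ k ✶ θ h ≋ const c ✶ (t ✶ h) → BinomialRecurrence k L c h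
logarithmic⇒recurrence k L c h p j j<L = rearrange (pos (suc j) ⊗ h (suc j)) c K (pos j) (h j) (begin
  pos (suc j) ⊗ h (suc j) ⊕ K ⊗ (pos j ⊗ h j)   ≡⟨ φ-✶-suc k (θ h) j ⟨
  (φ k ✶ θ h) (suc j)                            ≡⟨ Mod.coefficient p (suc j) j<L ⟩
  (const c ✶ (t ✶ h)) (suc j)                    ≡⟨ const-✶ c (t ✶ h) (suc j) ⟩
  c ⊗ (t ✶ h) (suc j)                            ≡⟨ cong (c ⊗_) (t-✶-suc h j) ⟩
  c ⊗ h j ∎)
  where
  open ≡-Reasoning
  K : ℤ
  K = pos (k * k)
  rearrange : ∀ x c K i y → x ⊕ K ⊗ (i ⊗ y) ≡ c ⊗ y → x ≡ (c ⊝ K ⊗ i) ⊗ y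
  rearrange x c K i y p = trans (add x (K ⊗ (i ⊗ y))) (trans (cong (_⊝ K ⊗ (i ⊗ y)) p) (factor c K i y))
    where
    add : ∀ x y → x ≡ x ⊕ y ⊝ y
    add = ℤ-Solver.solve-∀
    factor : ∀ c K i y → c ⊗ y ⊝ K ⊗ (i ⊗ y) ≡ (c ⊝ K ⊗ i) ⊗ y
    factor = ℤ-Solver.solve-∀

module _ (k deg′ L : ℕ) (c : ℤ) (h : Series) (rec : BinomialRecurrence k L c h) where
  private
    deg : ℕ
    deg = suc deg′
    K ρ : ℤ
    K = pos (k * k)
    ρ = pos deg
    open ≡-Reasoning

  -- The ratio of consecutive coefficients is hypergeometric: lowering the upper entry of C(2r-j, r)
  -- contributes (r - j) / (2r - j), and the recurrence for h contributes the rest.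
  padé-recurrence : ∀ j → j < 2 * deg → suc j < L →
    pos (suc j) ⊗ (pos 2 ⊗ ρ ⊝ pos j) ⊗ padé deg h (suc j) ≡ (ρ ⊝ pos j) ⊗ (c ⊝ K ⊗ pos j) ⊗ padé deg h j
  padé-recurrence j j<2r j<L = begin
    pos (suc j) ⊗ (pos 2 ⊗ ρ ⊝ pos j) ⊗ (pos (n C deg) ⊗ h (suc j))
      ≡⟨ swap₁ (pos (suc j)) (pos 2 ⊗ ρ ⊝ pos j) (pos (n C deg)) (h (suc j)) ⟩
    pos (n C deg) ⊗ (pos 2 ⊗ ρ ⊝ pos j) ⊗ (pos (suc j) ⊗ h (suc j))
      ≡⟨ cong₂ (λ u v → pos (n C deg) ⊗ u ⊗ v) 2ρ-j (rec j j<L) ⟩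
    pos (n C deg) ⊗ pos (suc n) ⊗ ((c ⊝ K ⊗ pos j) ⊗ h j)
      ≡⟨ cong (_⊗ ((c ⊝ K ⊗ pos j) ⊗ h j)) (C-step-ℤ n deg′) ⟩
    pos (suc n C deg) ⊗ (pos (suc n) ⊝ ρ) ⊗ ((c ⊝ K ⊗ pos j) ⊗ h j)
      ≡⟨ cong (λ u → pos (suc n C deg) ⊗ (u ⊝ ρ) ⊗ ((c ⊝ K ⊗ pos j) ⊗ h j)) 2ρ-j ⟨
    pos (suc n C deg) ⊗ (pos 2 ⊗ ρ ⊝ pos j ⊝ ρ) ⊗ ((c ⊝ K ⊗ pos j) ⊗ h j)
      ≡⟨ swap₂ (pos (suc n C deg)) ρ (pos j) (c ⊝ K ⊗ pos j) (h j) ⟩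
    (ρ ⊝ pos j) ⊗ (c ⊝ K ⊗ pos j) ⊗ (pos (suc n C deg) ⊗ h j)
      ≡⟨ cong (λ u → (ρ ⊝ pos j) ⊗ (c ⊝ K ⊗ pos j) ⊗ (pos (u C deg) ⊗ h j)) 1+n ⟩
    (ρ ⊝ pos j) ⊗ (c ⊝ K ⊗ pos j) ⊗ (pos ((2 * deg ∸ j) C deg) ⊗ h j) ∎
    where
    n : ℕ
    n = 2 * deg ∸ suc j
    1+n : suc n ≡ 2 * deg ∸ j
    1+n = sym (ℕ.+-∸-assoc 1 j<2r)
    2ρ-j : pos 2 ⊗ ρ ⊝ pos j ≡ pos (suc n)
    2ρ-j = begin
      pos 2 ⊗ ρ ⊝ pos j      ≡⟨ cong (_⊝ pos j) (ℤ.pos-* 2 deg) ⟨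
      pos (2 * deg) ⊝ pos j   ≡⟨ ℤ.m-n≡m⊖n (2 * deg) j ⟩
      (2 * deg) ℤ.⊖ j         ≡⟨ ℤ.⊖-≥ (ℕ.<⇒≤ j<2r) ⟩
      pos (2 * deg ∸ j)       ≡⟨ cong pos 1+n ⟨
      pos (suc n) ∎
    swap₁ : ∀ a b x y → a ⊗ b ⊗ (x ⊗ y) ≡ x ⊗ b ⊗ (a ⊗ y)
    swap₁ = ℤ-Solver.solve-∀
    swap₂ : ∀ x ρ j c y → x ⊗ (pos 2 ⊗ ρ ⊝ j ⊝ ρ) ⊗ (c ⊗ y) ≡ (ρ ⊝ j) ⊗ c ⊗ (x ⊗ y)
    swap₂ = ℤ-Solver.solve-∀

  -- The recurrence is the hypergeometric equation θ (θ - 2r - 1) a + t (θ - r) (K θ - c) a = 0. Its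
  -- exponents at t = 0 are 0 and 2r + 1; the second one becomes the order of contact of the
  -- approximants.
  padé-equation : suc (2 * deg) ≤ L → (let open Mod (suc (2 * deg)); a = padé deg h) →
    θ (θ a) ✢ t ✶ (K · θ (θ a) ✢ (⊖ (ρ ⊗ K ⊕ c)) · θ a ✢ (ρ ⊗ c) · a) ≋ (pos 2 ⊗ ρ ⊕ 1ℤ) · θ a
  padé-equation 1+2r≤L = Mod.up-to λ { zero _ → at0 (padé deg h 0) (w 0) ρ ; (suc j) (s≤s j<2r) → at-suc j j<2r }
    where
    a w : Series
    a = padé deg h
    w = K · θ (θ a) ✢ (⊖ (ρ ⊗ K ⊕ c)) · θ a ✢ (ρ ⊗ c) · a
    at0 : ∀ x w ρ → 0ℤ ⊗ (0ℤ ⊗ x) ⊕ 0ℤ ⊗ w ≡ (pos 2 ⊗ ρ ⊕ 1ℤ) ⊗ (0ℤ ⊗ x)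
    at0 = ℤ-Solver.solve-∀
    at-suc : ∀ j → j < 2 * deg → θ (θ a) (suc j) ⊕ (t ✶ w) (suc j) ≡ (pos 2 ⊗ ρ ⊕ 1ℤ) ⊗ θ a (suc j)
    at-suc j j<2r = begin
      pos (suc j) ⊗ (pos (suc j) ⊗ a (suc j)) ⊕ (t ✶ w) (suc j)
        ≡⟨ cong (pos (suc j) ⊗ (pos (suc j) ⊗ a (suc j)) ⊕_) (t-✶-suc w j) ⟩
      pos (suc j) ⊗ (pos (suc j) ⊗ a (suc j)) ⊕ w j
        ≡⟨ cong (pos (suc j) ⊗ (pos (suc j) ⊗ a (suc j)) ⊕_) (factor K ρ c (pos j) (a j)) ⟩
      pos (suc j) ⊗ (pos (suc j) ⊗ a (suc j)) ⊕ (ρ ⊝ pos j) ⊗ (c ⊝ K ⊗ pos j) ⊗ a j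
        ≡⟨ cong (pos (suc j) ⊗ (pos (suc j) ⊗ a (suc j)) ⊕_) (padé-recurrence j j<2r (ℕ.<-≤-trans (s≤s j<2r) 1+2r≤L)) ⟨
      pos (suc j) ⊗ (pos (suc j) ⊗ a (suc j)) ⊕ pos (suc j) ⊗ (pos 2 ⊗ ρ ⊝ pos j) ⊗ a (suc j)
        ≡⟨ collect (pos j) ρ (a (suc j)) ⟩
      (pos 2 ⊗ ρ ⊕ 1ℤ) ⊗ (pos (suc j) ⊗ a (suc j)) ∎
      where
      factor : ∀ K ρ c i x → K ⊗ (i ⊗ (i ⊗ x)) ⊕ (⊖ (ρ ⊗ K ⊕ c)) ⊗ (i ⊗ x) ⊕ (ρ ⊗ c) ⊗ x ≡ (ρ ⊝ i) ⊗ (c ⊝ K ⊗ i) ⊗ x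
      factor = ℤ-Solver.solve-∀
      collect : ∀ i ρ x → (1ℤ ⊕ i) ⊗ ((1ℤ ⊕ i) ⊗ x) ⊕ (1ℤ ⊕ i) ⊗ (pos 2 ⊗ ρ ⊝ i) ⊗ x ≡ (pos 2 ⊗ ρ ⊕ 1ℤ) ⊗ ((1ℤ ⊕ i) ⊗ x)
      collect = ℤ-Solver.solve-∀

-- Order of contact of the approximants, by a Wronskian

weaken : ∀ {M L f g} → M ≤ L → Mod._≋_ L f g → Mod._≋_ M f g
weaken M≤L p = Mod.up-to λ j j<M → Mod.coefficient p j (ℕ.<-≤-trans j<M M≤L)

φ-unit : ∀ M k u → (let open Mod M) → φ k ✶ u ≋ const 0ℤ → u ≋ const 0ℤ
φ-unit M k u p = Mod.up-to λ j j<M → trans (<-rec P step j j<M) (sym (Mod.const0-zero M j))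
  where
  P : ℕ → Set
  P j = j < M → u j ≡ 0ℤ
  step : ∀ j → (∀ {i} → i < j → P i) → P j
  step j below j<M = begin
    u j                ≡⟨ leading (u j) K ⟨
    φ k 0 ⊗ u j        ≡⟨ ✶-leading (φ k) u j (λ i i<j → below i<j (ℕ.<-trans i<j j<M)) ⟨
    (φ k ✶ u) j        ≡⟨ Mod.coefficient p j j<M ⟩
    const 0ℤ j         ≡⟨ Mod.const0-zero M j ⟩
    0ℤ ∎
    where
    open ≡-Reasoning
    K : ℤ
    K = pos (k * k)
    leading : ∀ x K → (1ℤ ⊕ K ⊗ 0ℤ) ⊗ x ≡ x
    leading = ℤ-Solver.solve-∀

-- The coefficient of t^j satisfies (N + 1 - j) u j = 0, and the first factor is nonzero in every
-- degree that the modulus t^(N+1) sees.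
eigenvector : ∀ N u → (let open Mod (suc N)) → θ u ≋ (pos N ⊕ 1ℤ) · u → u ≋ const 0ℤ
eigenvector N u p = Mod.up-to λ j j<M → trans (ℤ.*-cancelˡ-≡ (pos (suc N) ⊝ pos j) (u j) 0ℤ ⦃ ≢0 j j<M ⦄
    (trans (difference (pos N) (pos j) (u j)) (trans (cong (λ x → (pos N ⊕ 1ℤ) ⊗ u j ⊝ x) (Mod.coefficient p j j<M))
      (trans (ℤ.+-inverseʳ ((pos N ⊕ 1ℤ) ⊗ u j)) (sym (ℤ.*-zeroʳ (pos (suc N) ⊝ pos j))))))) (sym (Mod.const0-zero (suc N) j))
  where
  difference : ∀ n i x → (1ℤ ⊕ n ⊝ i) ⊗ x ≡ (n ⊕ 1ℤ) ⊗ x ⊝ i ⊗ x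
  difference = ℤ-Solver.solve-∀
  ≢0 : ∀ j → j < suc N → ℤ.NonZero (pos (suc N) ⊝ pos j)
  ≢0 j j<M = ℤ.≢-nonZero λ eq → ℕ.<⇒≢ j<M (sym (ℤ.+-injective (ℤ.i-j≡0⇒i≡j (pos (suc N)) (pos j) eq)))

module _ (k′ deg′ : ℕ) where
  private
    k deg M : ℕ
    k = suc k′
    deg = suc deg′
    M = suc (2 * deg)
    ρ K κ : ℤ
    ρ = pos deg
    K = pos (k * k)
    κ = pos k
  open Powers M
  open Solver using (_:+_; _:*_; _:-_; _:=_; solve; con)
  open import Relation.Binary.Reasoning.Setoid setoid

  ·-const : ∀ z f → z · f ≋ const z ✶ f
  ·-const z f = exact λ j → sym (const-✶ z f j)

  PadéEquation : ℤ → Series → Set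
  PadéEquation c a = θ (θ a) ✢ t ✶ (K · θ (θ a) ✢ (⊖ (ρ ⊗ K ⊕ c)) · θ a ✢ (ρ ⊗ c) · a) ≋ (pos 2 ⊗ ρ ⊕ 1ℤ) · θ a

  -- This is φ a b times the logarithmic derivative of f a / b, with θ f / f replaced by k t / φ;
  -- hence f itself does not occur and both factors a and b enter polynomially.
  wronskian : Series → Series → Series
  wronskian a b = const κ ✶ (t ✶ (a ✶ b)) ✢ (const 1ℤ ✢ const κ ✶ const κ ✶ t) ✶ (θ a ✶ b ✢ neg (a ✶ θ b))

  -- `PadéEquation` for c = r k² + ε k with all terms on one side. Its scalars are spelled out in
  -- the constants k, r and ε so that an identity between residuals is a polynomial identity. The
  -- denominator has ε = -1, the numerator ε = 1.
  residual : ℤ → Series → Series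
  residual ε a = θ (θ a) ✢ t ✶ (N ✶ N ✶ θ (θ a) ✢ neg (R ✶ (N ✶ N) ✢ (R ✶ (N ✶ N) ✢ const ε ✶ N)) ✶ θ a ✢ R ✶ (R ✶ (N ✶ N) ✢ const ε ✶ N) ✶ a)
      ✢ neg ((R ✢ R ✢ const 1ℤ) ✶ θ a)
    where
    N R : Series
    N = const κ
    R = const ρ

  residual-zero : ∀ ε c a → c ≡ ρ ⊗ K ⊕ ε ⊗ κ → PadéEquation c a → residual ε a ≋ const 0ℤ
  residual-zero ε c a refl p = exact-first
    where
    N R : Series
    N = const κ
    R = const ρ
    pointwise : ∀ j → residual ε a j ≡ (θ (θ a) ✢ t ✶ (K · θ (θ a) ✢ (⊖ (ρ ⊗ K ⊕ c)) · θ a ✢ (ρ ⊗ c) · a)) j ⊝ ((pos 2 ⊗ ρ ⊕ 1ℤ) · θ a) j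
    pointwise j = cong₂ (λ x y → θ (θ a) j ⊕ x ⊕ ⊖ y)
      (✶-cong j (λ _ _ → refl) (λ i _ → coeff i))
      (trans (✶-cong j (λ i _ → hom₃ i) (λ _ _ → refl)) (const-✶ (pos 2 ⊗ ρ ⊕ 1ℤ) (θ a) j))
      where
      hom-KN : ∀ i → (N ✶ N) i ≡ const K i
      hom-KN i = sym (trans (cong (λ z → const z i) (ℤ.pos-* k k)) (helper i))
        where
        helper : ∀ i → const (κ ⊗ κ) i ≡ (N ✶ N) i
        helper zero    = refl
        helper (suc i) = sym (trans (const-✶ κ N (suc i)) (ℤ.*-zeroʳ κ))
      const-const : ∀ x y i → (const x ✶ const y) i ≡ const (x ⊗ y) i
      const-const x y zero    = refl
      const-const x y (suc i) = trans (const-✶ x (const y) (suc i)) (ℤ.*-zeroʳ x)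
      const-+ : ∀ x y i → const x i ⊕ const y i ≡ const (x ⊕ y) i
      const-+ x y zero    = refl
      const-+ x y (suc i) = refl
      const-neg : ∀ x i → ⊖ const x i ≡ const (⊖ x) i
      const-neg x zero    = refl
      const-neg x (suc i) = refl
      R-NN : ∀ i → (R ✶ (N ✶ N)) i ≡ const (ρ ⊗ K) i
      R-NN i = trans (✶-cong i (λ _ _ → refl) (λ l _ → hom-KN l)) (const-const ρ K i)
      cc : ∀ i → (R ✶ (N ✶ N) ✢ const ε ✶ N) i ≡ const c i
      cc i = trans (cong₂ _⊕_ (R-NN i) (const-const ε κ i)) (const-+ (ρ ⊗ K) (ε ⊗ κ) i)
      hom₃ : ∀ i → (R ✢ R ✢ const 1ℤ) i ≡ const (pos 2 ⊗ ρ ⊕ 1ℤ) i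
      hom₃ i = trans (cong (_⊕ const 1ℤ i) (const-+ ρ ρ i)) (trans (const-+ (ρ ⊕ ρ) 1ℤ i) (cong (λ z → const z i) (two ρ)))
        where
        two : ∀ x → x ⊕ x ⊕ 1ℤ ≡ pos 2 ⊗ x ⊕ 1ℤ
        two = ℤ-Solver.solve-∀
      scale : ∀ s z f i → (∀ l → s l ≡ const z l) → (s ✶ f) i ≡ (z · f) i
      scale s z f i q = trans (✶-cong i (λ l _ → q l) (λ _ _ → refl)) (const-✶ z f i)
      coeff : ∀ i → (N ✶ N ✶ θ (θ a) ✢ neg (R ✶ (N ✶ N) ✢ (R ✶ (N ✶ N) ✢ const ε ✶ N)) ✶ θ a ✢ R ✶ (R ✶ (N ✶ N) ✢ const ε ✶ N) ✶ a) i
                    ≡ (K · θ (θ a) ✢ (⊖ (ρ ⊗ K ⊕ c)) · θ a ✢ (ρ ⊗ c) · a) i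
      coeff i = cong₂ _⊕_ (cong₂ _⊕_ (scale _ K (θ (θ a)) i hom-KN)
          (scale _ (⊖ (ρ ⊗ K ⊕ c)) (θ a) i (λ l → trans (cong ⊖_ (trans (cong₂ _⊕_ (R-NN l) (cc l)) (const-+ (ρ ⊗ K) c l))) (const-neg (ρ ⊗ K ⊕ c) l))))
          (scale _ (ρ ⊗ c) a i (λ l → trans (✶-cong l (λ _ _ → refl) (λ l _ → cc l)) (const-const ρ c l)))
    exact-first : residual ε a ≋ const 0ℤ
    exact-first = up-to λ j j<M → trans (pointwise j) (trans (cong (_⊝ ((pos 2 ⊗ ρ ⊕ 1ℤ) · θ a) j) (coefficient p j j<M))
      (trans (ℤ.+-inverseʳ (((pos 2 ⊗ ρ ⊕ 1ℤ) · θ a) j)) (sym (const0-zero j))))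

  θ-neg : ∀ f → θ (neg f) ≋ neg (θ f)
  θ-neg f = exact λ j → sym (ℤ.neg-distribʳ-* (pos j) (f j))

  θ-✢ : ∀ f g → θ (f ✢ g) ≋ θ f ✢ θ g
  θ-✢ f g = exact λ j → ℤ.*-distribˡ-+ (pos j) (f j) (g j)

  θ-const-✶ : ∀ z f → θ (const z ✶ f) ≋ const z ✶ θ f
  θ-const-✶ z f = begin
    θ (const z ✶ f)                          ≈⟨ θ-product (const z) f ⟩
    θ (const z) ✶ f ✢ const z ✶ θ f          ≈⟨ ✢-congʳ (const z ✶ θ f) (✶-congʳ f (θ-const z)) ⟩
    const 0ℤ ✶ f ✢ const z ✶ θ f             ≈⟨ solve 3 (λ f g z → con 0ℤ :* f :+ z :* g := z :* g) ≋-refl f (θ f) (const z) ⟩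
    const z ✶ θ f ∎

  θ-wronskian : ∀ a b → θ (wronskian a b) ≋
    const κ ✶ (t ✶ (a ✶ b) ✢ t ✶ (θ a ✶ b ✢ a ✶ θ b)) ✢ (const κ ✶ const κ ✶ t ✶ (θ a ✶ b ✢ neg (a ✶ θ b))
      ✢ (const 1ℤ ✢ const κ ✶ const κ ✶ t) ✶ ((θ (θ a) ✶ b ✢ θ a ✶ θ b) ✢ neg (θ a ✶ θ b ✢ a ✶ θ (θ b))))
  θ-wronskian a b = begin
    θ (wronskian a b)
      ≈⟨ θ-✢ (N ✶ (t ✶ (a ✶ b))) (ψ ✶ v) ⟩
    θ (N ✶ (t ✶ (a ✶ b))) ✢ θ (ψ ✶ v)
      ≈⟨ +-cong (≋-trans (θ-const-✶ κ (t ✶ (a ✶ b))) (✶-congˡ N (≋-trans (θ-product t (a ✶ b))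
           (+-cong (✶-congʳ (a ✶ b) θ-t) (✶-congˡ t (θ-product a b))))))
         (≋-trans (θ-product ψ v) (+-cong (✶-congʳ v θ-ψ) (✶-congˡ ψ θ-v))) ⟩
    N ✶ (t ✶ (a ✶ b) ✢ t ✶ (θ a ✶ b ✢ a ✶ θ b)) ✢ (N ✶ N ✶ t ✶ v ✢ ψ ✶ ((θ (θ a) ✶ b ✢ θ a ✶ θ b) ✢ neg (θ a ✶ θ b ✢ a ✶ θ (θ b)))) ∎
    where
    N ψ v : Series
    N = const κ
    ψ = const 1ℤ ✢ N ✶ N ✶ t
    v = θ a ✶ b ✢ neg (a ✶ θ b)
    θ-ψ : θ ψ ≋ N ✶ N ✶ t
    θ-ψ = begin
      θ ψ                                  ≈⟨ θ-✢ (const 1ℤ) (N ✶ N ✶ t) ⟩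
      θ (const 1ℤ) ✢ θ (N ✶ N ✶ t)         ≈⟨ +-cong (θ-const 1ℤ) (≋-trans (θ-cong (*-assoc N N t)) (≋-trans (θ-const-✶ κ (N ✶ t)) (✶-congˡ N (≋-trans (θ-const-✶ κ t) (✶-congˡ N θ-t))))) ⟩
      const 0ℤ ✢ N ✶ (N ✶ t)               ≈⟨ solve 2 (λ n t → con 0ℤ :+ n :* (n :* t) := n :* n :* t) ≋-refl N t ⟩
      N ✶ N ✶ t ∎
    θ-v : θ v ≋ (θ (θ a) ✶ b ✢ θ a ✶ θ b) ✢ neg (θ a ✶ θ b ✢ a ✶ θ (θ b))
    θ-v = ≋-trans (θ-✢ (θ a ✶ b) (neg (a ✶ θ b))) (+-cong (θ-product (θ a) b) (≋-trans (θ-neg (a ✶ θ b)) (-‿cong (θ-product a (θ b)))))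

  -- The second-order equations of a and b differ only in the sign of ε, so that b times the
  -- residual of a minus a times the residual of b collapses to θ S - (2r+1) S, a first-order
  -- expression in the Wronskian S.
  wronskian-vanishes : ∀ a b → residual (⊖ 1ℤ) a ≋ const 0ℤ → residual 1ℤ b ≋ const 0ℤ → wronskian a b ≋ const 0ℤ
  wronskian-vanishes a b pa pb = eigenvector (2 * deg) (wronskian a b) (begin
    θ S
      ≈⟨ θ-wronskian a b ⟩
    const κ ✶ (t ✶ (a ✶ b) ✢ t ✶ (θ a ✶ b ✢ a ✶ θ b)) ✢ (const κ ✶ const κ ✶ t ✶ (θ a ✶ b ✢ neg (a ✶ θ b))
      ✢ (const 1ℤ ✢ const κ ✶ const κ ✶ t) ✶ ((θ (θ a) ✶ b ✢ θ a ✶ θ b) ✢ neg (θ a ✶ θ b ✢ a ✶ θ (θ b))))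
      ≈⟨ solve 9 (λ a a₁ a₂ b b₁ b₂ t N R →
           N :* (t :* (a :* b) :+ t :* (a₁ :* b :+ a :* b₁)) :+ (N :* N :* t :* (a₁ :* b :- a :* b₁)
             :+ (con 1ℤ :+ N :* N :* t) :* ((a₂ :* b :+ a₁ :* b₁) :- (a₁ :* b₁ :+ a :* b₂)))
           := (R :+ R :+ con 1ℤ) :* (N :* (t :* (a :* b)) :+ (con 1ℤ :+ N :* N :* t) :* (a₁ :* b :- a :* b₁))
             :+ (b :* (a₂ :+ t :* (N :* N :* a₂ :+ (Solver.:- (R :* (N :* N) :+ (R :* (N :* N) :+ con (⊖ 1ℤ) :* N))) :* a₁ :+ R :* (R :* (N :* N) :+ con (⊖ 1ℤ) :* N) :* a)
                 :- (R :+ R :+ con 1ℤ) :* a₁)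
               :- a :* (b₂ :+ t :* (N :* N :* b₂ :+ (Solver.:- (R :* (N :* N) :+ (R :* (N :* N) :+ con 1ℤ :* N))) :* b₁ :+ R :* (R :* (N :* N) :+ con 1ℤ :* N) :* b)
                 :- (R :+ R :+ con 1ℤ) :* b₁)))
         ≋-refl a (θ a) (θ (θ a)) b (θ b) (θ (θ b)) t (const κ) (const ρ) ⟩
    (const ρ ✢ const ρ ✢ const 1ℤ) ✶ S ✢ (b ✶ residual (⊖ 1ℤ) a ✢ neg (a ✶ residual 1ℤ b))
      ≈⟨ ✢-congˡ ((const ρ ✢ const ρ ✢ const 1ℤ) ✶ S) (+-cong (✶-congˡ b pa) (-‿cong (✶-congˡ a pb))) ⟩
    (const ρ ✢ const ρ ✢ const 1ℤ) ✶ S ✢ (b ✶ const 0ℤ ✢ neg (a ✶ const 0ℤ))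
      ≈⟨ solve 4 (λ x S a b → x :* S :+ (b :* con 0ℤ :- a :* con 0ℤ) := x :* S) ≋-refl (const ρ ✢ const ρ ✢ const 1ℤ) S a b ⟩
    (const ρ ✢ const ρ ✢ const 1ℤ) ✶ S
      ≈⟨ ✶-congʳ S (exact λ { zero → cong (λ z → pos z) (two deg) ; (suc j) → refl }) ⟩
    const (pos (2 * deg) ⊕ 1ℤ) ✶ S
      ≈⟨ ·-const _ S ⟨
    (pos (2 * deg) ⊕ 1ℤ) · S ∎)
    where
    S : Series
    S = wronskian a b
    two : ∀ deg → deg ℕ.+ deg ℕ.+ 1 ≡ 2 ℕ.* deg ℕ.+ 1
    two deg = cong (λ z → deg ℕ.+ z ℕ.+ 1) (sym (ℕ.+-identityʳ deg))

  -- The logarithmic derivative of f a / b vanishes to order 2r, hence so does f a - b.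
  padé-approximation : ∀ f a b → φ k ✶ θ f ≋ const κ ✶ (t ✶ f) → wronskian a b ≋ const 0ℤ →
    f 0 ≡ 1ℤ → a 0 ≡ b 0 → b 0 ≢ 0ℤ → f ✶ a ≋ b
  padé-approximation f a b pf pS f0 a0≡b0 b0≢0 = up-to λ j j<M →
      ℤ.i-j≡0⇒i≡j _ _ (<-rec P step j j<M)
    where
    N ψ D S : Series
    N = const κ
    ψ = const 1ℤ ✢ N ✶ N ✶ t
    D = f ✶ a ✢ neg b
    S = wronskian a b
    ψ≋φ : φ k ≋ ψ
    ψ≋φ = ✢-congˡ (const 1ℤ) (✶-congʳ t (const-* k k))
    θD : θ D ≋ (θ f ✶ a ✢ f ✶ θ a) ✢ neg (θ b)
    θD = ≋-trans (θ-✢ (f ✶ a) (neg b)) (+-cong (θ-product f a) (θ-neg b))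
    -- Quotient rule for D / b: after multiplication by φ the left side becomes f times the
    -- Wronskian.
    equation : b ✶ θ D ✢ neg (D ✶ θ b) ≋ const 0ℤ
    equation = φ-unit M k _ (begin
      φ k ✶ (b ✶ θ D ✢ neg (D ✶ θ b))
        ≈⟨ *-cong ψ≋φ (✢-congʳ (neg (D ✶ θ b)) (✶-congˡ b θD)) ⟩
      ψ ✶ (b ✶ ((θ f ✶ a ✢ f ✶ θ a) ✢ neg (θ b)) ✢ neg (D ✶ θ b))
        ≈⟨ solve 8 (λ f f₁ a a₁ b b₁ t N →
             (con 1ℤ :+ N :* N :* t) :* (b :* ((f₁ :* a :+ f :* a₁) :- b₁) :- (f :* a :- b) :* b₁)
             := a :* b :* ((con 1ℤ :+ N :* N :* t) :* f₁) :+ f :* (con 1ℤ :+ N :* N :* t) :* (a₁ :* b :- a :* b₁))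
           ≋-refl f (θ f) a (θ a) b (θ b) t N ⟩
      a ✶ b ✶ (ψ ✶ θ f) ✢ f ✶ ψ ✶ (θ a ✶ b ✢ neg (a ✶ θ b))
        ≈⟨ ✢-congʳ (f ✶ ψ ✶ (θ a ✶ b ✢ neg (a ✶ θ b))) (✶-congˡ (a ✶ b) (≋-trans (✶-congʳ (θ f) (≋-sym ψ≋φ)) pf)) ⟩
      a ✶ b ✶ (N ✶ (t ✶ f)) ✢ f ✶ ψ ✶ (θ a ✶ b ✢ neg (a ✶ θ b))
        ≈⟨ solve 7 (λ f a b N t x y → a :* b :* (N :* (t :* f)) :+ f :* x :* y := f :* (N :* (t :* (a :* b)) :+ x :* y))
           ≋-refl f a b N t ψ (θ a ✶ b ✢ neg (a ✶ θ b)) ⟩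
      f ✶ S
        ≈⟨ ✶-congˡ f pS ⟩
      f ✶ const 0ℤ
        ≈⟨ solve 1 (λ f → f :* con 0ℤ := con 0ℤ) ≋-refl f ⟩
      const 0ℤ ∎)
    P : ℕ → Set
    P j = j < M → D j ≡ 0ℤ
    step : ∀ j → (∀ {i} → i < j → P i) → P j
    step zero    below j<M = trans (cong₂ (λ x y → x ⊗ y ⊝ b 0) f0 a0≡b0) (trans (cong (_⊝ b 0) (ℤ.*-identityˡ (b 0))) (ℤ.+-inverseʳ (b 0)))
    -- If D vanishes below degree j + 1, the equation reduces in that degree to b 0 (j + 1) D (j +
    -- 1) = 0, because θ b has no constant term.
    step (suc j) below j<M = ℤ.*-cancelˡ-≡ (b 0 ⊗ pos (suc j)) (D (suc j)) 0ℤ ⦃ ℤ.i*j≢0 (b 0) (pos (suc j)) ⦃ ℤ.≢-nonZero b0≢0 ⦄ ⦄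
        (trans (regroup (b 0) (pos (suc j)) (D (suc j)) (θ b 0) refl) (trans (cong₂ (λ x y → x ⊝ y)
          (sym (✶-leading b (θ D) (suc j) (λ i i<j → trans (cong (pos i ⊗_) (D0 i i<j)) (ℤ.*-zeroʳ (pos i)))))
          (sym (trans (✶-comm D (θ b) (suc j)) (✶-leading (θ b) D (suc j) D0))))
        (trans (coefficient equation (suc j) j<M) (sym (ℤ.*-zeroʳ (b 0 ⊗ pos (suc j)))))))
      where
      D0 : ∀ i → i < suc j → D i ≡ 0ℤ
      D0 i i<j = below i<j (ℕ.<-trans i<j j<M)
      regroup : ∀ b i d z → z ≡ 0ℤ → b ⊗ i ⊗ d ≡ b ⊗ (i ⊗ d) ⊝ z ⊗ d
      regroup b i d _ refl = lemma b i d
        where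
        lemma : ∀ b i d → b ⊗ i ⊗ d ≡ b ⊗ (i ⊗ d) ⊝ 0ℤ ⊗ d
        lemma = ℤ-Solver.solve-∀

-- Coefficientwise majorants

⊗-nonneg : ∀ {x y} → 0ℤ ℤ.≤ x → 0ℤ ℤ.≤ y → 0ℤ ℤ.≤ x ⊗ y
⊗-nonneg {x} {y} p q = ℤ.≤-trans (ℤ.≤-reflexive (sym (ℤ.*-zeroʳ x))) (ℤ.*-monoˡ-≤-nonNeg x ⦃ ℤ.nonNegative p ⦄ q)

⊗-mono : ∀ {x y x′ y′} → 0ℤ ℤ.≤ x → x ℤ.≤ x′ → 0ℤ ℤ.≤ y → y ℤ.≤ y′ → x ⊗ y ℤ.≤ x′ ⊗ y′
⊗-mono {x} {y} {x′} {y′} 0≤x x≤x′ 0≤y y≤y′ = ℤ.≤-trans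
  (ℤ.*-monoˡ-≤-nonNeg x ⦃ ℤ.nonNegative 0≤x ⦄ y≤y′)
  (ℤ.*-monoʳ-≤-nonNeg y′ ⦃ ℤ.nonNegative (ℤ.≤-trans 0≤y y≤y′) ⦄ x≤x′)

infix 4 _⊑_
-- Nonnegativity of the smaller series is part of the relation, because it is what makes the
-- comparison compatible with products and powers.
_⊑_ : Series → Series → Set
f ⊑ g = ∀ j → 0ℤ ℤ.≤ f j × f j ℤ.≤ g j

NonNeg : Series → Set
NonNeg f = ∀ j → 0ℤ ℤ.≤ f j

⊑-upper : ∀ {f g} → f ⊑ g → NonNeg g
⊑-upper p j = ℤ.≤-trans (proj₁ (p j)) (proj₂ (p j))

⊑-refl : ∀ {f} → NonNeg f → f ⊑ f
⊑-refl p j = p j , ℤ.≤-refl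

✶-⊑ : ∀ {f f′ g g′} → f ⊑ f′ → g ⊑ g′ → f ✶ g ⊑ f′ ✶ g′
✶-⊑ p q zero    = ⊗-nonneg (proj₁ (p 0)) (proj₁ (q 0)) , ⊗-mono (proj₁ (p 0)) (proj₂ (p 0)) (proj₁ (q 0)) (proj₂ (q 0))
✶-⊑ p q (suc n) with ✶-⊑ (λ j → p (suc j)) q n
... | lo , hi = ℤ.+-mono-≤ (⊗-nonneg (proj₁ (p 0)) (proj₁ (q (suc n)))) lo
              , ℤ.+-mono-≤ (⊗-mono (proj₁ (p 0)) (proj₂ (p 0)) (proj₁ (q (suc n))) (proj₂ (q (suc n)))) hi

const-nonneg : ∀ {z} → 0ℤ ℤ.≤ z → NonNeg (const z)
const-nonneg p zero    = p
const-nonneg p (suc j) = ℤ.≤-refl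

↑-⊑ : ∀ {f g} n → f ⊑ g → f ↑ n ⊑ g ↑ n
↑-⊑ zero    p = ⊑-refl (const-nonneg (ℤ.+≤+ z≤n))
↑-⊑ (suc n) p = ✶-⊑ p (↑-⊑ n p)

φ-nonneg : ∀ k → NonNeg (φ k)
φ-nonneg k j = ℤ.+-mono-≤ (const-nonneg (ℤ.+≤+ z≤n) j)
  (ℤ.≤-trans (⊗-nonneg {pos (k * k)} (ℤ.+≤+ z≤n) (t-nonneg j)) (ℤ.≤-reflexive (sym (const-✶ (pos (k * k)) t j))))
  where
  t-nonneg : NonNeg t
  t-nonneg zero    = ℤ.≤-refl
  t-nonneg (suc j) = const-nonneg (ℤ.+≤+ z≤n) j

φ-⊒ : ∀ k f → NonNeg f → f ⊑ φ k ✶ f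
φ-⊒ k f p zero    = p 0 , ℤ.≤-reflexive (lemma (pos (k * k)) (f 0))
  where
  lemma : ∀ K x → x ≡ (1ℤ ⊕ K ⊗ 0ℤ) ⊗ x
  lemma = ℤ-Solver.solve-∀
φ-⊒ k f p (suc j) = p (suc j) , ℤ.≤-trans
  (ℤ.≤-trans (ℤ.≤-reflexive (sym (ℤ.+-identityʳ _))) (ℤ.+-monoʳ-≤ (f (suc j)) (⊗-nonneg {pos (k * k)} (ℤ.+≤+ z≤n) (p j))))
  (ℤ.≤-reflexive (sym (φ-✶-suc k f j)))

φ-↑-recurrence : ∀ k deg j → pos (suc j) ⊗ (φ k ↑ deg) (suc j) ≡ pos (k * k) ⊗ (pos deg ⊝ pos j) ⊗ (φ k ↑ deg) j
φ-↑-recurrence k deg j = trans (logarithmic⇒recurrence k (suc (suc j)) (pos deg ⊗ K) (φ k ↑ deg) equation j ℕ.≤-refl)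
    (factor (pos deg) K (pos j) ((φ k ↑ deg) j))
  where
  K : ℤ
  K = pos (k * k)
  open Powers (suc (suc j))
  open Solver using (_:+_; _:*_; _:-_; _:=_; solve; con)
  factor : ∀ deg K j x → (deg ⊗ K ⊝ K ⊗ j) ⊗ x ≡ K ⊗ (deg ⊝ j) ⊗ x
  factor = ℤ-Solver.solve-∀
  equation : φ k ✶ θ (φ k ↑ deg) ≋ const (pos deg ⊗ K) ✶ (t ✶ (φ k ↑ deg))
  equation = ≋-trans (↑-logarithmic k (φ k) K
      (≋-trans (✶-congˡ (φ k) (θ-φ k)) (solve 3 (λ x c t → x :* (c :* t) := c :* (t :* x)) ≋-refl (φ k) (const K) t)) deg)
    (≋-trans (≋-sym (*-assoc (const (pos deg)) (const K) (t ✶ (φ k ↑ deg))))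
      (✶-congʳ (t ✶ (φ k ↑ deg)) (exact λ { zero → refl ; (suc i) → trans (const-✶ (pos deg) (const K) (suc i)) (ℤ.*-zeroʳ (pos deg)) })))

central : ℕ → ℕ
central r = (2 * r) C r

C-positive : ∀ m n → n ≤ m → 0 < m C n
C-positive m       zero    _         = s≤s z≤n
C-positive (suc m) (suc n) (s≤s n≤m) = subst (0 <_) (nCk+nC[k+1]≡[n+1]C[k+1] m n) (ℕ.<-≤-trans (C-positive m n n≤m) (ℕ.m≤m+n _ _))

central-positive : ∀ r → 0 < central r
central-positive r = C-positive (2 * r) r (ℕ.m≤m+n r _)

-- With r = `suc deg′`, the denominator is the case d = k² - k and the numerator the case d = k² + k
-- of c = k² (r - 1) + d.
module _ (k deg′ L d : ℕ) (h : Series)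
  (rec : BinomialRecurrence k L (pos (k * k * deg′ + d)) h) (h0 : h 0 ≡ 1ℤ)
  (1+2r≤L : suc (2 * suc deg′) ≤ L) (0<d : 0 < d) (d≤2K : d ≤ 2 * (k * k)) where
  private
    deg : ℕ
    deg = suc deg′
    K c c₀ : ℤ
    K = pos (k * k)
    c = pos (k * k * deg′ + d)
    c₀ = pos (central deg)

  private
    factor : ∀ j i → deg′ ≡ j + i → c ⊝ K ⊗ pos j ≡ pos (k * k * i + d)
    factor j i refl = trans (cong (_⊝ K ⊗ pos j) (ℤ.pos-+ (k * k * (j + i)) d))
      (trans (cong (λ x → x ⊕ pos d ⊝ K ⊗ pos j) (trans (ℤ.pos-* (k * k) (j + i)) (cong (K ⊗_) (ℤ.pos-+ j i))))
      (trans (lemma K (pos j) (pos i) (pos d)) (trans (cong (_⊕ pos d) (sym (ℤ.pos-* (k * k) i))) (sym (ℤ.pos-+ (k * k * i) d)))))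
      where
      lemma : ∀ K j i d → K ⊗ (j ⊕ i) ⊕ d ⊝ K ⊗ j ≡ K ⊗ i ⊕ d
      lemma = ℤ-Solver.solve-∀

    ρ-factor : ∀ j i → deg′ ≡ j + i → pos deg ⊝ pos j ≡ pos (suc i)
    ρ-factor j i refl = trans (cong (λ x → 1ℤ ⊕ x ⊝ pos j) (ℤ.pos-+ j i)) (lemma (pos j) (pos i))
      where
      lemma : ∀ j i → 1ℤ ⊕ (j ⊕ i) ⊝ j ≡ 1ℤ ⊕ i
      lemma = ℤ-Solver.solve-∀

    2ρ-factor : ∀ j i → deg′ ≡ j + i → pos 2 ⊗ pos deg ⊝ pos j ≡ pos (suc (suc (j + (i + i))))
    2ρ-factor j i refl = trans (cong (λ x → pos 2 ⊗ (1ℤ ⊕ x) ⊝ pos j) (ℤ.pos-+ j i))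
      (trans (lemma (pos j) (pos i)) (cong (pos 2 ⊕_) (trans (cong (pos j ⊕_) (sym (ℤ.pos-+ i i))) (sym (ℤ.pos-+ j (i + i))))))
      where
      lemma : ∀ j i → pos 2 ⊗ (1ℤ ⊕ (j ⊕ i)) ⊝ j ≡ pos 2 ⊕ (j ⊕ (i ⊕ i))
      lemma = ℤ-Solver.solve-∀

    j<L : ∀ {j} → j < deg → suc j < L
    j<L {j} j<r = ℕ.<-≤-trans (s≤s (ℕ.<-≤-trans j<r (ℕ.m≤m+n deg (deg + 0)))) 1+2r≤L

  -- Each step of the recurrence multiplies by (c - K j) / (j + 1), and c - K j = K (deg′ - j) + d
  -- stays positive up to j = deg′.
  power-positive : ∀ j → j ≤ deg → 0ℤ ℤ.< h j
  power-positive zero    _   = subst (0ℤ ℤ.<_) (sym h0) (ℤ.+<+ (s≤s z≤n))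
  power-positive (suc j) j<r@(s≤s j≤r′) = ℤ.*-cancelˡ-<-nonNeg (pos (suc j)) (begin-strict
    pos (suc j) ⊗ 0ℤ                    ≡⟨ ℤ.*-zeroʳ (pos (suc j)) ⟩
    0ℤ                                   ≡⟨ ℤ.*-zeroʳ (pos e) ⟨
    pos e ⊗ 0ℤ                          <⟨ ℤ.*-monoˡ-<-pos (pos e) ⦃ ℤ.positive (ℤ.+<+ 0<e) ⦄ (power-positive j (ℕ.<⇒≤ j<r)) ⟩
    pos e ⊗ h j                         ≡⟨ cong (_⊗ h j) (factor j (deg′ ∸ j) (sym (ℕ.m+[n∸m]≡n j≤r′))) ⟨
    (c ⊝ K ⊗ pos j) ⊗ h j               ≡⟨ rec j (j<L j<r) ⟨
    pos (suc j) ⊗ h (suc j) ∎)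
    where
    open ℤ.≤-Reasoning
    e : ℕ
    e = k * k * (deg′ ∸ j) + d
    0<e : 0 < e
    0<e = ℕ.<-≤-trans 0<d (ℕ.m≤n+m d _)

  padé-degree : ∀ j → deg < j → padé deg h j ≡ 0ℤ
  padé-degree j r<j = trans (cong (λ z → pos z ⊗ h j) (k>n⇒nCk≡0 below)) (ℤ.*-zeroˡ (h j))
    where
    below : 2 * deg ∸ j < deg
    below = ℕ.≤-<-trans (ℕ.∸-monoʳ-≤ (2 * deg) r<j) (s≤s (ℕ.≤-reflexive
      (trans (cong (_∸ suc deg) (cong (deg +_) (ℕ.+-identityʳ deg))) (trans (cong (_∸ deg) (ℕ.+-suc deg′ deg′)) (ℕ.m+n∸m≡n deg deg′)))))

  padé-nonneg : NonNeg (padé deg h)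
  padé-nonneg j with j ℕ.≤? deg
  ... | yes j≤r = ⊗-nonneg {pos ((2 * deg ∸ j) C deg)} (ℤ.+≤+ z≤n) (ℤ.<⇒≤ (power-positive j j≤r))
  ... | no  j≰r = ℤ.≤-reflexive (sym (padé-degree j (ℕ.≰⇒> j≰r)))

  private
    G : Series
    G = φ k ↑ deg
    G-nonneg : NonNeg G
    G-nonneg = ⊑-upper (↑-⊑ deg (⊑-refl (φ-nonneg k)))

    bound : ∀ j → j ≤ deg → padé deg h j ℤ.≤ c₀ ⊗ G j
    bound zero    _   = ℤ.≤-reflexive (cong (c₀ ⊗_) (trans h0 (sym (↑-zero-coefficient (φ k) deg (lemma K)))))
      where
      lemma : ∀ K → 1ℤ ⊕ K ⊗ 0ℤ ≡ 1ℤ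
      lemma = ℤ-Solver.solve-∀
    bound (suc j) j<r@(s≤s j≤r′) = ℤ.*-cancelˡ-≤-pos _ _ (pos (suc j) ⊗ σ) ⦃ pos-σ ⦄ (begin
      pos (suc j) ⊗ σ ⊗ padé deg h (suc j)
        ≡⟨ cong (λ x → pos (suc j) ⊗ x ⊗ padé deg h (suc j)) (2ρ-factor j i eq) ⟨
      pos (suc j) ⊗ (pos 2 ⊗ pos deg ⊝ pos j) ⊗ padé deg h (suc j)
        ≡⟨ padé-recurrence k deg′ L c h rec j (ℕ.<-≤-trans j<r (ℕ.m≤m+n deg (deg + 0))) (j<L j<r) ⟩
      (pos deg ⊝ pos j) ⊗ (c ⊝ K ⊗ pos j) ⊗ padé deg h j
        ≡⟨ cong (_⊗ padé deg h j) (cong₂ _⊗_ (ρ-factor j i eq) (factor j i eq)) ⟩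
      pos (suc i) ⊗ pos (k * k * i + d) ⊗ padé deg h j
        ≤⟨ ⊗-mono (⊗-nonneg {pos (suc i)} {pos (k * k * i + d)} (ℤ.+≤+ z≤n) (ℤ.+≤+ z≤n))
             (ℤ.*-monoˡ-≤-nonNeg (pos (suc i)) (ℤ.≤-trans (ℤ.+≤+ d-bound) (ℤ.≤-reflexive (ℤ.pos-* (k * k) (suc (suc (j + (i + i))))))))
             (padé-nonneg j) (bound j (ℕ.<⇒≤ j<r)) ⟩
      pos (suc i) ⊗ (K ⊗ σ) ⊗ (c₀ ⊗ G j)
        ≡⟨ regroup₁ (pos (suc i)) K σ c₀ (G j) ⟩
      σ ⊗ c₀ ⊗ (K ⊗ pos (suc i) ⊗ G j)
        ≡⟨ cong (λ x → σ ⊗ c₀ ⊗ (K ⊗ x ⊗ G j)) (ρ-factor j i eq) ⟨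
      σ ⊗ c₀ ⊗ (K ⊗ (pos deg ⊝ pos j) ⊗ G j)
        ≡⟨ cong (σ ⊗ c₀ ⊗_) (φ-↑-recurrence k deg j) ⟨
      σ ⊗ c₀ ⊗ (pos (suc j) ⊗ G (suc j))
        ≡⟨ regroup₂ σ c₀ (pos (suc j)) (G (suc j)) ⟩
      pos (suc j) ⊗ σ ⊗ (c₀ ⊗ G (suc j)) ∎)
      where
      open ℤ.≤-Reasoning
      i : ℕ
      i = deg′ ∸ j
      eq : deg′ ≡ j + i
      eq = sym (ℕ.m+[n∸m]≡n j≤r′)
      σ : ℤ
      σ = pos (suc (suc (j + (i + i))))
      pos-σ : ℤ.Positive (pos (suc j) ⊗ σ)
      pos-σ = _
      d-bound : k * k * i + d ≤ k * k * suc (suc (j + (i + i)))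
      d-bound = ℕ.≤-trans (ℕ.+-monoʳ-≤ (k * k * i) d≤2K)
        (ℕ.≤-trans (ℕ.≤-reflexive (trans (cong (k * k * i +_) (ℕ.*-comm 2 (k * k))) (sym (ℕ.*-distribˡ-+ (k * k) i 2))))
          (ℕ.*-monoʳ-≤ (k * k) (ℕ.≤-trans (ℕ.≤-reflexive (ℕ.+-comm i 2))
            (s≤s (s≤s (ℕ.≤-trans (ℕ.m≤m+n i i) (ℕ.m≤n+m (i + i) j)))))))
      regroup₁ : ∀ i K σ c x → i ⊗ (K ⊗ σ) ⊗ (c ⊗ x) ≡ σ ⊗ c ⊗ (K ⊗ i ⊗ x)
      regroup₁ = ℤ-Solver.solve-∀
      regroup₂ : ∀ σ c j x → σ ⊗ c ⊗ (j ⊗ x) ≡ j ⊗ σ ⊗ (c ⊗ x)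
      regroup₂ = ℤ-Solver.solve-∀

  -- Both sides start with C(2r, r). A step on the left multiplies by (r - j) (c - K j) / ((j + 1)
  -- (2r - j)), a step on the right by K (r - j) / (j + 1); the first is smaller since d ≤ 2 K gives
  -- c - K j ≤ K (2r - j).
  padé-⊑ : padé deg h ⊑ const c₀ ✶ (φ k ↑ deg)
  padé-⊑ j = padé-nonneg j , ℤ.≤-trans upper (ℤ.≤-reflexive (sym (const-✶ c₀ G j)))
    where
    upper : padé deg h j ℤ.≤ c₀ ⊗ G j
    upper with j ℕ.≤? deg
    ... | yes j≤r = bound j j≤r
    ... | no  j≰r = ℤ.≤-trans (ℤ.≤-reflexive (padé-degree j (ℕ.≰⇒> j≰r))) (⊗-nonneg {c₀} (ℤ.+≤+ z≤n) (G-nonneg j))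

-- Homogeneous evaluation

Degree : ℕ → Series → Set
Degree d f = ∀ j → d < j → f j ≡ 0ℤ

-- ⟦ f ⟧ d u v is the homogeneous form Σ_{j≤d} f_j u^j v^(d-j).
⟦_⟧ : Series → ℕ → ℤ → ℤ → ℤ
⟦ f ⟧ zero    u v = f 0
⟦ f ⟧ (suc d) u v = f 0 ⊗ v ^ᶻ suc d ⊕ u ⊗ ⟦ tail f ⟧ d u v

tail-degree : ∀ {d f} → Degree (suc d) f → Degree d (tail f)
tail-degree p j d<j = p (suc j) (s≤s d<j)

Degree-≤ : ∀ {d e f} → d ≤ e → Degree d f → Degree e f
Degree-≤ d≤e p j e<j = p j (ℕ.≤-<-trans d≤e e<j)

const-degree : ∀ z → Degree 0 (const z)
const-degree z (suc j) _ = refl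

✶-degree : ∀ d e f g → Degree d f → Degree e g → Degree (d + e) (f ✶ g)
✶-degree d e f g p q (suc j) d+e<j = trans (cong₂ _⊕_
    (trans (cong (f 0 ⊗_) (q (suc j) (ℕ.≤-<-trans (ℕ.m≤n+m e d) d+e<j))) (ℤ.*-zeroʳ (f 0)))
    (rest d p d+e<j)) refl
  where
  rest : ∀ d → Degree d f → d + e < suc j → (tail f ✶ g) j ≡ 0ℤ
  rest zero    p _             = zero-✶ (tail f) g j (λ i → p (suc i) (s≤s z≤n))
  rest (suc d) p (s≤s d+e<j) = ✶-degree d e (tail f) g (tail-degree p) q j d+e<j

✶-top : ∀ d e f g → Degree d f → Degree e g → (f ✶ g) (d + e) ≡ f d ⊗ g e
✶-top zero    zero    f g p q = refl
✶-top zero    (suc e) f g p q = trans (cong (f 0 ⊗ g (suc e) ⊕_) (zero-✶ (tail f) g e (λ i → p (suc i) (s≤s z≤n)))) (ℤ.+-identityʳ _)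
✶-top (suc d) e       f g p q = trans (cong₂ _⊕_
    (trans (cong (f 0 ⊗_) (q (suc (d + e)) (s≤s (ℕ.m≤n+m e d)))) (ℤ.*-zeroʳ (f 0)))
    (✶-top d e (tail f) g (tail-degree p) q)) (ℤ.+-identityˡ _)

↑-degree : ∀ d f n → Degree d f → Degree (n * d) (f ↑ n)
↑-degree d f zero    p = const-degree 1ℤ
↑-degree d f (suc n) p = ✶-degree d (n * d) f (f ↑ n) p (↑-degree d f n p)

⟦⟧-cong : ∀ {f g} d u v → (∀ j → f j ≡ g j) → ⟦ f ⟧ d u v ≡ ⟦ g ⟧ d u v
⟦⟧-cong zero    u v p = p 0
⟦⟧-cong (suc d) u v p = cong₂ (λ x y → x ⊗ v ^ᶻ suc d ⊕ u ⊗ y) (p 0) (⟦⟧-cong d u v (λ j → p (suc j)))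

⟦⟧-✢ : ∀ f g d u v → ⟦ f ✢ g ⟧ d u v ≡ ⟦ f ⟧ d u v ⊕ ⟦ g ⟧ d u v
⟦⟧-✢ f g zero    u v = refl
⟦⟧-✢ f g (suc d) u v = trans (cong (λ x → (f 0 ⊕ g 0) ⊗ v ^ᶻ suc d ⊕ u ⊗ x) (⟦⟧-✢ (tail f) (tail g) d u v))
  (lemma (f 0) (g 0) (v ^ᶻ suc d) u (⟦ tail f ⟧ d u v) (⟦ tail g ⟧ d u v))
  where
  lemma : ∀ a b w u x y → (a ⊕ b) ⊗ w ⊕ u ⊗ (x ⊕ y) ≡ (a ⊗ w ⊕ u ⊗ x) ⊕ (b ⊗ w ⊕ u ⊗ y)
  lemma = ℤ-Solver.solve-∀

⟦⟧-· : ∀ z f d u v → ⟦ z · f ⟧ d u v ≡ z ⊗ ⟦ f ⟧ d u v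
⟦⟧-· z f zero    u v = refl
⟦⟧-· z f (suc d) u v = trans (cong (λ x → (z ⊗ f 0) ⊗ v ^ᶻ suc d ⊕ u ⊗ x) (⟦⟧-· z (tail f) d u v))
  (lemma z (f 0) (v ^ᶻ suc d) u (⟦ tail f ⟧ d u v))
  where
  lemma : ∀ z a w u x → (z ⊗ a) ⊗ w ⊕ u ⊗ (z ⊗ x) ≡ z ⊗ (a ⊗ w ⊕ u ⊗ x)
  lemma = ℤ-Solver.solve-∀

⟦⟧-neg : ∀ f d u v → ⟦ neg f ⟧ d u v ≡ ⊖ ⟦ f ⟧ d u v
⟦⟧-neg f d u v = trans (⟦⟧-cong d u v (λ j → sym (ℤ.-1*i≡-i (f j)))) (trans (⟦⟧-· (⊖ 1ℤ) f d u v) (ℤ.-1*i≡-i _))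

⟦⟧-degree : ∀ f d u v → Degree d f → ⟦ f ⟧ (suc d) u v ≡ v ⊗ ⟦ f ⟧ d u v
⟦⟧-degree f zero    u v p = trans (cong (λ x → f 0 ⊗ (v ⊗ 1ℤ) ⊕ u ⊗ x) (p 1 (s≤s z≤n))) (lemma (f 0) v u)
  where
  lemma : ∀ a v u → a ⊗ (v ⊗ 1ℤ) ⊕ u ⊗ 0ℤ ≡ v ⊗ a
  lemma = ℤ-Solver.solve-∀
⟦⟧-degree f (suc d) u v p = trans (cong (λ x → f 0 ⊗ (v ⊗ v ^ᶻ suc d) ⊕ u ⊗ x) (⟦⟧-degree (tail f) d u v (tail-degree p)))
  (lemma (f 0) (v ^ᶻ suc d) v u (⟦ tail f ⟧ d u v))
  where
  lemma : ∀ a w v u x → a ⊗ (v ⊗ w) ⊕ u ⊗ (v ⊗ x) ≡ v ⊗ (a ⊗ w ⊕ u ⊗ x)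
  lemma = ℤ-Solver.solve-∀

⟦⟧-degree-+ : ∀ f e d u v → Degree d f → ⟦ f ⟧ (e + d) u v ≡ v ^ᶻ e ⊗ ⟦ f ⟧ d u v
⟦⟧-degree-+ f zero    d u v p = sym (ℤ.*-identityˡ _)
⟦⟧-degree-+ f (suc e) d u v p = trans (⟦⟧-degree f (e + d) u v (Degree-≤ (ℕ.m≤n+m d e) p))
  (trans (cong (v ⊗_) (⟦⟧-degree-+ f e d u v p)) (sym (ℤ.*-assoc v (v ^ᶻ e) _)))

⟦⟧-✶ : ∀ d e f g u v → Degree d f → Degree e g → ⟦ f ✶ g ⟧ (d + e) u v ≡ ⟦ f ⟧ d u v ⊗ ⟦ g ⟧ e u v
⟦⟧-✶ zero    e f g u v p q = trans (⟦⟧-cong e u v scalar) (⟦⟧-· (f 0) g e u v)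
  where
  scalar : ∀ j → (f ✶ g) j ≡ f 0 ⊗ g j
  scalar zero    = refl
  scalar (suc j) = trans (cong (f 0 ⊗ g (suc j) ⊕_) (zero-✶ (tail f) g j (λ i → p (suc i) (s≤s z≤n)))) (ℤ.+-identityʳ _)
⟦⟧-✶ (suc d) e f g u v p q = begin
  f 0 ⊗ g 0 ⊗ v ^ᶻ suc (d + e) ⊕ u ⊗ ⟦ (f 0 · tail g) ✢ (tail f ✶ g) ⟧ (d + e) u v
    ≡⟨ cong (λ x → f 0 ⊗ g 0 ⊗ v ^ᶻ suc (d + e) ⊕ u ⊗ x) (trans (⟦⟧-✢ (f 0 · tail g) (tail f ✶ g) (d + e) u v)
         (cong₂ _⊕_ (⟦⟧-· (f 0) (tail g) (d + e) u v) (⟦⟧-✶ d e (tail f) g u v (tail-degree p) q))) ⟩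
  f 0 ⊗ g 0 ⊗ v ^ᶻ suc (d + e) ⊕ u ⊗ (f 0 ⊗ ⟦ tail g ⟧ (d + e) u v ⊕ ⟦ tail f ⟧ d u v ⊗ ⟦ g ⟧ e u v)
    ≡⟨ regroup₁ (f 0) (g 0) (v ^ᶻ suc (d + e)) u (⟦ tail g ⟧ (d + e) u v) (⟦ tail f ⟧ d u v) (⟦ g ⟧ e u v) ⟩
  f 0 ⊗ ⟦ g ⟧ (suc d + e) u v ⊕ u ⊗ ⟦ tail f ⟧ d u v ⊗ ⟦ g ⟧ e u v
    ≡⟨ cong (λ x → f 0 ⊗ x ⊕ u ⊗ ⟦ tail f ⟧ d u v ⊗ ⟦ g ⟧ e u v) (⟦⟧-degree-+ g (suc d) e u v q) ⟩
  f 0 ⊗ (v ^ᶻ suc d ⊗ ⟦ g ⟧ e u v) ⊕ u ⊗ ⟦ tail f ⟧ d u v ⊗ ⟦ g ⟧ e u v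
    ≡⟨ regroup₂ (f 0) (v ^ᶻ suc d) u (⟦ tail f ⟧ d u v) (⟦ g ⟧ e u v) ⟩
  (f 0 ⊗ v ^ᶻ suc d ⊕ u ⊗ ⟦ tail f ⟧ d u v) ⊗ ⟦ g ⟧ e u v ∎
  where
  open ≡-Reasoning
  regroup₁ : ∀ a b w u x y z → a ⊗ b ⊗ w ⊕ u ⊗ (a ⊗ x ⊕ y ⊗ z) ≡ a ⊗ (b ⊗ w ⊕ u ⊗ x) ⊕ u ⊗ y ⊗ z
  regroup₁ = ℤ-Solver.solve-∀
  regroup₂ : ∀ a w u y z → a ⊗ (w ⊗ z) ⊕ u ⊗ y ⊗ z ≡ (a ⊗ w ⊕ u ⊗ y) ⊗ z
  regroup₂ = ℤ-Solver.solve-∀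

⟦⟧-↑ : ∀ d f n u v → Degree d f → ⟦ f ↑ n ⟧ (n * d) u v ≡ ⟦ f ⟧ d u v ^ᶻ n
⟦⟧-↑ d f zero    u v p = refl
⟦⟧-↑ d f (suc n) u v p = trans (⟦⟧-✶ d (n * d) f (f ↑ n) u v p (↑-degree d f n p)) (cong (⟦ f ⟧ d u v ⊗_) (⟦⟧-↑ d f n u v p))

⟦⟧-scale : ∀ f d z u v → z ^ᶻ d ⊗ ⟦ f ⟧ d u v ≡ ⟦ f ⟧ d (z ⊗ u) (z ⊗ v)
⟦⟧-scale f zero    z u v = ℤ.*-identityˡ (f 0)
⟦⟧-scale f (suc d) z u v = trans (lemma (z ^ᶻ d) z (f 0) (v ^ᶻ suc d) u (⟦ tail f ⟧ d u v))
  (cong₂ (λ x y → f 0 ⊗ x ⊕ z ⊗ u ⊗ y) (sym (^-distrib z v (suc d))) (⟦⟧-scale (tail f) d z u v))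
  where
  lemma : ∀ Z z a w u x → z ⊗ Z ⊗ (a ⊗ w ⊕ u ⊗ x) ≡ a ⊗ (z ⊗ Z ⊗ w) ⊕ z ⊗ u ⊗ (Z ⊗ x)
  lemma = ℤ-Solver.solve-∀
  ^-distrib : ∀ x y n → (x ⊗ y) ^ᶻ n ≡ x ^ᶻ n ⊗ y ^ᶻ n
  ^-distrib x y zero    = refl
  ^-distrib x y (suc n) = trans (cong (x ⊗ y ⊗_) (^-distrib x y n)) (swap x y (x ^ᶻ n) (y ^ᶻ n))
    where
    swap : ∀ x y X Y → x ⊗ y ⊗ (X ⊗ Y) ≡ x ⊗ X ⊗ (y ⊗ Y)
    swap = ℤ-Solver.solve-∀

⟦⟧-monomial : ∀ f d u v → (∀ j → j < d → f j ≡ 0ℤ) → ⟦ f ⟧ d u v ≡ u ^ᶻ d ⊗ f d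
⟦⟧-monomial f zero    u v p = sym (ℤ.*-identityˡ (f 0))
⟦⟧-monomial f (suc d) u v p = trans (cong₂ (λ x y → x ⊗ v ^ᶻ suc d ⊕ u ⊗ y) (p 0 (s≤s z≤n)) (⟦⟧-monomial (tail f) d u v (λ j j<d → p (suc j) (s≤s j<d))))
  (lemma (v ^ᶻ suc d) u (u ^ᶻ d) (f (suc d)))
  where
  lemma : ∀ w u U x → 0ℤ ⊗ w ⊕ u ⊗ (U ⊗ x) ≡ u ⊗ U ⊗ x
  lemma = ℤ-Solver.solve-∀

⟦φ⟧ : ∀ k u v → ⟦ φ k ⟧ 1 u v ≡ v ⊕ pos (k * k) ⊗ u
⟦φ⟧ k u v = trans (cong (λ x → φ k 0 ⊗ (v ⊗ 1ℤ) ⊕ u ⊗ x) (cong (0ℤ ⊕_) (trans (const-✶ (pos (k * k)) t 1) (ℤ.*-identityʳ (pos (k * k))))))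
  (lemma (pos (k * k)) u v)
  where
  lemma : ∀ K u v → (1ℤ ⊕ K ⊗ 0ℤ) ⊗ (v ⊗ 1ℤ) ⊕ u ⊗ (0ℤ ⊕ K) ≡ v ⊕ K ⊗ u
  lemma = ℤ-Solver.solve-∀

φ-degree : ∀ k → Degree 1 (φ k)
φ-degree k (suc (suc j)) _ = cong (0ℤ ⊕_) (trans (const-✶ (pos (k * k)) t (suc (suc j))) (ℤ.*-zeroʳ (pos (k * k))))
φ-degree k (suc zero) (s≤s ())

^ᶻ-nonneg : ∀ {v} n → 0ℤ ℤ.≤ v → 0ℤ ℤ.≤ v ^ᶻ n
^ᶻ-nonneg zero    p = ℤ.+≤+ z≤n
^ᶻ-nonneg {v} (suc n) p = ⊗-nonneg {v} p (^ᶻ-nonneg n p)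

⟦⟧-nonneg : ∀ f d u v → NonNeg f → 0ℤ ℤ.≤ u → 0ℤ ℤ.≤ v → 0ℤ ℤ.≤ ⟦ f ⟧ d u v
⟦⟧-nonneg f zero    u v p 0≤u 0≤v = p 0
⟦⟧-nonneg f (suc d) u v p 0≤u 0≤v = ℤ.+-mono-≤ (⊗-nonneg (p 0) (^ᶻ-nonneg (suc d) 0≤v))
  (⊗-nonneg 0≤u (⟦⟧-nonneg (tail f) d u v (λ j → p (suc j)) 0≤u 0≤v))

⟦⟧-first : ∀ f d u v → NonNeg f → 0ℤ ℤ.≤ u → 0ℤ ℤ.≤ v → f 0 ⊗ v ^ᶻ d ℤ.≤ ⟦ f ⟧ d u v
⟦⟧-first f zero    u v p 0≤u 0≤v = ℤ.≤-reflexive (ℤ.*-identityʳ (f 0))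
⟦⟧-first f (suc d) u v p 0≤u 0≤v = ℤ.≤-trans (ℤ.≤-reflexive (sym (ℤ.+-identityʳ _)))
  (ℤ.+-monoʳ-≤ (f 0 ⊗ v ^ᶻ suc d) (⊗-nonneg 0≤u (⟦⟧-nonneg (tail f) d u v (λ j → p (suc j)) 0≤u 0≤v)))

⟦⟧-mono : ∀ {f g} d u w v → (∀ j → f j ℤ.≤ g j) → NonNeg g → 0ℤ ℤ.≤ u → u ℤ.≤ w → 0ℤ ℤ.≤ v → ⟦ f ⟧ d u v ℤ.≤ ⟦ g ⟧ d w v
⟦⟧-mono zero    u w v p q 0≤u u≤w 0≤v = p 0
⟦⟧-mono {f} {g} (suc d) u w v p q 0≤u u≤w 0≤v = ℤ.+-mono-≤
  (ℤ.*-monoʳ-≤-nonNeg (v ^ᶻ suc d) ⦃ ℤ.nonNegative (^ᶻ-nonneg (suc d) 0≤v) ⦄ (p 0))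
  (ℤ.≤-trans (ℤ.*-monoˡ-≤-nonNeg u ⦃ ℤ.nonNegative 0≤u ⦄ (⟦⟧-mono d u w v (λ j → p (suc j)) (λ j → q (suc j)) 0≤u u≤w 0≤v))
    (ℤ.*-monoʳ-≤-nonNeg (⟦ tail g ⟧ d w v) ⦃ ℤ.nonNegative (⟦⟧-nonneg (tail g) d w v (λ j → q (suc j)) (ℤ.≤-trans 0≤u u≤w) 0≤v) ⦄ u≤w))

-- Cauchy's estimate for the terms of order at least s, with w as the radius.
⟦⟧-tail : ∀ s {f g} d u w v → (∀ j → j < s → f j ≡ 0ℤ) → (∀ j → f j ℤ.≤ g j) → NonNeg g → 0ℤ ℤ.≤ u → u ℤ.≤ w → 0ℤ ℤ.≤ v →
  w ^ᶻ s ⊗ ⟦ f ⟧ d u v ℤ.≤ u ^ᶻ s ⊗ ⟦ g ⟧ d w v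
⟦⟧-tail zero    {f} {g} d u w v z p q 0≤u u≤w 0≤v = ℤ.≤-trans (ℤ.≤-reflexive (ℤ.*-identityˡ (⟦ f ⟧ d u v)))
  (ℤ.≤-trans (⟦⟧-mono {f} {g} d u w v p q 0≤u u≤w 0≤v) (ℤ.≤-reflexive (sym (ℤ.*-identityˡ (⟦ g ⟧ d w v)))))
⟦⟧-tail (suc s) {f} {g} zero u w v z p q 0≤u u≤w 0≤v = ℤ.≤-trans
  (ℤ.≤-reflexive (trans (cong (w ^ᶻ suc s ⊗_) (z 0 (s≤s z≤n))) (ℤ.*-zeroʳ (w ^ᶻ suc s))))
  (⊗-nonneg (^ᶻ-nonneg (suc s) 0≤u) (q 0))
⟦⟧-tail (suc s) {f} {g} (suc d) u w v z p q 0≤u u≤w 0≤v = begin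
  w ⊗ w ^ᶻ s ⊗ (f 0 ⊗ v ^ᶻ suc d ⊕ u ⊗ ⟦ tail f ⟧ d u v)
    ≡⟨ cong (λ x → w ⊗ w ^ᶻ s ⊗ (x ⊗ v ^ᶻ suc d ⊕ u ⊗ ⟦ tail f ⟧ d u v)) (z 0 (s≤s z≤n)) ⟩
  w ⊗ w ^ᶻ s ⊗ (0ℤ ⊗ v ^ᶻ suc d ⊕ u ⊗ ⟦ tail f ⟧ d u v)
    ≡⟨ regroup₁ w (w ^ᶻ s) (v ^ᶻ suc d) u (⟦ tail f ⟧ d u v) ⟩
  w ⊗ u ⊗ (w ^ᶻ s ⊗ ⟦ tail f ⟧ d u v)
    ≤⟨ ℤ.*-monoˡ-≤-nonNeg (w ⊗ u) ⦃ ℤ.nonNegative (⊗-nonneg 0≤w 0≤u) ⦄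
         (⟦⟧-tail s {tail f} {tail g} d u w v (λ j j<s → z (suc j) (s≤s j<s)) (λ j → p (suc j)) (λ j → q (suc j)) 0≤u u≤w 0≤v) ⟩
  w ⊗ u ⊗ (u ^ᶻ s ⊗ ⟦ tail g ⟧ d w v)
    ≡⟨ regroup₂ w u (u ^ᶻ s) (⟦ tail g ⟧ d w v) ⟩
  u ⊗ u ^ᶻ s ⊗ (0ℤ ⊕ w ⊗ ⟦ tail g ⟧ d w v)
    ≤⟨ ℤ.*-monoˡ-≤-nonNeg (u ⊗ u ^ᶻ s) ⦃ ℤ.nonNegative (^ᶻ-nonneg (suc s) 0≤u) ⦄
         (ℤ.+-monoˡ-≤ (w ⊗ ⟦ tail g ⟧ d w v) (⊗-nonneg (q 0) (^ᶻ-nonneg (suc d) 0≤v))) ⟩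
  u ⊗ u ^ᶻ s ⊗ (g 0 ⊗ v ^ᶻ suc d ⊕ w ⊗ ⟦ tail g ⟧ d w v) ∎
  where
  open ℤ.≤-Reasoning
  0≤w : 0ℤ ℤ.≤ w
  0≤w = ℤ.≤-trans 0≤u u≤w
  regroup₁ : ∀ w W V u x → w ⊗ W ⊗ (0ℤ ⊗ V ⊕ u ⊗ x) ≡ w ⊗ u ⊗ (W ⊗ x)
  regroup₁ = ℤ-Solver.solve-∀
  regroup₂ : ∀ w u U x → w ⊗ u ⊗ (U ⊗ x) ≡ u ⊗ U ⊗ (0ℤ ⊕ w ⊗ x)
  regroup₂ = ℤ-Solver.solve-∀

-- Integer values of the approximants and their error

pos-^ : ∀ m n → pos (m ^ n) ≡ pos m ^ᶻ n
pos-^ m zero    = refl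
pos-^ m (suc n) = trans (ℤ.pos-* m (m ^ n)) (cong (pos m ⊗_) (pos-^ m n))

-- Cauchy's bound for φ a^k - b^k with radius t = 1/k³. There φ equals 1 + 1/k, whose k-th power is
-- bounded independently of k; y is the homogenised value of φ at this point.
tail-bound : ℕ → ℕ → ℕ → ℕ → ℕ
tail-bound k deg m Q = (k * m) ^ suc (2 * deg) * (y * (central deg * y ^ deg) ^ k)
  where
  y : ℕ
  y = suc k * (k * k * Q)

-- A and B are the denominator and numerator at t = m / (k² Q), multiplied by (k² Q)^deg. The two
-- closeness fields bound the difference of (1 + m/Q) A^k and B^k from both sides; the powers of Q
-- and k in front clear the denominators of Cauchy's estimate.
record PadéValues (k deg m Q A B : ℕ) : Set where
  field
    A-lower : central deg * (k * k * Q) ^ deg ≤ A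
    B-lower : central deg * (k * k * Q) ^ deg ≤ B
    B-upper : B ≤ central deg * (k * k * Q + k * k * m) ^ deg
    A-close : k * m ≤ Q → Q ^ suc (2 * deg) * (k ^ suc (k * deg) * ((k * k * Q + k * k * m) * A ^ k))
      ≤ Q ^ suc (2 * deg) * (k ^ suc (k * deg) * ((k * k * Q) * B ^ k)) + tail-bound k deg m Q
    B-close : k * m ≤ Q → Q ^ suc (2 * deg) * (k ^ suc (k * deg) * ((k * k * Q) * B ^ k))
      ≤ Q ^ suc (2 * deg) * (k ^ suc (k * deg) * ((k * k * Q + k * k * m) * A ^ k)) + tail-bound k deg m Q

module _ (k″ L : ℕ) (f : Series) (f0 : f 0 ≡ 1ℤ) (f↑k : Mod._≋_ L (f ↑ suc (suc k″)) (φ (suc (suc k″)))) where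
  private
    k′ k : ℕ
    k′ = suc k″
    k  = suc k′

  -- This is k r - 1 for r = `suc deg′`, written without subtraction; the numerator uses the power k
  -- r + 1.
  exponent : ℕ → ℕ
  exponent deg′ = k * deg′ + k′

  numerator denominator : ℕ → Series
  denominator deg′ = padé (suc deg′) (f ↑ exponent deg′)
  numerator deg′   = padé (suc deg′) (f ↑ suc (suc (exponent deg′)))

  power-recurrence : ∀ e c → e * k ≡ c → BinomialRecurrence k L (pos c) (f ↑ e)
  power-recurrence e c refl = logarithmic⇒recurrence k L (pos (e * k)) (f ↑ e)
    (≋-trans (↑-logarithmic k f (pos k) (root-logarithmic k′ f f↑k) e)
      (≋-trans (≋-sym (*-assoc (const (pos e)) (const (pos k)) (t ✶ (f ↑ e))))
        (✶-congʳ (t ✶ (f ↑ e)) (≋-sym (const-* e k)))))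
    where open Powers L

  d-A d-B : ℕ
  d-A = k′ * k
  d-B = (2 + k′) * k

  e-A : ∀ deg′ → exponent deg′ * k ≡ k * k * deg′ + d-A
  e-A deg′ = lemma k k′ deg′
    where
    lemma : ∀ k k′ deg → (k * deg + k′) * k ≡ k * k * deg + k′ * k
    lemma = ℕ-Solver.solve-∀
  e-B : ∀ deg′ → suc (suc (exponent deg′)) * k ≡ k * k * deg′ + d-B
  e-B deg′ = lemma k k′ deg′
    where
    lemma : ∀ k k′ deg → (2 + (k * deg + k′)) * k ≡ k * k * deg + (2 + k′) * k
    lemma = ℕ-Solver.solve-∀

  rec-A : ∀ deg′ → BinomialRecurrence k L (pos (k * k * deg′ + d-A)) (f ↑ exponent deg′)
  rec-A deg′ = power-recurrence (exponent deg′) (k * k * deg′ + d-A) (e-A deg′)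
  rec-B : ∀ deg′ → BinomialRecurrence k L (pos (k * k * deg′ + d-B)) (f ↑ suc (suc (exponent deg′)))
  rec-B deg′ = power-recurrence (suc (suc (exponent deg′))) (k * k * deg′ + d-B) (e-B deg′)

  d-A≤ : d-A ≤ 2 * (k * k)
  d-A≤ = ℕ.≤-trans (ℕ.*-monoˡ-≤ k (ℕ.n≤1+n k′)) (ℕ.m≤m+n (k * k) _)
  d-B≤ : d-B ≤ 2 * (k * k)
  d-B≤ = ℕ.≤-trans (ℕ.*-monoˡ-≤ k {suc k} {2 * k} (ℕ.≤-trans (ℕ.≤-reflexive (ℕ.+-comm 1 k)) (ℕ.+-monoʳ-≤ k (s≤s z≤n))))
    (ℕ.≤-reflexive (ℕ.*-assoc 2 k k))

  module _ (deg′ : ℕ) (1+2r≤L : suc (2 * suc deg′) ≤ L) where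
    private
      deg K c₀ : ℕ
      deg  = suc deg′
      K  = k * k
      c₀ = central deg
      a b D : Series
      a = denominator deg′
      b = numerator deg′
      D = const (pos c₀) ✶ (φ k ↑ deg)

      h0 : ∀ e → (f ↑ e) 0 ≡ 1ℤ
      h0 e = ↑-zero-coefficient f e f0

    a⊑D : a ⊑ D
    a⊑D = padé-⊑ k deg′ L d-A (f ↑ exponent deg′) (rec-A deg′) (h0 (exponent deg′)) 1+2r≤L (s≤s z≤n) d-A≤
    b⊑D : b ⊑ D
    b⊑D = padé-⊑ k deg′ L d-B (f ↑ suc (suc (exponent deg′))) (rec-B deg′) (h0 (suc (suc (exponent deg′)))) 1+2r≤L (s≤s z≤n) d-B≤

    denominator-degree : Degree deg a
    denominator-degree = padé-degree k deg′ L d-A (f ↑ exponent deg′) (rec-A deg′) (h0 (exponent deg′)) 1+2r≤L (s≤s z≤n) d-A≤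
    numerator-degree : Degree deg b
    numerator-degree = padé-degree k deg′ L d-B (f ↑ suc (suc (exponent deg′))) (rec-B deg′) (h0 (suc (suc (exponent deg′)))) 1+2r≤L (s≤s z≤n) d-B≤

    first-coefficient : a 0 ≡ pos c₀ × b 0 ≡ pos c₀
    first-coefficient = trans (cong (pos c₀ ⊗_) (h0 (exponent deg′))) (ℤ.*-identityʳ (pos c₀))
                      , trans (cong (pos c₀ ⊗_) (h0 (suc (suc (exponent deg′))))) (ℤ.*-identityʳ (pos c₀))

    fa≋b : Mod._≋_ (suc (2 * deg)) (f ✶ a) b
    fa≋b = padé-approximation k′ deg′ f a b (weaken 1+2r≤L (Powers.root-logarithmic L k′ f f↑k))
      (wronskian-vanishes k′ deg′ a b
        (residual-zero k′ deg′ (⊖ 1ℤ) (pos (k * k * deg′ + d-A)) a c-A (padé-equation k deg′ L (pos (k * k * deg′ + d-A)) (f ↑ exponent deg′) (rec-A deg′) 1+2r≤L))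
        (residual-zero k′ deg′ 1ℤ (pos (k * k * deg′ + d-B)) b c-B (padé-equation k deg′ L (pos (k * k * deg′ + d-B)) (f ↑ suc (suc (exponent deg′))) (rec-B deg′) 1+2r≤L)))
      f0 (trans (proj₁ first-coefficient) (sym (proj₂ first-coefficient)))
      (λ b0≡0 → ℕ.<⇒≢ (central-positive deg) (sym (ℤ.+-injective (trans (sym (proj₂ first-coefficient)) b0≡0))))
      where
      cast : ∀ d → pos (k * k * deg′ + d * k) ≡ (1ℤ ⊕ pos k′) ⊗ (1ℤ ⊕ pos k′) ⊗ pos deg′ ⊕ pos d ⊗ (1ℤ ⊕ pos k′)
      cast d = trans (ℤ.pos-+ (k * k * deg′) (d * k)) (cong₂ _⊕_ (trans (ℤ.pos-* (k * k) deg′) (cong (_⊗ pos deg′) (ℤ.pos-* k k))) (ℤ.pos-* d k))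
      target : ∀ ε → pos deg ⊗ pos (k * k) ⊕ ε ⊗ pos k ≡ (1ℤ ⊕ pos deg′) ⊗ ((1ℤ ⊕ pos k′) ⊗ (1ℤ ⊕ pos k′)) ⊕ ε ⊗ (1ℤ ⊕ pos k′)
      target ε = cong (λ x → pos deg ⊗ x ⊕ ε ⊗ pos k) (ℤ.pos-* k k)
      c-A : pos (k * k * deg′ + d-A) ≡ pos deg ⊗ pos (k * k) ⊕ ⊖ 1ℤ ⊗ pos k
      c-A = trans (cast k′) (trans (lemma (pos k′) (pos deg′)) (sym (target (⊖ 1ℤ))))
        where
        lemma : ∀ k deg → (1ℤ ⊕ k) ⊗ (1ℤ ⊕ k) ⊗ deg ⊕ k ⊗ (1ℤ ⊕ k) ≡ (1ℤ ⊕ deg) ⊗ ((1ℤ ⊕ k) ⊗ (1ℤ ⊕ k)) ⊕ ⊖ 1ℤ ⊗ (1ℤ ⊕ k)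
        lemma = ℤ-Solver.solve-∀
      c-B : pos (k * k * deg′ + d-B) ≡ pos deg ⊗ pos (k * k) ⊕ 1ℤ ⊗ pos k
      c-B = trans (cast (2 + k′)) (trans (lemma (pos k′) (pos deg′)) (sym (target 1ℤ)))
        where
        lemma : ∀ k deg → (1ℤ ⊕ k) ⊗ (1ℤ ⊕ k) ⊗ deg ⊕ (pos 2 ⊕ k) ⊗ (1ℤ ⊕ k) ≡ (1ℤ ⊕ deg) ⊗ ((1ℤ ⊕ k) ⊗ (1ℤ ⊕ k)) ⊕ 1ℤ ⊗ (1ℤ ⊕ k)
        lemma = ℤ-Solver.solve-∀

    private
      φ↑r-degree : Degree deg (φ k ↑ deg)
      φ↑r-degree = Degree-≤ (ℕ.≤-reflexive (ℕ.*-identityʳ deg)) (↑-degree 1 (φ k) deg (φ-degree k))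

      D-degree : Degree deg D
      D-degree = ✶-degree 0 deg (const (pos c₀)) (φ k ↑ deg) (const-degree (pos c₀)) φ↑r-degree

      ⟦D⟧ : ∀ mᶻ v → ⟦ D ⟧ deg mᶻ v ≡ pos c₀ ⊗ (v ⊕ pos K ⊗ mᶻ) ^ᶻ deg
      ⟦D⟧ mᶻ v = trans (⟦⟧-✶ 0 deg (const (pos c₀)) (φ k ↑ deg) mᶻ v (const-degree (pos c₀)) φ↑r-degree)
        (cong (pos c₀ ⊗_) (trans (cong (λ d → ⟦ φ k ↑ deg ⟧ d mᶻ v) (sym (ℕ.*-identityʳ deg)))
          (trans (⟦⟧-↑ 1 (φ k) deg mᶻ v (φ-degree k)) (cong (_^ᶻ deg) (⟦φ⟧ k mᶻ v)))))

      Γ : Series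
      Γ = φ k ✶ (D ↑ k)
      F₁ F₂ : Series
      F₁ = φ k ✶ (a ↑ k)
      F₂ = b ↑ k

      D-nonneg : NonNeg D
      D-nonneg = ⊑-upper a⊑D

      F₁⊑Γ : F₁ ⊑ Γ
      F₁⊑Γ = ✶-⊑ (⊑-refl (φ-nonneg k)) (↑-⊑ k a⊑D)
      F₂⊑Γ : F₂ ⊑ Γ
      F₂⊑Γ j = proj₁ (↑-⊑ k b⊑D j) , ℤ.≤-trans (proj₂ (↑-⊑ k b⊑D j)) (proj₂ (φ-⊒ k (D ↑ k) (⊑-upper (↑-⊑ k a⊑D)) j))

      -- The k-th power of f a ≡ b, in which f survives only as f^k = φ: from here on no root
      -- occurs.
      F₁≋F₂ : Mod._≋_ (suc (2 * deg)) F₁ F₂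
      F₁≋F₂ = begin
        φ k ✶ (a ↑ k)          ≈⟨ ✶-congʳ (a ↑ k) (weaken 1+2r≤L f↑k) ⟨
        (f ↑ k) ✶ (a ↑ k)      ≈⟨ ✶-↑ f a k ⟨
        (f ✶ a) ↑ k            ≈⟨ ↑-cong k fa≋b ⟩
        b ↑ k ∎
        where
        open Powers (suc (2 * deg))
        open import Relation.Binary.Reasoning.Setoid setoid

      N : ℕ
      N = 1 + k * deg

    module _ (m Q : ℕ) where
      private
        mᶻ v : ℤ
        mᶻ = pos m
        v = pos (K * Q)
        0≤pos : ∀ n → 0ℤ ℤ.≤ pos n
        0≤pos n = ℤ.+≤+ z≤n
        α β : ℤ
        α = ⟦ a ⟧ deg mᶻ v
        β = ⟦ b ⟧ deg mᶻ v
        0≤α : 0ℤ ℤ.≤ α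
        0≤α = ⟦⟧-nonneg a deg mᶻ v (λ j → proj₁ (a⊑D j)) (0≤pos m) (0≤pos (K * Q))
        0≤β : 0ℤ ℤ.≤ β
        0≤β = ⟦⟧-nonneg b deg mᶻ v (λ j → proj₁ (b⊑D j)) (0≤pos m) (0≤pos (K * Q))
        A B : ℕ
        A = ∣ α ∣
        B = ∣ β ∣
        pos-A : pos A ≡ α
        pos-A = ℤ.0≤i⇒+∣i∣≡i 0≤α
        pos-B : pos B ≡ β
        pos-B = ℤ.0≤i⇒+∣i∣≡i 0≤β

        lower : ∀ g → g ⊑ D → g 0 ≡ pos c₀ → (A : ℕ) → pos A ≡ ⟦ g ⟧ deg mᶻ v → c₀ * (K * Q) ^ deg ≤ A
        lower g g⊑D g0 A pos-A = ℤ.drop‿+≤+ (begin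
          pos (c₀ * (K * Q) ^ deg)     ≡⟨ trans (ℤ.pos-* c₀ ((K * Q) ^ deg)) (cong (pos c₀ ⊗_) (pos-^ (K * Q) deg)) ⟩
          pos c₀ ⊗ v ^ᶻ deg              ≡⟨ cong (_⊗ v ^ᶻ deg) g0 ⟨
          g 0 ⊗ v ^ᶻ deg                 ≤⟨ ⟦⟧-first g deg mᶻ v (λ j → proj₁ (g⊑D j)) (0≤pos m) (0≤pos (K * Q)) ⟩
          ⟦ g ⟧ deg mᶻ v                  ≡⟨ pos-A ⟨
          pos A ∎)
          where open ℤ.≤-Reasoning

        upper : B ≤ c₀ * (K * Q + K * m) ^ deg
        upper = ℤ.drop‿+≤+ (begin
          pos B                                     ≡⟨ pos-B ⟩
          ⟦ b ⟧ deg mᶻ v                               ≤⟨ ⟦⟧-mono {b} {D} deg mᶻ mᶻ v (λ j → proj₂ (b⊑D j)) D-nonneg (0≤pos m) ℤ.≤-refl (0≤pos (K * Q)) ⟩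
          ⟦ D ⟧ deg mᶻ v                               ≡⟨ ⟦D⟧ mᶻ v ⟩
          pos c₀ ⊗ (v ⊕ pos K ⊗ mᶻ) ^ᶻ deg            ≡⟨ cong (λ x → pos c₀ ⊗ x ^ᶻ deg) (trans (ℤ.pos-+ (K * Q) (K * m)) (cong (v ⊕_) (ℤ.pos-* K m))) ⟨
          pos c₀ ⊗ pos (K * Q + K * m) ^ᶻ deg     ≡⟨ trans (ℤ.pos-* c₀ ((K * Q + K * m) ^ deg)) (cong (pos c₀ ⊗_) (pos-^ (K * Q + K * m) deg)) ⟨
          pos (c₀ * (K * Q + K * m) ^ deg) ∎)
          where open ℤ.≤-Reasoning

        -- Multiplying both arguments of the forms by k gives the radius 1/k³ = w / x integral
        -- coordinates. The evaluation point has first coordinate k m, so k m ≤ Q says that it lies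
        -- within the radius.
        w x : ℤ
        w = pos Q
        x = pos k ⊗ v

        ⟦F₁⟧ : ⟦ F₁ ⟧ N mᶻ v ≡ pos ((K * Q + K * m) * A ^ k)
        ⟦F₁⟧ = trans (⟦⟧-✶ 1 (k * deg) (φ k) (a ↑ k) mᶻ v (φ-degree k) (↑-degree deg a k denominator-degree))
          (trans (cong₂ _⊗_ (trans (⟦φ⟧ k mᶻ v) (sym (trans (ℤ.pos-+ (K * Q) (K * m)) (cong (v ⊕_) (ℤ.pos-* K m)))))
              (trans (⟦⟧-↑ deg a k mᶻ v denominator-degree) (trans (cong (_^ᶻ k) (sym pos-A)) (sym (pos-^ A k)))))
            (sym (ℤ.pos-* (K * Q + K * m) (A ^ k))))

        -- The degree of F₂ is one less than N, which produces the extra factor v = K Q.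
        ⟦F₂⟧ : ⟦ F₂ ⟧ N mᶻ v ≡ pos ((K * Q) * B ^ k)
        ⟦F₂⟧ = trans (⟦⟧-degree F₂ (k * deg) mᶻ v (↑-degree deg b k numerator-degree))
          (trans (cong (v ⊗_) (trans (⟦⟧-↑ deg b k mᶻ v numerator-degree) (trans (cong (_^ᶻ k) (sym pos-B)) (sym (pos-^ B k)))))
            (sym (ℤ.pos-* (K * Q) (B ^ k))))

        y : ℕ
        y = suc k * (K * Q)

        ⟦φ⟧-y : ⟦ φ k ⟧ 1 w x ≡ pos y
        ⟦φ⟧-y = trans (⟦φ⟧ k w x) (trans (cong (λ z → pos k ⊗ z ⊕ pos K ⊗ w) (ℤ.pos-* K Q))
          (trans (lemma (pos k) (pos K) w) (sym (trans (ℤ.pos-* (suc k) (K * Q)) (cong (pos (suc k) ⊗_) (ℤ.pos-* K Q))))))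
          where
          lemma : ∀ k K w → k ⊗ (K ⊗ w) ⊕ K ⊗ w ≡ (1ℤ ⊕ k) ⊗ (K ⊗ w)
          lemma = ℤ-Solver.solve-∀

        ⟦Γ⟧ : ⟦ Γ ⟧ N w x ≡ pos (y * (c₀ * y ^ deg) ^ k)
        ⟦Γ⟧ = trans (⟦⟧-✶ 1 (k * deg) (φ k) (D ↑ k) w x (φ-degree k) (↑-degree deg D k D-degree))
          (trans (cong₂ _⊗_ ⟦φ⟧-y (trans (⟦⟧-↑ deg D k w x D-degree) (trans (cong (_^ᶻ k) ⟦D⟧-y) (sym (pos-^ (c₀ * y ^ deg) k)))))
            (sym (ℤ.pos-* y ((c₀ * y ^ deg) ^ k))))
          where
          ⟦D⟧-y : ⟦ D ⟧ deg w x ≡ pos (c₀ * y ^ deg)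
          ⟦D⟧-y = trans (⟦D⟧ w x) (trans (cong (λ z → pos c₀ ⊗ z ^ᶻ deg) (trans (sym (⟦φ⟧ k w x)) ⟦φ⟧-y))
            (sym (trans (ℤ.pos-* c₀ (y ^ deg)) (cong (pos c₀ ⊗_) (pos-^ y deg)))))

        s : ℕ
        s = suc (2 * deg)

        -- The difference f - g starts at t^s, and g ≥ 0 lets the majorant of f bound it from above.
        -- Exchanging f and g gives the other side.
        close : ∀ f g (X Y : ℕ) → f ⊑ Γ → (∀ j → 0ℤ ℤ.≤ g j) → Mod._≋_ s f g → ⟦ f ⟧ N mᶻ v ≡ pos X → ⟦ g ⟧ N mᶻ v ≡ pos Y → k * m ≤ Q →
          Q ^ s * (k ^ N * X) ≤ Q ^ s * (k ^ N * Y) + (k * m) ^ s * (y * (c₀ * y ^ deg) ^ k)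
        close f g X Y f⊑Γ g≥0 f≋g ⟦f⟧ ⟦g⟧ km≤Q = ℤ.drop‿+≤+ (begin
          pos (Q ^ s * (k ^ N * X))
            ≡⟨ cast X ⟩
          w ^ᶻ s ⊗ (pos k ^ᶻ N ⊗ pos X)
            ≡⟨ split (w ^ᶻ s) (pos k ^ᶻ N) (pos X) (pos Y) ⟩
          w ^ᶻ s ⊗ (pos k ^ᶻ N ⊗ pos Y) ⊕ w ^ᶻ s ⊗ (pos k ^ᶻ N ⊗ (pos X ⊕ ⊖ pos Y))
            ≡⟨ cong (λ z → w ^ᶻ s ⊗ (pos k ^ᶻ N ⊗ pos Y) ⊕ w ^ᶻ s ⊗ z) scaled ⟩
          w ^ᶻ s ⊗ (pos k ^ᶻ N ⊗ pos Y) ⊕ w ^ᶻ s ⊗ ⟦ f ✢ neg g ⟧ N (pos (k * m)) x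
            ≤⟨ ℤ.+-monoʳ-≤ (w ^ᶻ s ⊗ (pos k ^ᶻ N ⊗ pos Y)) (⟦⟧-tail s {f ✢ neg g} {Γ} N (pos (k * m)) w x vanish below (⊑-upper f⊑Γ) (0≤pos (k * m)) (ℤ.+≤+ km≤Q) (⊗-nonneg (0≤pos k) (0≤pos (K * Q)))) ⟩
          w ^ᶻ s ⊗ (pos k ^ᶻ N ⊗ pos Y) ⊕ pos (k * m) ^ᶻ s ⊗ ⟦ Γ ⟧ N w x
            ≡⟨ cong₂ _⊕_ (sym (cast Y)) (trans (cong₂ _⊗_ (sym (pos-^ (k * m) s)) ⟦Γ⟧) (sym (ℤ.pos-* ((k * m) ^ s) (y * (c₀ * y ^ deg) ^ k)))) ⟩
          pos (Q ^ s * (k ^ N * Y)) ⊕ pos ((k * m) ^ s * (y * (c₀ * y ^ deg) ^ k))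
            ≡⟨ ℤ.pos-+ (Q ^ s * (k ^ N * Y)) _ ⟨
          pos (Q ^ s * (k ^ N * Y) + (k * m) ^ s * (y * (c₀ * y ^ deg) ^ k)) ∎)
          where
          open ℤ.≤-Reasoning
          cast : ∀ X → pos (Q ^ s * (k ^ N * X)) ≡ w ^ᶻ s ⊗ (pos k ^ᶻ N ⊗ pos X)
          cast X = trans (ℤ.pos-* (Q ^ s) (k ^ N * X)) (cong₂ _⊗_ (pos-^ Q s) (trans (ℤ.pos-* (k ^ N) X) (cong (_⊗ pos X) (pos-^ k N))))
          split : ∀ a b x y → a ⊗ (b ⊗ x) ≡ a ⊗ (b ⊗ y) ⊕ a ⊗ (b ⊗ (x ⊕ ⊖ y))
          split = ℤ-Solver.solve-∀
          scaled : pos k ^ᶻ N ⊗ (pos X ⊕ ⊖ pos Y) ≡ ⟦ f ✢ neg g ⟧ N (pos (k * m)) x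
          scaled = trans (cong (pos k ^ᶻ N ⊗_) (trans (cong₂ (λ p q → p ⊕ ⊖ q) (sym ⟦f⟧) (sym ⟦g⟧))
              (sym (trans (⟦⟧-✢ f (neg g) N mᶻ v) (cong (⟦ f ⟧ N mᶻ v ⊕_) (⟦⟧-neg g N mᶻ v))))))
            (trans (⟦⟧-scale (f ✢ neg g) N (pos k) mᶻ v) (cong (λ z → ⟦ f ✢ neg g ⟧ N z x) (sym (ℤ.pos-* k m))))
          vanish : ∀ j → j < s → f j ⊕ ⊖ g j ≡ 0ℤ
          vanish j j<s = trans (cong (_⊕ ⊖ g j) (Mod.coefficient f≋g j j<s)) (ℤ.+-inverseʳ (g j))
          below : ∀ j → f j ⊕ ⊖ g j ℤ.≤ Γ j
          below j = ℤ.≤-trans (ℤ.+-mono-≤ (proj₂ (f⊑Γ j)) (ℤ.neg-mono-≤ (g≥0 j))) (ℤ.≤-reflexive (ℤ.+-identityʳ (Γ j)))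

      padé-values : PadéValues k deg m Q ∣ ⟦ a ⟧ deg mᶻ v ∣ ∣ ⟦ b ⟧ deg mᶻ v ∣
      padé-values = record
        { A-lower = lower a a⊑D (proj₁ first-coefficient) A pos-A
        ; B-lower = lower b b⊑D (proj₂ first-coefficient) B pos-B
        ; B-upper = upper
        ; A-close = close F₁ F₂ _ _ F₁⊑Γ (λ j → proj₁ (F₂⊑Γ j)) F₁≋F₂ ⟦F₁⟧ ⟦F₂⟧
        ; B-close = close F₂ F₁ _ _ F₂⊑Γ (λ j → proj₁ (F₁⊑Γ j)) (Mod.≋-sym _ F₁≋F₂) ⟦F₂⟧ ⟦F₁⟧
        }

-- Linear independence of consecutive approximants

module _ (k″ deg′ : ℕ) (f : Series) (f0 : f 0 ≡ 1ℤ)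
  (f↑k : Mod._≋_ (suc (2 * suc (suc deg′))) (f ↑ suc (suc k″)) (φ (suc (suc k″)))) where
  private
    k′ k deg L : ℕ
    k′  = suc k″
    k   = suc k′
    deg = suc deg′
    L   = suc (2 * suc deg)
    a b a′ b′ δ : Series
    a  = denominator k″ L f f0 f↑k deg′
    b  = numerator k″ L f f0 f↑k deg′
    a′ = denominator k″ L f f0 f↑k deg
    b′ = numerator k″ L f f0 f↑k deg
    δ  = (a ✶ b′) ✢ neg (a′ ✶ b)
    e : ℕ
    e = exponent k″ L f f0 f↑k deg′

    r≤ : suc (2 * deg) ≤ L
    r≤ = s≤s (ℕ.*-monoʳ-≤ 2 (ℕ.n≤1+n deg))

    d : ℕ
    d = deg + suc deg

    a-degree : Degree deg a
    a-degree = denominator-degree k″ L f f0 f↑k deg′ r≤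
    b-degree : Degree deg b
    b-degree = numerator-degree k″ L f f0 f↑k deg′ r≤
    a′-degree : Degree (suc deg) a′
    a′-degree = denominator-degree k″ L f f0 f↑k deg ℕ.≤-refl
    b′-degree : Degree (suc deg) b′
    b′-degree = numerator-degree k″ L f f0 f↑k deg ℕ.≤-refl

    δ≋0 : Mod._≋_ (suc (2 * deg)) δ (const 0ℤ)
    δ≋0 = begin
      (a ✶ b′) ✢ neg (a′ ✶ b)
        ≈⟨ +-cong (✶-congˡ a (weaken r≤ (fa≋b k″ L f f0 f↑k deg ℕ.≤-refl))) (-‿cong (✶-congˡ a′ (fa≋b k″ L f f0 f↑k deg′ r≤))) ⟨
      (a ✶ (f ✶ a′)) ✢ neg (a′ ✶ (f ✶ a))
        ≈⟨ solve 3 (λ a a′ f → a :* (f :* a′) :- a′ :* (f :* a) := con 0ℤ) ≋-refl a a′ f ⟩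
      const 0ℤ ∎
      where
      open Powers (suc (2 * deg))
      open Solver using (_:+_; _:*_; _:-_; _:=_; solve; con)
      open import Relation.Binary.Reasoning.Setoid setoid

    padé-top : ∀ n h → padé n h n ≡ h n
    padé-top n h = trans (cong (λ i → pos (i C n) ⊗ h n) (trans (cong (_∸ n) (cong (n +_) (ℕ.+-identityʳ n))) (ℕ.m+n∸n≡m n n)))
      (trans (cong (λ c → pos c ⊗ h n) (nCn≡1 n)) (ℤ.*-identityˡ (h n)))

    shift : ∀ e e′ → suc (e + k′) ≡ e′ → pos (suc deg) ⊗ (f ↑ e′) (suc deg) ≡ pos e′ ⊗ (pos k ⊗ (f ↑ e) deg)
    shift e e′ refl = trans (Mod.coefficient (Powers.root-power-shift L k′ f f↑k e) (suc deg) (s≤s (ℕ.m≤m+n (suc deg) _)))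
      (trans (const-✶ (pos e′) (const (pos k) ✶ (t ✶ (f ↑ e))) (suc deg)) (cong (pos e′ ⊗_) (trans (const-✶ (pos k) (t ✶ (f ↑ e)) (suc deg)) (cong (pos k ⊗_) (t-✶-suc (f ↑ e) deg)))))

    x y : ℤ
    x = (f ↑ e) deg
    y = (f ↑ suc (suc e)) deg

    e′ : ℕ
    e′ = exponent k″ L f f0 f↑k deg

    e+k : suc (e + k′) ≡ e′
    e+k = lemma k k′ deg′ refl
      where
      lemma : ∀ k k′ deg′ → k ≡ suc k′ → suc (k * deg′ + k′ + k′) ≡ k * suc deg′ + k′
      lemma _ k′ deg′ refl = lemma′ k′ deg′
        where
        lemma′ : ∀ k′ deg′ → 1 + ((1 + k′) * deg′ + k′ + k′) ≡ (1 + k′) * (1 + deg′) + k′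
        lemma′ = ℕ-Solver.solve-∀

    -- The leading Padé coefficients are plain coefficients of powers of f, as C(n, n) = 1. The
    -- shift by k expresses both products through x y with multipliers k (e′ + 2) and k e′, whose
    -- difference is 2 k.
    top : pos (suc deg) ⊗ δ d ≡ pos 2 ⊗ pos k ⊗ (x ⊗ y)
    top = begin
      pos (suc deg) ⊗ (((a ✶ b′) d) ⊕ ⊖ ((a′ ✶ b) d))
        ≡⟨ cong₂ (λ u v → pos (suc deg) ⊗ (u ⊕ ⊖ v)) (✶-top deg (suc deg) a b′ a-degree b′-degree)
             (trans (cong (a′ ✶ b) (ℕ.+-suc deg deg)) (✶-top (suc deg) deg a′ b a′-degree b-degree)) ⟩
      pos (suc deg) ⊗ (a deg ⊗ b′ (suc deg) ⊕ ⊖ (a′ (suc deg) ⊗ b deg))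
        ≡⟨ cong₂ (λ u v → pos (suc deg) ⊗ (u ⊕ ⊖ v)) (cong₂ _⊗_ (padé-top deg (f ↑ e)) (padé-top (suc deg) (f ↑ suc (suc e′)))) (cong₂ _⊗_ (padé-top (suc deg) (f ↑ e′)) (padé-top deg (f ↑ suc (suc e)))) ⟩
      pos (suc deg) ⊗ (x ⊗ X ⊕ ⊖ (Y ⊗ y))
        ≡⟨ distribute (pos (suc deg)) x X Y y ⟩
      x ⊗ (pos (suc deg) ⊗ X) ⊕ ⊖ ((pos (suc deg) ⊗ Y) ⊗ y)
        ≡⟨ cong₂ (λ u v → x ⊗ u ⊕ ⊖ (v ⊗ y)) (shift (suc (suc e)) (suc (suc e′)) (cong (λ z → suc (suc z)) e+k)) (shift e e′ e+k) ⟩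
      x ⊗ ((pos 2 ⊕ pos e′) ⊗ (pos k ⊗ y)) ⊕ ⊖ (pos e′ ⊗ (pos k ⊗ x) ⊗ y)
        ≡⟨ collect x y (pos e′) (pos k) ⟩
      pos 2 ⊗ pos k ⊗ (x ⊗ y) ∎
      where
      open ≡-Reasoning
      X Y : ℤ
      X = (f ↑ suc (suc e′)) (suc deg)
      Y = (f ↑ e′) (suc deg)
      distribute : ∀ s x X Y y → s ⊗ (x ⊗ X ⊕ ⊖ (Y ⊗ y)) ≡ x ⊗ (s ⊗ X) ⊕ ⊖ ((s ⊗ Y) ⊗ y)
      distribute = ℤ-Solver.solve-∀
      collect : ∀ x y e k → x ⊗ ((pos 2 ⊕ e) ⊗ (k ⊗ y)) ⊕ ⊖ (e ⊗ (k ⊗ x) ⊗ y) ≡ pos 2 ⊗ k ⊗ (x ⊗ y)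
      collect = ℤ-Solver.solve-∀

  module _ (m Q : ℕ) (0<m : 0 < m) where
    private
      mᶻ v : ℤ
      mᶻ = pos m
      v  = pos (k * k * Q)
      A B A′ B′ : ℕ
      A  = ∣ ⟦ a ⟧ deg mᶻ v ∣
      B  = ∣ ⟦ b ⟧ deg mᶻ v ∣
      A′ = ∣ ⟦ a′ ⟧ (suc deg) mᶻ v ∣
      B′ = ∣ ⟦ b′ ⟧ (suc deg) mᶻ v ∣

      pos-∣∣ : ∀ g n → (∀ j → 0ℤ ℤ.≤ g j) → pos ∣ ⟦ g ⟧ n mᶻ v ∣ ≡ ⟦ g ⟧ n mᶻ v
      pos-∣∣ g n p = ℤ.0≤i⇒+∣i∣≡i (⟦⟧-nonneg g n mᶻ v p (ℤ.+≤+ z≤n) (ℤ.+≤+ z≤n))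

    -- The polynomial a b′ - a′ b has degree at most 2r + 1 and vanishes modulo t^(2r+1), since b ≡
    -- f a and b′ ≡ f a′. So it is one monomial, and its coefficient is positive because x and y
    -- are.
    consecutive-independent : A * B′ ≢ A′ * B
    consecutive-independent eq = ℤ.<-irrefl (sym zero-product) positive-product
      where
      open ≡-Reasoning
      cast : ∀ g h i j → (∀ l → 0ℤ ℤ.≤ g l) → (∀ l → 0ℤ ℤ.≤ h l) → ⟦ g ⟧ i mᶻ v ⊗ ⟦ h ⟧ j mᶻ v ≡ pos (∣ ⟦ g ⟧ i mᶻ v ∣ * ∣ ⟦ h ⟧ j mᶻ v ∣)
      cast g h i j p q = trans (sym (cong₂ _⊗_ (pos-∣∣ g i p) (pos-∣∣ h j q))) (sym (ℤ.pos-* ∣ ⟦ g ⟧ i mᶻ v ∣ ∣ ⟦ h ⟧ j mᶻ v ∣))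
      ab′ : ⟦ a ✶ b′ ⟧ d mᶻ v ≡ pos (A * B′)
      ab′ = trans (⟦⟧-✶ deg (suc deg) a b′ mᶻ v a-degree b′-degree)
        (cast a b′ deg (suc deg) (λ j → proj₁ (a⊑D k″ L f f0 f↑k deg′ r≤ j)) (λ j → proj₁ (b⊑D k″ L f f0 f↑k deg ℕ.≤-refl j)))
      a′b : ⟦ a′ ✶ b ⟧ d mᶻ v ≡ pos (A′ * B)
      a′b = trans (cong (λ n → ⟦ a′ ✶ b ⟧ n mᶻ v) (ℕ.+-suc deg deg)) (trans (⟦⟧-✶ (suc deg) deg a′ b mᶻ v a′-degree b-degree)
        (cast a′ b (suc deg) deg (λ j → proj₁ (a⊑D k″ L f f0 f↑k deg ℕ.≤-refl j)) (λ j → proj₁ (b⊑D k″ L f f0 f↑k deg′ r≤ j))))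
      ⟦δ⟧-zero : ⟦ δ ⟧ d mᶻ v ≡ 0ℤ
      ⟦δ⟧-zero = begin
        ⟦ δ ⟧ d mᶻ v                                   ≡⟨ ⟦⟧-✢ (a ✶ b′) (neg (a′ ✶ b)) d mᶻ v ⟩
        ⟦ a ✶ b′ ⟧ d mᶻ v ⊕ ⟦ neg (a′ ✶ b) ⟧ d mᶻ v    ≡⟨ cong₂ _⊕_ ab′ (trans (⟦⟧-neg (a′ ✶ b) d mᶻ v) (cong ⊖_ a′b)) ⟩
        pos (A * B′) ⊝ pos (A′ * B)                 ≡⟨ ℤ.i≡j⇒i-j≡0 (cong pos eq) ⟩
        0ℤ ∎
      ⟦δ⟧-top : ⟦ δ ⟧ d mᶻ v ≡ mᶻ ^ᶻ d ⊗ δ d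
      ⟦δ⟧-top = ⟦⟧-monomial δ d mᶻ v λ j j<d → trans (Mod.coefficient δ≋0 j (ℕ.<-≤-trans j<d (ℕ.≤-reflexive d≡)))
          (Mod.const0-zero (suc (2 * deg)) j)
        where
        d≡ : d ≡ suc (2 * deg)
        d≡ = trans (ℕ.+-suc deg deg) (cong (λ n → suc (deg + n)) (sym (ℕ.+-identityʳ deg)))
      zero-product : mᶻ ^ᶻ d ⊗ (pos 2 ⊗ pos k ⊗ (x ⊗ y)) ≡ 0ℤ
      zero-product = begin
        mᶻ ^ᶻ d ⊗ (pos 2 ⊗ pos k ⊗ (x ⊗ y))    ≡⟨ cong (mᶻ ^ᶻ d ⊗_) top ⟨
        mᶻ ^ᶻ d ⊗ (pos (suc deg) ⊗ δ d)           ≡⟨ swap (mᶻ ^ᶻ d) (pos (suc deg)) (δ d) ⟩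
        pos (suc deg) ⊗ (mᶻ ^ᶻ d ⊗ δ d)           ≡⟨ cong (pos (suc deg) ⊗_) (trans (sym ⟦δ⟧-top) ⟦δ⟧-zero) ⟩
        pos (suc deg) ⊗ 0ℤ                       ≡⟨ ℤ.*-zeroʳ (pos (suc deg)) ⟩
        0ℤ ∎
        where
        swap : ∀ x y z → x ⊗ (y ⊗ z) ≡ y ⊗ (x ⊗ z)
        swap = ℤ-Solver.solve-∀
      ⊗-positive : ∀ {p q} → 0ℤ ℤ.< p → 0ℤ ℤ.< q → 0ℤ ℤ.< p ⊗ q
      ⊗-positive {p} {q} 0<p 0<q = ℤ.≤-<-trans (ℤ.≤-reflexive (sym (ℤ.*-zeroʳ p))) (ℤ.*-monoˡ-<-pos p ⦃ ℤ.positive 0<p ⦄ 0<q)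
      u^-positive : ∀ n → 0ℤ ℤ.< mᶻ ^ᶻ n
      u^-positive zero    = ℤ.+<+ (s≤s z≤n)
      u^-positive (suc n) = ⊗-positive {mᶻ} (ℤ.+<+ 0<m) (u^-positive n)
      x-positive : 0ℤ ℤ.< x
      x-positive = power-positive k deg′ L (d-A k″ L f f0 f↑k) (f ↑ e) (rec-A k″ L f f0 f↑k deg′) (↑-zero-coefficient f e f0) r≤ (s≤s z≤n) (d-A≤ k″ L f f0 f↑k) deg ℕ.≤-refl
      y-positive : 0ℤ ℤ.< y
      y-positive = power-positive k deg′ L (d-B k″ L f f0 f↑k) (f ↑ suc (suc e)) (rec-B k″ L f f0 f↑k deg′) (↑-zero-coefficient f (suc (suc e)) f0) r≤ (s≤s z≤n) (d-B≤ k″ L f f0 f↑k) deg ℕ.≤-refl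
      positive-product : 0ℤ ℤ.< mᶻ ^ᶻ d ⊗ (pos 2 ⊗ pos k ⊗ (x ⊗ y))
      positive-product = ⊗-positive {mᶻ ^ᶻ d} (u^-positive d) (⊗-positive {pos 2 ⊗ pos k} (ℤ.+<+ (s≤s z≤n)) (⊗-positive {x} {y} x-positive y-positive))

consecutive-padé-values : ∀ k deg m Q → 2 ≤ k → 1 ≤ deg → 1 ≤ m → ∃[ A ] ∃[ B ] ∃[ A′ ] ∃[ B′ ]
  PadéValues k deg m Q A B × PadéValues k (suc deg) m Q A′ B′ × A * B′ ≢ A′ * B
consecutive-padé-values (suc (suc k″)) (suc deg′) m Q (s≤s (s≤s z≤n)) (s≤s z≤n) 0<m = from-root (Powers.root L (suc k″))
  where
  k deg L : ℕ
  k = suc (suc k″)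
  deg = suc deg′
  -- One root serves both approximants, so its precision is that of the larger one.
  L = suc (2 * suc deg)
  from-root : ∃[ f ] f 0 ≡ 1ℤ × Mod._≋_ L (f ↑ k) (φ k) → ∃[ A ] ∃[ B ] ∃[ A′ ] ∃[ B′ ]
    PadéValues k deg m Q A B × PadéValues k (suc deg) m Q A′ B′ × A * B′ ≢ A′ * B
  from-root (f , f0 , f↑k) =
      value deg (denominator k″ L f f0 f↑k deg′) , value deg (numerator k″ L f f0 f↑k deg′)
    , value (suc deg) (denominator k″ L f f0 f↑k deg) , value (suc deg) (numerator k″ L f f0 f↑k deg)
    , padé-values k″ L f f0 f↑k deg′ (s≤s (ℕ.*-monoʳ-≤ 2 (ℕ.n≤1+n deg))) m Q
    , padé-values k″ L f f0 f↑k deg ℕ.≤-refl m Q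
    , consecutive-independent k″ deg′ f f0 f↑k m Q 0<m
    where
    value : ℕ → Series → ℕ
    value n g = ∣ ⟦ g ⟧ n (pos m) (pos (k * k * Q)) ∣

-- Pairs of solutions

^-swap : ∀ x m n → (x ^ m) ^ n ≡ (x ^ n) ^ m
^-swap x m n = trans (ℕ.^-*-assoc x m n) (trans (cong (x ^_) (ℕ.*-comm m n)) (sym (ℕ.^-*-assoc x n m)))

^-distrib-* : ∀ n x y → (x * y) ^ n ≡ x ^ n * y ^ n
^-distrib-* zero    x y = refl
^-distrib-* (suc n) x y = trans (cong (x * y *_) (^-distrib-* n x y)) (swap x y (x ^ n) (y ^ n))
  where
  swap : ∀ x y X Y → x * y * (X * Y) ≡ x * X * (y * Y)
  swap = ℕ-Solver.solve-∀

^-positive : ∀ x n → 0 < x → 0 < x ^ n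
^-positive x n 0<x = >-nonZero⁻¹ (x ^ n) ⦃ ℕ.m^n≢0 x n ⦃ >-nonZero 0<x ⦄ ⦄

*-positive : ∀ {x y} → 0 < x → 0 < y → 0 < x * y
*-positive {suc x} {suc y} _ _ = s≤s z≤n

cancelˡ : ∀ z {x y} → 0 < z → z * x ≤ z * y → x ≤ y
cancelˡ z 0<z = ℕ.*-cancelˡ-≤ z ⦃ >-nonZero 0<z ⦄

-- That is, (1 + 1/k)^i ≤ 1 + i/k + (i/k)².
[1+1/k]^i-bound : ∀ k i → i ≤ k → suc k ^ i * (k * k) ≤ k ^ i * (k * k + i * k + i * i)
[1+1/k]^i-bound k zero    _   = ℕ.≤-reflexive (lemma k)
  where
  lemma : ∀ k → 1 * (k * k) ≡ 1 * (k * k + 0 * k + 0 * 0)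
  lemma = ℕ-Solver.solve-∀
[1+1/k]^i-bound k (suc i) i<k = begin
  suc k * suc k ^ i * (k * k)                       ≡⟨ ℕ.*-assoc (suc k) (suc k ^ i) (k * k) ⟩
  suc k * (suc k ^ i * (k * k))                     ≤⟨ ℕ.*-monoʳ-≤ (suc k) ([1+1/k]^i-bound k i (ℕ.<⇒≤ i<k)) ⟩
  suc k * (k ^ i * (k * k + i * k + i * i))         ≡⟨ expand k i (k ^ i) ⟩
  k ^ i * (k * (k * k + i * k + i * i + k + i) + i * i)   ≤⟨ ℕ.*-monoʳ-≤ (k ^ i) (ℕ.+-monoʳ-≤ (k * (k * k + i * k + i * i + k + i))
      (ℕ.*-mono-≤ {i} {k} (ℕ.<⇒≤ i<k) (ℕ.n≤1+n i))) ⟩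
  k ^ i * (k * (k * k + i * k + i * i + k + i) + k * suc i)  ≡⟨ collect k i (k ^ i) ⟩
  k * k ^ i * (k * k + suc i * k + suc i * suc i) ∎
  where
  open ℕ.≤-Reasoning
  expand : ∀ k i x → (1 + k) * (x * (k * k + i * k + i * i)) ≡ x * (k * (k * k + i * k + i * i + k + i) + i * i)
  expand = ℕ-Solver.solve-∀
  collect : ∀ k i x → x * (k * (k * k + i * k + i * i + k + i) + k * (1 + i)) ≡ k * x * (k * k + (1 + i) * k + (1 + i) * (1 + i))
  collect = ℕ-Solver.solve-∀

[1+k]^k≤3k^k : ∀ k → 0 < k → suc k ^ k ≤ 3 * k ^ k
[1+k]^k≤3k^k k 0<k = cancelˡ (k * k) (*-positive 0<k 0<k) (begin
  k * k * suc k ^ k                    ≡⟨ ℕ.*-comm (k * k) (suc k ^ k) ⟩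
  suc k ^ k * (k * k)                  ≤⟨ [1+1/k]^i-bound k k ℕ.≤-refl ⟩
  k ^ k * (k * k + k * k + k * k)      ≡⟨ lemma k (k ^ k) ⟩
  k * k * (3 * k ^ k) ∎)
  where
  open ℕ.≤-Reasoning
  lemma : ∀ k x → x * (k * k + k * k + k * k) ≡ k * k * (3 * x)
  lemma = ℕ-Solver.solve-∀

[Q+m]^k≤3Q^k : ∀ k Q m → 0 < k → k * m ≤ Q → (Q + m) ^ k ≤ 3 * Q ^ k
[Q+m]^k≤3Q^k k Q m 0<k km≤Q = cancelˡ (k ^ k) (^-positive k k 0<k) (begin
  k ^ k * (Q + m) ^ k        ≡⟨ ^-distrib-* k k (Q + m) ⟨
  (k * (Q + m)) ^ k          ≤⟨ ℕ.^-monoˡ-≤ k (ℕ.≤-trans (ℕ.≤-reflexive (ℕ.*-distribˡ-+ k Q m))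
                                  (ℕ.≤-trans (ℕ.+-monoʳ-≤ (k * Q) km≤Q) (ℕ.≤-reflexive (ℕ.+-comm (k * Q) Q)))) ⟩
  (suc k * Q) ^ k            ≡⟨ ^-distrib-* k (suc k) Q ⟩
  suc k ^ k * Q ^ k          ≤⟨ ℕ.*-monoˡ-≤ (Q ^ k) ([1+k]^k≤3k^k k 0<k) ⟩
  3 * k ^ k * Q ^ k          ≡⟨ lemma (k ^ k) (Q ^ k) ⟩
  k ^ k * (3 * Q ^ k) ∎)
  where
  open ℕ.≤-Reasoning
  lemma : ∀ x y → 3 * x * y ≡ x * (3 * y)
  lemma = ℕ-Solver.solve-∀

C≤2^n : ∀ n i → n C i ≤ 2 ^ n
C≤2^n zero    zero    = s≤s z≤n
C≤2^n zero    (suc i) = z≤n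
C≤2^n (suc n) zero    = ^-positive 2 (suc n) (s≤s z≤n)
C≤2^n (suc n) (suc i) = begin
  suc n C suc i               ≡⟨ nCk+nC[k+1]≡[n+1]C[k+1] n i ⟨
  n C i + n C suc i           ≤⟨ ℕ.+-mono-≤ (C≤2^n n i) (C≤2^n n (suc i)) ⟩
  2 ^ n + 2 ^ n               ≡⟨ cong (2 ^ n +_) (ℕ.+-identityʳ (2 ^ n)) ⟨
  2 ^ suc n ∎
  where open ℕ.≤-Reasoning

central≤4^r : ∀ r → central r ≤ 4 ^ r
central≤4^r r = ℕ.≤-trans (C≤2^n (2 * r) r) (ℕ.≤-reflexive (sym (ℕ.^-*-assoc 2 2 r)))

power-gap : ∀ j p → p ^ suc j + suc j * p ^ j ≤ suc p ^ suc j
power-gap zero    p = ℕ.≤-reflexive (lemma p)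
  where
  lemma : ∀ p → p * 1 + 1 * 1 ≡ (1 + p) * 1
  lemma = ℕ-Solver.solve-∀
power-gap (suc j) p = begin
  p * p ^ suc j + suc (suc j) * p ^ suc j              ≤⟨ ℕ.m≤m+n _ (suc j * p ^ j) ⟩
  p * p ^ suc j + suc (suc j) * p ^ suc j + suc j * p ^ j  ≡⟨ lemma p j (p ^ j) ⟩
  suc p * (p ^ suc j + suc j * p ^ j)                  ≤⟨ ℕ.*-monoʳ-≤ (suc p) (power-gap j p) ⟩
  suc p * suc p ^ suc j ∎
  where
  open ℕ.≤-Reasoning
  lemma : ∀ p j x → p * (p * x) + (2 + j) * (p * x) + (1 + j) * x ≡ (1 + p) * (p * x + (1 + j) * x)
  lemma = ℕ-Solver.solve-∀

-- From q ≥ p + 1 follows q^k - p^k ≥ k p^(k-1). Raising the resulting bound on k γ G p^(k-1) to the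
-- k-th power leaves p only in the form γ p^k, for which a lower bound Z is at hand.
ordered-powers : ∀ j γ G T Z p q → let k = suc j in p < q →
  G * (γ * q ^ k) ≤ G * (γ * p ^ k) + T → Z ≤ γ * p ^ k → G ^ k * (k ^ k * γ * Z ^ j) ≤ T ^ k
ordered-powers j γ G T Z p q p<q q≤p Z≤p = begin
  G ^ k * (k ^ k * γ * Z ^ j)                ≤⟨ ℕ.*-monoʳ-≤ (G ^ k) (ℕ.*-monoʳ-≤ (k ^ k * γ) (ℕ.^-monoˡ-≤ j Z≤p)) ⟩
  G ^ k * (k ^ k * γ * (γ * p ^ k) ^ j)      ≡⟨ cong (λ z → G ^ k * (k ^ k * γ * z)) (trans (^-distrib-* j γ (p ^ k)) (cong (γ ^ j *_) (^-swap p k j))) ⟩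
  G ^ k * (k ^ k * γ * (γ ^ j * (p ^ j) ^ k))  ≡⟨ regroup (G ^ k) (k ^ k) γ (γ ^ j) ((p ^ j) ^ k) ⟩
  (G ^ k * (k ^ k * γ ^ k)) * (p ^ j) ^ k      ≡⟨ cong (λ z → G ^ k * z * (p ^ j) ^ k) (^-distrib-* k k γ) ⟨
  (G ^ k * (k * γ) ^ k) * (p ^ j) ^ k          ≡⟨ cong (_* (p ^ j) ^ k) (^-distrib-* k G (k * γ)) ⟨
  (G * (k * γ)) ^ k * (p ^ j) ^ k              ≡⟨ ^-distrib-* k (G * (k * γ)) (p ^ j) ⟨
  (G * (k * γ) * p ^ j) ^ k                    ≤⟨ ℕ.^-monoˡ-≤ k difference ⟩
  T ^ k ∎
  where
  open ℕ.≤-Reasoning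
  k : ℕ
  k = suc j
  regroup : ∀ g κ γ γj x → g * (κ * γ * (γj * x)) ≡ (g * (κ * (γ * γj))) * x
  regroup = ℕ-Solver.solve-∀
  difference : G * (k * γ) * p ^ j ≤ T
  difference = ℕ.+-cancelˡ-≤ (G * (γ * p ^ k)) _ _ (begin
    G * (γ * p ^ k) + G * (k * γ) * p ^ j      ≡⟨ factor G γ (p ^ k) k (p ^ j) ⟩
    G * (γ * (p ^ k + k * p ^ j))              ≤⟨ ℕ.*-monoʳ-≤ G (ℕ.*-monoʳ-≤ γ (ℕ.≤-trans (power-gap j p) (ℕ.^-monoˡ-≤ k p<q))) ⟩
    G * (γ * q ^ k)                            ≤⟨ q≤p ⟩
    G * (γ * p ^ k) + T ∎)
    where
    factor : ∀ G γ x k y → G * (γ * x) + G * (k * γ) * y ≡ G * (γ * (x + k * y))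
    factor = ℕ-Solver.solve-∀

distinct-powers : ∀ j γ G T Z p q → let k = suc j in p ≢ q →
  G * (γ * p ^ k) ≤ G * (γ * q ^ k) + T → G * (γ * q ^ k) ≤ G * (γ * p ^ k) + T →
  Z ≤ γ * p ^ k → Z ≤ γ * q ^ k → G ^ k * (k ^ k * γ * Z ^ j) ≤ T ^ k
distinct-powers j γ G T Z p q p≢q p≤q q≤p Z≤p Z≤q with ℕ.<-cmp p q
... | tri< p<q _ _ = ordered-powers j γ G T Z p q p<q q≤p Z≤p
... | tri≈ _ p≡q _ = ⊥-elim (p≢q p≡q)
... | tri> _ _ q<p = ordered-powers j γ G T Z q p q<p p≤q Z≤q

-- The gap principle and the Padé dichotomy

record Solution (k α β m Q : ℕ) : Set where
  field
    x y : ℕ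
    αx^k : α * x ^ k ≡ Q + m
    βy^k : β * y ^ k ≡ Q
open Solution

-- The factors A and B are kept general so that the gap principle, with A = B = 1, and the Padé
-- argument use the same identities.
α-side : ∀ k α β x A Y Q m Q′ → α * x ^ k ≡ Q + m → β * Y ^ k ≡ Q′ → α * β * (x * A * Y) ^ k ≡ (Q + m) * A ^ k * Q′
α-side k α β x A Y Q m Q′ p q = trans (cong (α * β *_) (trans (^-distrib-* k (x * A) Y) (cong (_* Y ^ k) (^-distrib-* k x A))))
  (trans (regroup α β (x ^ k) (A ^ k) (Y ^ k)) (cong₂ (λ u v → u * A ^ k * v) p q))
  where
  regroup : ∀ α β x A Y → α * β * (x * A * Y) ≡ α * x * A * (β * Y)
  regroup = ℕ-Solver.solve-∀

β-side : ∀ k α β y B X Q m Q′ → β * y ^ k ≡ Q → α * X ^ k ≡ Q′ + m → α * β * (y * B * X) ^ k ≡ Q * B ^ k * (Q′ + m)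
β-side k α β y B X Q m Q′ p q = trans (cong (α * β *_) (trans (^-distrib-* k (y * B) X) (cong (_* X ^ k) (^-distrib-* k y B))))
  (trans (regroup α β (y ^ k) (B ^ k) (X ^ k)) (cong₂ (λ u v → u * B ^ k * v) p q))
  where
  regroup : ∀ α β y B X → α * β * (y * B * X) ≡ β * y * B * (α * X)
  regroup = ℕ-Solver.solve-∀

-- Multiplied by α β, the k-th powers of x y′ and y x′ are Q Q′ + m Q′ and Q Q′ + m Q. They differ
-- because Q ≠ Q′, and by at most m Q′. Comparing with Z = Q Q′ leaves a common factor Q′^(k-1) to
-- cancel.
gap-principle : ∀ j α β m Q Q′ → let k = suc j in 0 < m → Q < Q′ → Solution k α β m Q → Solution k α β m Q′ →
  k ^ k * (α * β) * Q ^ j ≤ Q′ * m ^ k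
gap-principle j α β m Q Q′ 0<m Q<Q′ S S′ = cancelˡ (Q′ ^ j) (^-positive Q′ j (ℕ.≤-<-trans z≤n Q<Q′)) (begin
  Q′ ^ j * (W * Q ^ j)                ≡⟨ swap (Q′ ^ j) W (Q ^ j) ⟩
  W * (Q ^ j * Q′ ^ j)                ≡⟨ cong (W *_) (^-distrib-* j Q Q′) ⟨
  W * (Q * Q′) ^ j                    ≡⟨ trans (cong (_* (W * (Q * Q′) ^ j)) (ℕ.^-zeroˡ k)) (ℕ.*-identityˡ _) ⟨
  1 ^ k * (W * (Q * Q′) ^ j)          ≤⟨ distinct-powers j (α * β) 1 (m * Q′) (Q * Q′) p q p≢q
        (ℕ.≤-trans (ℕ.≤-reflexive (trans (ℕ.*-identityˡ _) p^k)) (ℕ.≤-trans (ℕ.+-monoˡ-≤ (m * Q′) (ℕ.≤-trans (ℕ.m≤m+n (Q * Q′) (m * Q)) (ℕ.≤-reflexive (sym q^k)))) (ℕ.≤-reflexive (cong (_+ m * Q′) (sym (ℕ.*-identityˡ (α * β * q ^ k)))))))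
        (ℕ.≤-trans (ℕ.≤-reflexive (trans (ℕ.*-identityˡ _) q^k)) (ℕ.≤-trans (ℕ.+-monoʳ-≤ (Q * Q′) (ℕ.*-monoʳ-≤ m (ℕ.<⇒≤ Q<Q′))) (ℕ.≤-trans (ℕ.≤-reflexive (trans (sym p^k) (sym (ℕ.*-identityˡ _)))) (ℕ.m≤m+n _ (m * Q′)))))
        (ℕ.≤-trans (ℕ.m≤m+n (Q * Q′) (m * Q′)) (ℕ.≤-reflexive (sym p^k)))
        (ℕ.≤-trans (ℕ.m≤m+n (Q * Q′) (m * Q)) (ℕ.≤-reflexive (sym q^k))) ⟩
  (m * Q′) ^ k                        ≡⟨ ^-distrib-* k m Q′ ⟩
  m ^ k * (Q′ * Q′ ^ j)               ≡⟨ regroup (m ^ k) Q′ (Q′ ^ j) ⟩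
  Q′ ^ j * (Q′ * m ^ k) ∎)
  where
  open ℕ.≤-Reasoning
  k W p q : ℕ
  k = suc j
  W = k ^ k * (α * β)
  p = x S * 1 * y S′
  q = y S * 1 * x S′
  p^k : α * β * p ^ k ≡ Q * Q′ + m * Q′
  p^k = trans (α-side k α β (x S) 1 (y S′) Q m Q′ (αx^k S) (βy^k S′)) (trans (cong (λ z → (Q + m) * z * Q′) (ℕ.^-zeroˡ k)) (lemma Q m Q′))
    where
    lemma : ∀ Q m Q′ → (Q + m) * 1 * Q′ ≡ Q * Q′ + m * Q′
    lemma = ℕ-Solver.solve-∀
  q^k : α * β * q ^ k ≡ Q * Q′ + m * Q
  q^k = trans (β-side k α β (y S) 1 (x S′) Q m Q′ (βy^k S) (αx^k S′)) (trans (cong (λ z → Q * z * (Q′ + m)) (ℕ.^-zeroˡ k)) (lemma Q m Q′))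
    where
    lemma : ∀ Q m Q′ → Q * 1 * (Q′ + m) ≡ Q * Q′ + m * Q
    lemma = ℕ-Solver.solve-∀
  p≢q : p ≢ q
  p≢q p≡q = ℕ.<-irrefl (ℕ.*-cancelˡ-≡ Q Q′ m ⦃ >-nonZero 0<m ⦄
      (ℕ.+-cancelˡ-≡ (Q * Q′) (m * Q) (m * Q′) (trans (sym q^k) (trans (cong (λ z → α * β * z ^ k) (sym p≡q)) p^k)))) Q<Q′
  swap : ∀ a b c → a * (b * c) ≡ b * (c * a)
  swap = ℕ-Solver.solve-∀
  regroup : ∀ a b c → a * (b * c) ≡ c * (b * a)
  regroup = ℕ-Solver.solve-∀

-- Up to lower-order factors, Large says Q′ ≥ Q^(kr+k-1) and Small says Q′ ≤ Q^((kr+1)/(k-1)): the two ways in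
-- which the r-th approximant can fail to separate the solutions. Here γ = α β.
Large Small : (k γ m Q Q′ r : ℕ) → Set
Large k γ m Q Q′ r = k ^ k * γ * Q ^ (k ∸ 1) * (Q ^ r) ^ k ≤ Q′ * (2 * suc k * m * (12 * (k * k) * (k * k) * (m * m)) ^ r) ^ k
Small k γ m Q Q′ r = k ^ k * γ * Q′ ^ (k ∸ 1) ≤ Q * (2 * m * (12 * (k * k) * Q) ^ r) ^ k

private
  ^-double : ∀ x r → x ^ (2 * r) ≡ x ^ r * x ^ r
  ^-double x r = trans (cong (x ^_) (cong (r +_) (ℕ.+-identityʳ r))) (ℕ.^-distribˡ-+-* x r r)

  -- The tail bound relative to the weight G of the comparison. The factor 3^r comes from (1 +
  -- 1/k)^(k r), after the power k^(k r) has been matched with the one in G.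
  tail-estimate : ∀ k r m Q → 0 < k → let K = k * k; a₀ = central r * (K * Q) ^ r in
    tail-bound k r m Q * (Q ^ r * Q ^ r) ≤
      Q ^ suc (2 * r) * (k ^ suc (k * r) * K) * (suc k * (3 ^ r * K ^ r) * m ^ suc (2 * r) * a₀ ^ k)
  tail-estimate k r m Q 0<k = begin
    (k * m) ^ s * (suc k * (K * Q) * (c₀ * (suc k * (K * Q)) ^ r) ^ k) * (q * q)
      ≡⟨ cong₂ (λ u v → u * (suc k * (K * Q) * v) * (q * q)) (^-distrib-* s k m)
           (trans (cong (λ z → (c₀ * z) ^ k) (^-distrib-* r (suc k) (K * Q))) (split c₀ (suc k ^ r) ((K * Q) ^ r))) ⟩
    k ^ s * m ^ s * (suc k * (K * Q) * ((suc k ^ r) ^ k * a₀ ^ k)) * (q * q)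
      ≤⟨ ℕ.*-monoˡ-≤ (q * q) (ℕ.*-monoʳ-≤ (k ^ s * m ^ s) (ℕ.*-monoʳ-≤ (suc k * (K * Q)) (ℕ.*-monoˡ-≤ (a₀ ^ k) power-bound))) ⟩
    k ^ s * m ^ s * (suc k * (K * Q) * (3 ^ r * k ^ (k * r) * a₀ ^ k)) * (q * q)
      ≡⟨ cong (λ z → z * m ^ s * (suc k * (K * Q) * (3 ^ r * k ^ (k * r) * a₀ ^ k)) * (q * q)) (cong (k *_) (trans (^-double k r) (sym (^-distrib-* r k k)))) ⟩
    k * K ^ r * m ^ s * (suc k * (K * Q) * (3 ^ r * k ^ (k * r) * a₀ ^ k)) * (q * q)
      ≡⟨ regroup k (K ^ r) (m ^ s) (suc k) K Q (3 ^ r) (k ^ (k * r)) (a₀ ^ k) (q * q) ⟩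
    Q * (q * q) * (k * k ^ (k * r) * K) * (suc k * (3 ^ r * K ^ r) * m ^ s * a₀ ^ k)
      ≡⟨ cong (λ z → Q * z * (k * k ^ (k * r) * K) * (suc k * (3 ^ r * K ^ r) * m ^ s * a₀ ^ k)) (^-double Q r) ⟨
    Q ^ s * (k ^ suc (k * r) * K) * (suc k * (3 ^ r * K ^ r) * m ^ s * a₀ ^ k) ∎
    where
    open ℕ.≤-Reasoning
    K s c₀ a₀ q : ℕ
    K  = k * k
    s  = suc (2 * r)
    c₀ = central r
    a₀ = c₀ * (K * Q) ^ r
    q  = Q ^ r
    split : ∀ c x y → (c * (x * y)) ^ k ≡ x ^ k * (c * y) ^ k
    split c x y = trans (cong (_^ k) (swap c x y)) (^-distrib-* k x (c * y))
      where
      swap : ∀ c x y → c * (x * y) ≡ x * (c * y)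
      swap = ℕ-Solver.solve-∀
    power-bound : (suc k ^ r) ^ k ≤ 3 ^ r * k ^ (k * r)
    power-bound = begin
      (suc k ^ r) ^ k        ≡⟨ ^-swap (suc k) r k ⟩
      (suc k ^ k) ^ r        ≤⟨ ℕ.^-monoˡ-≤ r ([1+k]^k≤3k^k k 0<k) ⟩
      (3 * k ^ k) ^ r        ≡⟨ trans (^-distrib-* r 3 (k ^ k)) (cong (3 ^ r *_) (ℕ.^-*-assoc k k r)) ⟩
      3 ^ r * k ^ (k * r) ∎
    regroup : ∀ k κ μ l K Q t λ′ a q → k * κ * μ * (l * (K * Q) * (t * λ′ * a)) * q ≡ Q * q * (k * λ′ * K) * (l * (t * κ) * μ * a)
    regroup = ℕ-Solver.solve-∀

  -- Each of the r linear factors of the majorant contributes (1 + m/Q)^k, which is at most 3 as k m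
  -- ≤ Q.
  B-power-bound : ∀ k r m Q B → 0 < k → k * m ≤ Q → let K = k * k; a₀ = central r * (K * Q) ^ r in
    B ≤ central r * (K * Q + K * m) ^ r → B ^ k ≤ 3 ^ r * a₀ ^ k
  B-power-bound k r m Q B 0<k km≤Q B≤ = begin
    B ^ k                                     ≤⟨ ℕ.^-monoˡ-≤ k B≤ ⟩
    (c₀ * (K * Q + K * m) ^ r) ^ k            ≡⟨ cong (λ z → (c₀ * z ^ r) ^ k) (ℕ.*-distribˡ-+ K Q m) ⟨
    (c₀ * (K * (Q + m)) ^ r) ^ k              ≡⟨ expand (Q + m) ⟩
    c₀ ^ k * ((K ^ k) ^ r * ((Q + m) ^ k) ^ r)  ≤⟨ ℕ.*-monoʳ-≤ (c₀ ^ k) (ℕ.*-monoʳ-≤ ((K ^ k) ^ r) (ℕ.^-monoˡ-≤ r ([Q+m]^k≤3Q^k k Q m 0<k km≤Q))) ⟩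
    c₀ ^ k * ((K ^ k) ^ r * (3 * Q ^ k) ^ r)  ≡⟨ cong (λ z → c₀ ^ k * ((K ^ k) ^ r * z)) (^-distrib-* r 3 (Q ^ k)) ⟩
    c₀ ^ k * ((K ^ k) ^ r * (3 ^ r * (Q ^ k) ^ r))  ≡⟨ regroup (c₀ ^ k) ((K ^ k) ^ r) (3 ^ r) ((Q ^ k) ^ r) ⟩
    3 ^ r * (c₀ ^ k * ((K ^ k) ^ r * (Q ^ k) ^ r))  ≡⟨ cong (3 ^ r *_) (expand Q) ⟨
    3 ^ r * (c₀ * (K * Q) ^ r) ^ k ∎
    where
    open ℕ.≤-Reasoning
    K c₀ : ℕ
    K  = k * k
    c₀ = central r
    expand : ∀ P → (c₀ * (K * P) ^ r) ^ k ≡ c₀ ^ k * ((K ^ k) ^ r * (P ^ k) ^ r)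
    expand P = trans (^-distrib-* k c₀ ((K * P) ^ r)) (cong (c₀ ^ k *_)
      (trans (^-swap (K * P) r k) (trans (cong (_^ r) (^-distrib-* k K P)) (^-distrib-* r (K ^ k) (P ^ k)))))
    regroup : ∀ a b c d → a * (b * (c * d)) ≡ c * (a * (b * d))
    regroup = ℕ-Solver.solve-∀

module _ (j α β m Q Q′ r A B : ℕ) (S : Solution (suc j) α β m Q) (S′ : Solution (suc j) α β m Q′)
  (0<m : 0 < m) (0<Q′ : 0 < Q′) (km≤Q : suc j * m ≤ Q) (values : PadéValues (suc j) r m Q A B)
  (A≢B : Solution.x S * A * Solution.y S′ ≢ Solution.y S * B * Solution.x S′) where
  open Solution
  open PadéValues values
  private
    k K G W c₀ a₀ T q : ℕ
    k  = suc j
    K  = k * k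
    G  = Q ^ suc (2 * r) * (k ^ suc (k * r) * K)
    W  = k ^ k * (α * β)
    c₀ = central r
    a₀ = c₀ * (K * Q) ^ r
    T  = tail-bound k r m Q
    q  = Q ^ r

    0<k : 0 < k
    0<k = s≤s z≤n
    0<Q : 0 < Q
    0<Q = ℕ.<-≤-trans (*-positive 0<k 0<m) km≤Q
    0<K : 0 < K
    0<K = *-positive 0<k 0<k
    0<G : 0 < G
    0<G = *-positive (^-positive Q (suc (2 * r)) 0<Q) (*-positive (^-positive k (suc (k * r)) 0<k) 0<K)
    0<q : 0 < q
    0<q = ^-positive Q r 0<Q
    0<a₀ : 0 < a₀
    0<a₀ = *-positive (central-positive r) (^-positive (K * Q) r (*-positive 0<K 0<Q))

    p₁ p₂ : ℕ
    p₁ = x S * A * y S′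
    p₂ = y S * B * x S′
    side₁ : α * β * p₁ ^ k ≡ (Q + m) * A ^ k * Q′
    side₁ = α-side k α β (x S) A (y S′) Q m Q′ (αx^k S) (βy^k S′)
    side₂ : α * β * p₂ ^ k ≡ Q * B ^ k * (Q′ + m)
    side₂ = β-side k α β (y S) B (x S′) Q m Q′ (βy^k S) (αx^k S′)

    a₀^k≤ : ∀ {A} → a₀ ≤ A → a₀ ^ k ≤ A ^ k
    a₀^k≤ = ℕ.^-monoˡ-≤ k

    reshape : ∀ s n K P X → s * (n * (K * P * X)) ≡ s * (n * K) * (P * X)
    reshape = ℕ-Solver.solve-∀
    A-close′ : G * ((Q + m) * A ^ k) ≤ G * (Q * B ^ k) + T
    A-close′ = ℕ.≤-trans (ℕ.≤-reflexive (sym (trans (cong (λ z → Q ^ suc (2 * r) * (k ^ suc (k * r) * (z * A ^ k))) (sym (ℕ.*-distribˡ-+ K Q m)))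
        (reshape (Q ^ suc (2 * r)) (k ^ suc (k * r)) K (Q + m) (A ^ k)))))
      (ℕ.≤-trans (A-close km≤Q) (ℕ.≤-reflexive (cong (_+ T) (reshape (Q ^ suc (2 * r)) (k ^ suc (k * r)) K Q (B ^ k)))))
    B-close′ : G * (Q * B ^ k) ≤ G * ((Q + m) * A ^ k) + T
    B-close′ = ℕ.≤-trans (ℕ.≤-reflexive (sym (reshape (Q ^ suc (2 * r)) (k ^ suc (k * r)) K Q (B ^ k))))
      (ℕ.≤-trans (B-close km≤Q) (ℕ.≤-reflexive (cong (_+ T) (trans (cong (λ z → Q ^ suc (2 * r) * (k ^ suc (k * r) * (z * A ^ k))) (sym (ℕ.*-distribˡ-+ K Q m)))
        (reshape (Q ^ suc (2 * r)) (k ^ suc (k * r)) K (Q + m) (A ^ k))))))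

    -- Two sources of error: e₁ is the failure of B/A to be the exact root, multiplied by Q′; e₂
    -- comes from Q′ + m standing on the β side where Q′ stands on the α side.
    e₁ e₂ : ℕ
    e₁ = Q′ * T
    e₂ = G * m * (Q * B ^ k)

    1≤2 : G * (α * β * p₁ ^ k) ≤ G * (α * β * p₂ ^ k) + (e₁ + e₂)
    1≤2 = begin
      G * (α * β * p₁ ^ k)                      ≡⟨ trans (cong (G *_) side₁) (sym (ℕ.*-assoc G ((Q + m) * A ^ k) Q′)) ⟩
      G * ((Q + m) * A ^ k) * Q′                ≤⟨ ℕ.*-monoˡ-≤ Q′ A-close′ ⟩
      (G * (Q * B ^ k) + T) * Q′                ≤⟨ ℕ.m≤m+n _ (e₂ + e₂) ⟩
      (G * (Q * B ^ k) + T) * Q′ + (e₂ + e₂)    ≡⟨ regroup G (Q * B ^ k) T Q′ m ⟩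
      G * (Q * B ^ k * (Q′ + m)) + (e₁ + e₂)    ≡⟨ cong (λ z → G * z + (e₁ + e₂)) side₂ ⟨
      G * (α * β * p₂ ^ k) + (e₁ + e₂) ∎
      where
      open ℕ.≤-Reasoning
      regroup : ∀ G b T Q m → (G * b + T) * Q + (G * m * b + G * m * b) ≡ G * (b * (Q + m)) + (Q * T + G * m * b)
      regroup = ℕ-Solver.solve-∀

    2≤1 : G * (α * β * p₂ ^ k) ≤ G * (α * β * p₁ ^ k) + (e₁ + e₂)
    2≤1 = begin
      G * (α * β * p₂ ^ k)                      ≡⟨ cong (G *_) side₂ ⟩
      G * (Q * B ^ k * (Q′ + m))                ≡⟨ expand G (Q * B ^ k) Q′ m ⟩
      G * (Q * B ^ k) * Q′ + e₂                 ≤⟨ ℕ.+-monoˡ-≤ e₂ (ℕ.*-monoˡ-≤ Q′ B-close′) ⟩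
      (G * ((Q + m) * A ^ k) + T) * Q′ + e₂     ≡⟨ regroup G ((Q + m) * A ^ k) T Q′ e₂ ⟩
      G * ((Q + m) * A ^ k * Q′) + (e₁ + e₂)    ≡⟨ cong (λ z → G * z + (e₁ + e₂)) side₁ ⟨
      G * (α * β * p₁ ^ k) + (e₁ + e₂) ∎
      where
      open ℕ.≤-Reasoning
      expand : ∀ G b Q m → G * (b * (Q + m)) ≡ G * b * Q + G * m * b
      expand = ℕ-Solver.solve-∀
      regroup : ∀ G a T Q e → (G * a + T) * Q + e ≡ G * (a * Q) + (Q * T + e)
      regroup = ℕ-Solver.solve-∀

    Z : ℕ
    Z = Q * Q′ * a₀ ^ k

    Z≤1 : Z ≤ α * β * p₁ ^ k
    Z≤1 = begin
      Q * Q′ * a₀ ^ k            ≤⟨ ℕ.*-mono-≤ (ℕ.*-monoˡ-≤ Q′ (ℕ.m≤m+n Q m)) (a₀^k≤ A-lower) ⟩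
      (Q + m) * Q′ * A ^ k       ≡⟨ swap (Q + m) Q′ (A ^ k) ⟩
      (Q + m) * A ^ k * Q′       ≡⟨ side₁ ⟨
      α * β * p₁ ^ k ∎
      where
      open ℕ.≤-Reasoning
      swap : ∀ a b c → a * b * c ≡ a * c * b
      swap = ℕ-Solver.solve-∀
    Z≤2 : Z ≤ α * β * p₂ ^ k
    Z≤2 = begin
      Q * Q′ * a₀ ^ k            ≤⟨ ℕ.*-mono-≤ (ℕ.*-monoʳ-≤ Q (ℕ.m≤m+n Q′ m)) (a₀^k≤ B-lower) ⟩
      Q * (Q′ + m) * B ^ k       ≡⟨ swap Q (Q′ + m) (B ^ k) ⟩
      Q * B ^ k * (Q′ + m)       ≡⟨ side₂ ⟨
      α * β * p₂ ^ k ∎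
      where
      open ℕ.≤-Reasoning
      swap : ∀ a b c → a * b * c ≡ a * c * b
      swap = ℕ-Solver.solve-∀

    main : G ^ k * (W * Z ^ j) ≤ (e₁ + e₂) ^ k
    main = distinct-powers j (α * β) G (e₁ + e₂) Z p₁ p₂ A≢B 1≤2 2≤1 Z≤1 Z≤2

    Z^j : Z ^ j ≡ Q ^ j * Q′ ^ j * (a₀ ^ k) ^ j
    Z^j = trans (^-distrib-* j (Q * Q′) (a₀ ^ k)) (cong (_* (a₀ ^ k) ^ j) (^-distrib-* j Q Q′))

    double : ∀ {a b} → a ≤ b → a + b ≤ 2 * b
    double {a} {b} a≤b = ℕ.≤-trans (ℕ.+-monoˡ-≤ b a≤b) (ℕ.≤-reflexive (cong (b +_) (sym (ℕ.+-identityʳ b))))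

    -- When e₁ dominates, Q′ occurs to the power k on the right and k - 1 on the left of `main`; a
    -- linear factor Q′ remains and is bounded below.
    large : e₂ ≤ e₁ → Large k (α * β) m Q Q′ r
    large e₂≤e₁ = cancelˡ (q ^ k) (^-positive q k 0<q) (begin
      q ^ k * (W * Q ^ j * q ^ k)
        ≡⟨ swap₁ (q ^ k) (W * Q ^ j) ⟩
      W * Q ^ j * (q ^ k * q ^ k)
        ≤⟨ step ⟩
      Q′ * (2 * e) ^ k * a₀ ^ k
        ≡⟨ cong (λ z → Q′ * (2 * e) ^ k * z) (trans (cong (λ z → (c₀ * z) ^ k) (^-distrib-* r K Q)) (trans (cong (_^ k) (sym (ℕ.*-assoc c₀ (K ^ r) q))) (^-distrib-* k (c₀ * K ^ r) q))) ⟩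
      Q′ * (2 * e) ^ k * ((c₀ * K ^ r) ^ k * q ^ k)
        ≡⟨ swap₂ Q′ ((2 * e) ^ k) ((c₀ * K ^ r) ^ k) (q ^ k) ⟩
      q ^ k * (Q′ * ((2 * e) ^ k * (c₀ * K ^ r) ^ k))
        ≡⟨ cong (λ z → q ^ k * (Q′ * z)) (^-distrib-* k (2 * e) (c₀ * K ^ r)) ⟨
      q ^ k * (Q′ * (2 * e * (c₀ * K ^ r)) ^ k)
        ≤⟨ ℕ.*-monoʳ-≤ (q ^ k) (ℕ.*-monoʳ-≤ Q′ (ℕ.^-monoˡ-≤ k e-bound)) ⟩
      q ^ k * (Q′ * (2 * suc k * m * (12 * K * K * (m * m)) ^ r) ^ k) ∎)
      where
      open ℕ.≤-Reasoning
      e : ℕ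
      e = suc k * (3 ^ r * K ^ r) * m ^ suc (2 * r)
      swap₁ : ∀ a b → a * (b * a) ≡ b * (a * a)
      swap₁ = ℕ-Solver.solve-∀
      swap₂ : ∀ a b c d → a * b * (c * d) ≡ d * (a * (b * c))
      swap₂ = ℕ-Solver.solve-∀
      -- The 12 in `Large` and `Small` is 3 · 4, from (1 + 1/k)^k ≤ 3 and C(2r, r) ≤ 4^r.
      e-bound : 2 * e * (c₀ * K ^ r) ≤ 2 * suc k * m * (12 * K * K * (m * m)) ^ r
      e-bound = begin
        2 * e * (c₀ * K ^ r)
          ≤⟨ ℕ.*-monoʳ-≤ (2 * e) (ℕ.*-monoˡ-≤ (K ^ r) (central≤4^r r)) ⟩
        2 * (suc k * (3 ^ r * K ^ r) * (m * m ^ (2 * r))) * (4 ^ r * K ^ r)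
          ≡⟨ cong (λ z → 2 * (suc k * (3 ^ r * K ^ r) * (m * z)) * (4 ^ r * K ^ r)) (trans (^-double m r) (sym (^-distrib-* r m m))) ⟩
        2 * (suc k * (3 ^ r * K ^ r) * (m * (m * m) ^ r)) * (4 ^ r * K ^ r)
          ≡⟨ regroup (suc k) (3 ^ r) (K ^ r) m ((m * m) ^ r) (4 ^ r) ⟩
        2 * suc k * m * (3 ^ r * 4 ^ r * K ^ r * K ^ r * (m * m) ^ r)
          ≡⟨ cong (2 * suc k * m *_) (trans (^-distrib-* r (12 * K * K) (m * m)) (cong (_* (m * m) ^ r) (trans (^-distrib-* r (12 * K) K) (cong (_* K ^ r) (trans (^-distrib-* r 12 K) (cong (_* K ^ r) (^-distrib-* r 3 4))))))) ⟨
        2 * suc k * m * (12 * K * K * (m * m)) ^ r ∎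
        where
        regroup : ∀ l a K m M b → 2 * (l * (a * K) * (m * M)) * (b * K) ≡ 2 * l * m * (a * b * K * K * M)
        regroup = ℕ-Solver.solve-∀
      step : W * Q ^ j * (q ^ k * q ^ k) ≤ Q′ * (2 * e) ^ k * a₀ ^ k
      step = cancelˡ (G ^ k * (Q′ ^ j * (a₀ ^ k) ^ j)) (*-positive (^-positive G k 0<G) (*-positive (^-positive Q′ j 0<Q′) (^-positive (a₀ ^ k) j (^-positive a₀ k 0<a₀)))) (begin
        G ^ k * (Q′ ^ j * (a₀ ^ k) ^ j) * (W * Q ^ j * (q ^ k * q ^ k))
          ≡⟨ shuffle₁ (G ^ k) (Q′ ^ j) ((a₀ ^ k) ^ j) W (Q ^ j) (q ^ k * q ^ k) ⟩
        G ^ k * (W * (Q ^ j * Q′ ^ j * (a₀ ^ k) ^ j)) * (q ^ k * q ^ k)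
          ≡⟨ cong₂ (λ u v → G ^ k * (W * u) * v) Z^j (^-distrib-* k q q) ⟨
        G ^ k * (W * Z ^ j) * (q * q) ^ k
          ≤⟨ ℕ.*-monoˡ-≤ ((q * q) ^ k) (ℕ.≤-trans main (ℕ.^-monoˡ-≤ k (ℕ.≤-trans (ℕ.≤-reflexive (ℕ.+-comm e₁ e₂)) (double e₂≤e₁)))) ⟩
        (2 * (Q′ * T)) ^ k * (q * q) ^ k
          ≡⟨ ^-distrib-* k (2 * (Q′ * T)) (q * q) ⟨
        (2 * (Q′ * T) * (q * q)) ^ k
          ≤⟨ ℕ.^-monoˡ-≤ k (ℕ.≤-trans (ℕ.≤-reflexive (shuffle₂ Q′ T (q * q))) (ℕ.*-monoʳ-≤ (2 * Q′) (tail-estimate k r m Q 0<k))) ⟩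
        (2 * Q′ * (G * (e * a₀ ^ k))) ^ k
          ≡⟨ cong (_^ k) (shuffle₃ Q′ G e (a₀ ^ k)) ⟩
        (G * (Q′ * (2 * e * a₀ ^ k))) ^ k
          ≡⟨ trans (^-distrib-* k G _) (cong (G ^ k *_) (trans (^-distrib-* k Q′ _) (cong (Q′ ^ k *_) (^-distrib-* k (2 * e) (a₀ ^ k))))) ⟩
        G ^ k * (Q′ * Q′ ^ j * ((2 * e) ^ k * (a₀ ^ k * (a₀ ^ k) ^ j)))
          ≡⟨ shuffle₄ (G ^ k) Q′ (Q′ ^ j) ((2 * e) ^ k) (a₀ ^ k) ((a₀ ^ k) ^ j) ⟩
        G ^ k * (Q′ ^ j * (a₀ ^ k) ^ j) * (Q′ * (2 * e) ^ k * a₀ ^ k) ∎)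
        where
        shuffle₁ : ∀ G Q a W P s → G * (Q * a) * (W * P * s) ≡ G * (W * (P * Q * a)) * s
        shuffle₁ = ℕ-Solver.solve-∀
        shuffle₂ : ∀ Q T s → 2 * (Q * T) * s ≡ 2 * Q * (T * s)
        shuffle₂ = ℕ-Solver.solve-∀
        shuffle₃ : ∀ Q G e a → 2 * Q * (G * (e * a)) ≡ G * (Q * (2 * e * a))
        shuffle₃ = ℕ-Solver.solve-∀
        shuffle₄ : ∀ G Q P e a b → G * (Q * P * (e * (a * b))) ≡ G * (P * b) * (Q * e * a)
        shuffle₄ = ℕ-Solver.solve-∀

    -- When e₂ dominates, the right side of `main` is free of Q′, so that Q′^(k-1) on the left is
    -- bounded above.
    small : e₁ ≤ e₂ → Small k (α * β) m Q Q′ r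
    small e₁≤e₂ = cancelˡ (G ^ k * (Q ^ j * (a₀ ^ k) ^ j)) (*-positive (^-positive G k 0<G) (*-positive (^-positive Q j 0<Q) (^-positive (a₀ ^ k) j (^-positive a₀ k 0<a₀)))) (begin
      G ^ k * (Q ^ j * (a₀ ^ k) ^ j) * (W * Q′ ^ j)
        ≡⟨ shuffle₁ (G ^ k) (Q ^ j) ((a₀ ^ k) ^ j) W (Q′ ^ j) ⟩
      G ^ k * (W * (Q ^ j * Q′ ^ j * (a₀ ^ k) ^ j))
        ≡⟨ cong (λ z → G ^ k * (W * z)) Z^j ⟨
      G ^ k * (W * Z ^ j)
        ≤⟨ ℕ.≤-trans main (ℕ.^-monoˡ-≤ k (double e₁≤e₂)) ⟩
      (2 * (G * m * (Q * B ^ k))) ^ k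
        ≤⟨ ℕ.^-monoˡ-≤ k (ℕ.*-monoʳ-≤ 2 (ℕ.*-monoʳ-≤ (G * m) (ℕ.*-monoʳ-≤ Q (B-power-bound k r m Q B 0<k km≤Q B-upper)))) ⟩
      (2 * (G * m * (Q * (3 ^ r * a₀ ^ k)))) ^ k
        ≡⟨ cong (_^ k) (shuffle₂ G m Q (3 ^ r) (a₀ ^ k)) ⟩
      (G * (Q * (2 * m * 3 ^ r * a₀ ^ k))) ^ k
        ≡⟨ trans (^-distrib-* k G _) (cong (G ^ k *_) (trans (^-distrib-* k Q _) (cong (Q ^ k *_) (^-distrib-* k (2 * m * 3 ^ r) (a₀ ^ k))))) ⟩
      G ^ k * (Q * Q ^ j * ((2 * m * 3 ^ r) ^ k * (a₀ ^ k * (a₀ ^ k) ^ j)))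
        ≡⟨ shuffle₃ (G ^ k) Q (Q ^ j) ((2 * m * 3 ^ r) ^ k) (a₀ ^ k) ((a₀ ^ k) ^ j) ⟩
      G ^ k * (Q ^ j * (a₀ ^ k) ^ j) * (Q * ((2 * m * 3 ^ r) ^ k * a₀ ^ k))
        ≡⟨ cong (λ z → G ^ k * (Q ^ j * (a₀ ^ k) ^ j) * (Q * z)) (^-distrib-* k (2 * m * 3 ^ r) a₀) ⟨
      G ^ k * (Q ^ j * (a₀ ^ k) ^ j) * (Q * (2 * m * 3 ^ r * a₀) ^ k)
        ≤⟨ ℕ.*-monoʳ-≤ (G ^ k * (Q ^ j * (a₀ ^ k) ^ j)) (ℕ.*-monoʳ-≤ Q (ℕ.^-monoˡ-≤ k a₀-bound)) ⟩
      G ^ k * (Q ^ j * (a₀ ^ k) ^ j) * (Q * (2 * m * (12 * K * Q) ^ r) ^ k) ∎)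
      where
      open ℕ.≤-Reasoning
      a₀-bound : 2 * m * 3 ^ r * a₀ ≤ 2 * m * (12 * K * Q) ^ r
      a₀-bound = begin
        2 * m * 3 ^ r * (c₀ * (K * Q) ^ r)       ≤⟨ ℕ.*-monoʳ-≤ (2 * m * 3 ^ r) (ℕ.*-monoˡ-≤ ((K * Q) ^ r) (central≤4^r r)) ⟩
        2 * m * 3 ^ r * (4 ^ r * (K * Q) ^ r)    ≡⟨ regroup m (3 ^ r) (4 ^ r) ((K * Q) ^ r) ⟩
        2 * m * (3 ^ r * 4 ^ r * (K * Q) ^ r)    ≡⟨ cong (λ z → 2 * m * (z * (K * Q) ^ r)) (^-distrib-* r 3 4) ⟨
        2 * m * (12 ^ r * (K * Q) ^ r)           ≡⟨ cong (2 * m *_) (trans (cong (_^ r) (ℕ.*-assoc 12 K Q)) (^-distrib-* r 12 (K * Q))) ⟨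
        2 * m * (12 * K * Q) ^ r ∎
        where
        regroup : ∀ m a b c → 2 * m * a * (b * c) ≡ 2 * m * (a * b * c)
        regroup = ℕ-Solver.solve-∀
      shuffle₁ : ∀ G Q a W P → G * (Q * a) * (W * P) ≡ G * (W * (Q * P * a))
      shuffle₁ = ℕ-Solver.solve-∀
      shuffle₂ : ∀ G m Q t a → 2 * (G * m * (Q * (t * a))) ≡ G * (Q * (2 * m * t * a))
      shuffle₂ = ℕ-Solver.solve-∀
      shuffle₃ : ∀ G Q P e a b → G * (Q * P * (e * (a * b))) ≡ G * (P * b) * (Q * (e * a))
      shuffle₃ = ℕ-Solver.solve-∀

  padé-dichotomy : Large k (α * β) m Q Q′ r ⊎ Small k (α * β) m Q Q′ r
  padé-dichotomy with ℕ.≤-total e₁ e₂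
  ... | inj₁ e₁≤e₂ = inj₂ (small e₁≤e₂)
  ... | inj₂ e₂≤e₁ = inj₁ (large e₂≤e₁)

consecutive-dichotomy : ∀ j α β m Q Q′ r → let k = suc j in 2 ≤ k → 1 ≤ r → Solution k α β m Q → Solution k α β m Q′ →
  0 < m → 0 < Q′ → k * m ≤ Q →
  (Large k (α * β) m Q Q′ r ⊎ Small k (α * β) m Q Q′ r) ⊎ (Large k (α * β) m Q Q′ (suc r) ⊎ Small k (α * β) m Q Q′ (suc r))
consecutive-dichotomy j α β m Q Q′ r 2≤k 1≤r S S′ 0<m 0<Q′ km≤Q = from-values (consecutive-padé-values (suc j) r m Q 2≤k 1≤r 0<m)
  where
  open Solution
  k : ℕ
  k = suc j
  from-values : (∃[ A ] ∃[ B ] ∃[ A′ ] ∃[ B′ ] PadéValues k r m Q A B × PadéValues k (suc r) m Q A′ B′ × A * B′ ≢ A′ * B) → _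
  from-values (A , B , A′ , B′ , V , V′ , independent) with x S * A * y S′ ℕ.≟ y S * B * x S′ | x S * A′ * y S′ ℕ.≟ y S * B′ * x S′
  ... | no p≢q | _ = inj₁ (padé-dichotomy j α β m Q Q′ r A B S S′ 0<m 0<Q′ km≤Q V p≢q)
  ... | yes _ | no p≢q = inj₂ (padé-dichotomy j α β m Q Q′ (suc r) A′ B′ S S′ 0<m 0<Q′ km≤Q V′ p≢q)
  -- Two coincidences would make A : B and A′ : B′ the same ratio.
  ... | yes p≡q | yes p≡q′ = ⊥-elim (independent (cancel (x S * y S′) (y S * x S′) A B A′ B′ 0<xy 0<yx
        (trans (sym (flip (x S) A (y S′))) (trans p≡q (flip (y S) B (x S′)))) (trans (sym (flip (x S) A′ (y S′))) (trans p≡q′ (flip (y S) B′ (x S′))))))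
    where
    0<Q : 0 < Q
    0<Q = ℕ.<-≤-trans (*-positive {k} (s≤s z≤n) 0<m) km≤Q
    base-positive : ∀ γ z N → γ * z ^ k ≡ N → 0 < N → 0 < z
    base-positive γ zero    N eq 0<N = ⊥-elim (ℕ.<⇒≢ 0<N (trans (sym (ℕ.*-zeroʳ γ)) eq))
    base-positive γ (suc z) N eq 0<N = s≤s z≤n
    0<xy : 0 < x S * y S′
    0<xy = *-positive (base-positive α (x S) (Q + m) (αx^k S) (ℕ.<-≤-trans 0<Q (ℕ.m≤m+n Q m))) (base-positive β (y S′) Q′ (βy^k S′) 0<Q′)
    0<yx : 0 < y S * x S′
    0<yx = *-positive (base-positive β (y S) Q (βy^k S) 0<Q) (base-positive α (x S′) (Q′ + m) (αx^k S′) (ℕ.<-≤-trans 0<Q′ (ℕ.m≤m+n Q′ m)))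
    flip : ∀ a b c → a * b * c ≡ a * c * b
    flip = ℕ-Solver.solve-∀
    cancel : ∀ u v A B A′ B′ → 0 < u → 0 < v → u * A ≡ v * B → u * A′ ≡ v * B′ → A * B′ ≡ A′ * B
    cancel u v A B A′ B′ 0<u 0<v p q = ℕ.*-cancelˡ-≡ (A * B′) (A′ * B) (u * v) ⦃ >-nonZero (*-positive 0<u 0<v) ⦄
      (trans (s₁ u v A B′) (trans (cong₂ _*_ p (sym q)) (s₂ u v A′ B)))
      where
      s₁ : ∀ u v a b → u * v * (a * b) ≡ u * a * (v * b)
      s₁ = ℕ-Solver.solve-∀
      s₂ : ∀ u v a b → v * b * (u * a) ≡ u * v * (a * b)
      s₂ = ℕ-Solver.solve-∀

-- Chaining the approximants over all r

root-≤ : ∀ j x y → x ^ suc j ≤ y ^ suc j → x ≤ y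
root-≤ j x y p = ℕ.≮⇒≥ λ y<x → ℕ.<⇒≱ (ℕ.^-monoˡ-< (suc j) y<x) p

n<2^n : ∀ n → n < 2 ^ n
n<2^n zero    = s≤s z≤n
n<2^n (suc n) = ℕ.≤-trans (ℕ.+-mono-≤ {1} {2 ^ n} (ℕ.≤-trans (s≤s z≤n) (n<2^n n)) (n<2^n n))
  (ℕ.≤-reflexive (cong (2 ^ n +_) (sym (ℕ.+-identityʳ (2 ^ n)))))

crossing : ∀ {P : ℕ → Set} → (∀ n → Dec (P n)) → ∀ n r → P r → ¬ P (n + r) → ∃[ s ] r ≤ s × P s × ¬ P (suc s)
crossing P? zero    r Pr ¬P = ⊥-elim (¬P Pr)
crossing {P} P? (suc n) r Pr ¬P with P? (suc r)
... | no ¬Pr+1 = r , ℕ.≤-refl , Pr , ¬Pr+1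
... | yes Pr+1 with crossing P? n (suc r) Pr+1 (λ p → ¬P (subst P (ℕ.+-suc n r) p))
...   | s , r<s , Ps , ¬Ps = s , ℕ.<⇒≤ r<s , Ps , ¬Ps

-- If the r-th approximant is too short for Q′, then the (r+2)-nd is not too long for it.
Overlapping : (k γ m Q r : ℕ) → Set
Overlapping k γ m Q r = 2 * m * (12 * (k * k)) ^ (2 + r) * (2 * suc k * m * (12 * (k * k) * (k * k) * (m * m)) ^ r) ^ (k ∸ 1) * (Q * Q)
  < k ^ k * γ * (Q ^ (k ∸ 2)) ^ suc r

module _ (i m Q Q′ γ : ℕ) (0<m : 0 < m) (0<Q : 0 < Q) where
  private
    j k K X W Y : ℕ
    j = suc i
    k = suc j
    K = k * k
    X = 12 * K * K * (m * m)
    W = k ^ k * γ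
    Y = 12 * K * Q
    0<k : 0 < k
    0<k = s≤s z≤n
    0<Y : 0 < Y
    0<Y = *-positive {12 * K} (*-positive {12} (s≤s z≤n) (*-positive 0<k 0<k)) 0<Q

  -- Passing from r to r + 1 multiplies the left side by Q^k and the right side only by X^k.
  Large-pred : X ≤ Q → ∀ r → Large k γ m Q Q′ (suc r) → Large k γ m Q Q′ r
  Large-pred X≤Q r large = cancelˡ (Q ^ k) (^-positive Q k 0<Q) (begin
    Q ^ k * (W * Q ^ j * (Q ^ r) ^ k)                      ≡⟨ swap (Q ^ k) (W * Q ^ j) ((Q ^ r) ^ k) ⟩
    W * Q ^ j * (Q ^ k * (Q ^ r) ^ k)                      ≡⟨ cong (W * Q ^ j *_) (^-distrib-* k Q (Q ^ r)) ⟨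
    W * Q ^ j * (Q * Q ^ r) ^ k                            ≤⟨ large ⟩
    Q′ * (2 * suc k * m * (X * X ^ r)) ^ k                 ≡⟨ cong (λ z → Q′ * z ^ k) (regroup (2 * suc k * m) X (X ^ r)) ⟩
    Q′ * (X * (2 * suc k * m * X ^ r)) ^ k                 ≤⟨ ℕ.*-monoʳ-≤ Q′ (ℕ.^-monoˡ-≤ k (ℕ.*-monoˡ-≤ (2 * suc k * m * X ^ r) X≤Q)) ⟩
    Q′ * (Q * (2 * suc k * m * X ^ r)) ^ k                 ≡⟨ cong (Q′ *_) (^-distrib-* k Q (2 * suc k * m * X ^ r)) ⟩
    Q′ * (Q ^ k * (2 * suc k * m * X ^ r) ^ k)             ≡⟨ regroup Q′ (Q ^ k) _ ⟩
    Q ^ k * (Q′ * (2 * suc k * m * X ^ r) ^ k) ∎)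
    where
    open ℕ.≤-Reasoning
    swap : ∀ a b c → a * (b * c) ≡ b * (a * c)
    swap = ℕ-Solver.solve-∀
    regroup : ∀ a b c → a * (b * c) ≡ b * (a * c)
    regroup = ℕ-Solver.solve-∀

  Large-+ : X ≤ Q → ∀ n r → Large k γ m Q Q′ (n + r) → Large k γ m Q Q′ n
  Large-+ X≤Q n zero    large = subst (Large k γ m Q Q′) (ℕ.+-identityʳ n) large
  Large-+ X≤Q n (suc r) large = Large-+ X≤Q n r (Large-pred X≤Q (n + r) (subst (Large k γ m Q Q′) (ℕ.+-suc n r) large))

  Small-suc : ∀ r → Small k γ m Q Q′ r → Small k γ m Q Q′ (suc r)
  Small-suc r small = ℕ.≤-trans small (ℕ.*-monoʳ-≤ Q (ℕ.^-monoˡ-≤ k (ℕ.*-monoʳ-≤ (2 * m)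
    (ℕ.≤-trans (ℕ.≤-reflexive (sym (ℕ.*-identityˡ (Y ^ r)))) (ℕ.*-monoˡ-≤ (Y ^ r) 0<Y)))))

  -- Since Q ≥ 2 X, the left side gains at least 2^k on the right side in each step. Taking n to be
  -- the part of the right side that does not depend on r already suffices, by n < 2^n.
  eventually-¬Large : 0 < γ → 2 * X ≤ Q → ∃[ n ] ¬ Large k γ m Q Q′ n
  eventually-¬Large 0<γ 2X≤Q = n , λ large → ℕ.<⇒≱ (n<2^n n) (cancelˡ ((X ^ n) ^ k) (^-positive (X ^ n) k (^-positive X n 0<X)) (begin
      (X ^ n) ^ k * 2 ^ n                              ≤⟨ ℕ.*-monoʳ-≤ ((X ^ n) ^ k) (ℕ.≤-trans (ℕ.≤-reflexive (sym (ℕ.*-identityʳ (2 ^ n)))) (ℕ.*-monoʳ-≤ (2 ^ n) (^-positive (2 ^ n) j (^-positive 2 n (s≤s z≤n))))) ⟩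
      (X ^ n) ^ k * (2 ^ n) ^ k                        ≡⟨ trans (ℕ.*-comm ((X ^ n) ^ k) _) (trans (sym (^-distrib-* k (2 ^ n) (X ^ n))) (cong (_^ k) (sym (^-distrib-* n 2 X)))) ⟩
      ((2 * X) ^ n) ^ k                                ≤⟨ ℕ.^-monoˡ-≤ k (ℕ.^-monoˡ-≤ n 2X≤Q) ⟩
      (Q ^ n) ^ k                                      ≡⟨ ℕ.*-identityˡ ((Q ^ n) ^ k) ⟨
      1 * (Q ^ n) ^ k                                  ≤⟨ ℕ.*-monoˡ-≤ ((Q ^ n) ^ k) (*-positive {W} (*-positive (^-positive k k 0<k) 0<γ) (^-positive Q j 0<Q)) ⟩
      W * Q ^ j * (Q ^ n) ^ k                          ≤⟨ large ⟩
      Q′ * (2 * suc k * m * X ^ n) ^ k                 ≡⟨ cong (Q′ *_) (^-distrib-* k (2 * suc k * m) (X ^ n)) ⟩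
      Q′ * ((2 * suc k * m) ^ k * (X ^ n) ^ k)         ≡⟨ regroup Q′ ((2 * suc k * m) ^ k) ((X ^ n) ^ k) ⟩
      (X ^ n) ^ k * n ∎))
    where
    open ℕ.≤-Reasoning
    n : ℕ
    n = Q′ * (2 * suc k * m) ^ k
    0<X : 0 < X
    0<X = *-positive {12 * K * K} (*-positive {12 * K} (*-positive {12} (s≤s z≤n) (*-positive 0<k 0<k)) (*-positive 0<k 0<k)) (*-positive 0<m 0<m)
    regroup : ∀ a b c → a * (b * c) ≡ c * (a * b)
    regroup = ℕ-Solver.solve-∀

  private
    Overlap : ℕ → Set
    Overlap = Overlapping k γ m Q

  -- `Large` at r raised to the power k - 1 and combined with `Small` at r + 2 eliminates Q′. Both
  -- sides are then k-th powers up to common factors, and the k-th root contradicts `Overlapping`.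
  covering : ∀ r → Overlap r → Large k γ m Q Q′ r → ¬ Small k γ m Q Q′ (2 + r)
  covering r overlap-r large small = ℕ.<⇒≱ overlap-r (root-≤ j _ _ (cancelˡ ((Q ^ r) ^ k * Q) (*-positive (^-positive (Q ^ r) k (^-positive Q r 0<Q)) 0<Q) (begin
    (Q ^ r) ^ k * Q * (W * (Q ^ i) ^ suc r) ^ k
      ≡⟨ exponents ⟩
    W * (W * Q ^ j * (Q ^ r) ^ k) ^ j
      ≤⟨ ℕ.*-monoʳ-≤ W (ℕ.^-monoˡ-≤ j large) ⟩
    W * (Q′ * e ^ k) ^ j
      ≡⟨ trans (cong (W *_) (trans (^-distrib-* j Q′ (e ^ k)) (cong (Q′ ^ j *_) (^-swap e k j)))) (sym (ℕ.*-assoc W (Q′ ^ j) ((e ^ j) ^ k))) ⟩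
    W * Q′ ^ j * (e ^ j) ^ k
      ≤⟨ ℕ.*-monoˡ-≤ ((e ^ j) ^ k) small ⟩
    Q * (2 * m * Y ^ (2 + r)) ^ k * (e ^ j) ^ k
      ≡⟨ trans (ℕ.*-assoc Q _ _) (cong (Q *_) (sym (^-distrib-* k (2 * m * Y ^ (2 + r)) (e ^ j)))) ⟩
    Q * (2 * m * Y ^ (2 + r) * e ^ j) ^ k
      ≡⟨ cong (λ z → Q * (2 * m * z * e ^ j) ^ k) (^-distrib-* (2 + r) (12 * K) Q) ⟩
    Q * (2 * m * ((12 * K) ^ (2 + r) * (Q * (Q * Q ^ r))) * e ^ j) ^ k
      ≡⟨ cong (λ z → Q * z ^ k) (regroup (2 * m) ((12 * K) ^ (2 + r)) Q (Q ^ r) (e ^ j)) ⟩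
    Q * (Q ^ r * (2 * m * (12 * K) ^ (2 + r) * e ^ j * (Q * Q))) ^ k
      ≡⟨ trans (cong (Q *_) (^-distrib-* k (Q ^ r) _)) (swap Q ((Q ^ r) ^ k) _) ⟩
    (Q ^ r) ^ k * Q * (2 * m * (12 * K) ^ (2 + r) * e ^ j * (Q * Q)) ^ k ∎)))
    where
    open ℕ.≤-Reasoning
    e : ℕ
    e = 2 * suc k * m * X ^ r
    regroup : ∀ a b Q q e → a * (b * (Q * (Q * q))) * e ≡ q * (a * b * e * (Q * Q))
    regroup = ℕ-Solver.solve-∀
    swap : ∀ a b c → a * (b * c) ≡ b * a * c
    swap = ℕ-Solver.solve-∀
    exponents : (Q ^ r) ^ k * Q * (W * (Q ^ i) ^ suc r) ^ k ≡ W * (W * Q ^ j * (Q ^ r) ^ k) ^ j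
    exponents = begin-equality
      (Q ^ r) ^ k * Q * (W * (Q ^ i) ^ suc r) ^ k
        ≡⟨ cong ((Q ^ r) ^ k * Q *_) (trans (^-distrib-* k W _) (cong (W ^ k *_) (trans (cong (_^ k) (ℕ.^-*-assoc Q i (suc r))) (ℕ.^-*-assoc Q (i * suc r) k)))) ⟩
      (Q ^ r) ^ k * Q * (W ^ k * Q ^ (i * suc r * k))
        ≡⟨ cong₂ (λ u v → u * v * (W ^ k * Q ^ (i * suc r * k))) (ℕ.^-*-assoc Q r k) (sym (ℕ.^-identityʳ Q)) ⟩
      Q ^ (r * k) * Q ^ 1 * (W ^ k * Q ^ (i * suc r * k))
        ≡⟨ gather W (W ^ j) (Q ^ (r * k)) (Q ^ 1) (Q ^ (i * suc r * k)) ⟩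
      W * (W ^ j * (Q ^ (r * k) * Q ^ 1 * Q ^ (i * suc r * k)))
        ≡⟨ cong (λ z → W * (W ^ j * z)) (trans (cong (_* Q ^ (i * suc r * k)) (sym (ℕ.^-distribˡ-+-* Q (r * k) 1))) (trans (sym (ℕ.^-distribˡ-+-* Q (r * k + 1) (i * suc r * k)))
             (trans (cong (Q ^_) (count i r)) (ℕ.^-distribˡ-+-* Q (j * j) (r * k * j))))) ⟩
      W * (W ^ j * (Q ^ (j * j) * Q ^ (r * k * j)))
        ≡⟨ cong (λ z → W * z) (trans (sym (ℕ.*-assoc (W ^ j) _ _)) (sym (trans (^-distrib-* j (W * Q ^ j) ((Q ^ r) ^ k)) (cong₂ _*_ (trans (^-distrib-* j W (Q ^ j)) (cong (W ^ j *_) (ℕ.^-*-assoc Q j j)))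
             (trans (cong (_^ j) (ℕ.^-*-assoc Q r k)) (ℕ.^-*-assoc Q (r * k) j)))))) ⟩
      W * (W * Q ^ j * (Q ^ r) ^ k) ^ j ∎
      where
      gather : ∀ W w a b c → a * b * (W * w * c) ≡ W * (w * (a * b * c))
      gather = ℕ-Solver.solve-∀
      -- The exponents of Q balance because (k-1)² = 1 + (k-2) k.
      count : ∀ i r → r * (2 + i) + 1 + i * (1 + r) * (2 + i) ≡ (1 + i) * (1 + i) + r * (2 + i) * (1 + i)
      count = ℕ-Solver.solve-∀

  -- Going from r to r + 1 multiplies the left side by 12 K X^j and the right side by Q^i.
  Overlap-suc : 12 * K * X ^ j ≤ Q ^ i → ∀ r → Overlap r → Overlap (suc r)
  Overlap-suc step r overlap-r = begin-strict
    2 * m * (12 * K * (12 * K) ^ (2 + r)) * (2 * suc k * m * (X * X ^ r)) ^ j * (Q * Q)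
      ≡⟨ cong (λ z → 2 * m * (12 * K * (12 * K) ^ (2 + r)) * z * (Q * Q)) (trans (cong (_^ j) (swap (2 * suc k * m) X (X ^ r))) (^-distrib-* j X _)) ⟩
    2 * m * (12 * K * (12 * K) ^ (2 + r)) * (X ^ j * (2 * suc k * m * X ^ r) ^ j) * (Q * Q)
      ≡⟨ regroup (2 * m) (12 * K) ((12 * K) ^ (2 + r)) (X ^ j) ((2 * suc k * m * X ^ r) ^ j) (Q * Q) ⟩
    12 * K * X ^ j * (2 * m * (12 * K) ^ (2 + r) * (2 * suc k * m * X ^ r) ^ j * (Q * Q))
      ≤⟨ ℕ.*-monoˡ-≤ _ step ⟩
    Q ^ i * (2 * m * (12 * K) ^ (2 + r) * (2 * suc k * m * X ^ r) ^ j * (Q * Q))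
      <⟨ ℕ.*-monoʳ-< (Q ^ i) ⦃ >-nonZero (^-positive Q i 0<Q) ⦄ overlap-r ⟩
    Q ^ i * (W * (Q ^ i) ^ suc r)
      ≡⟨ swap (Q ^ i) W _ ⟩
    W * (Q ^ i) ^ suc (suc r) ∎
    where
    open ℕ.≤-Reasoning
    swap : ∀ a b c → a * (b * c) ≡ b * (a * c)
    swap = ℕ-Solver.solve-∀
    regroup : ∀ a b c x e q → a * (b * c) * (x * e) * q ≡ b * x * (a * c * e * q)
    regroup = ℕ-Solver.solve-∀

  Overlap-≥ : 12 * K * X ^ j ≤ Q ^ i → ∀ r₀ r → r₀ ≤ r → Overlap r₀ → Overlap r
  Overlap-≥ step r₀ r r₀≤r overlap-r₀ = subst Overlap (trans (ℕ.+-comm (r ∸ r₀) r₀) (ℕ.m+[n∸m]≡n r₀≤r)) (up (r ∸ r₀))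
    where
    up : ∀ n → Overlap (n + r₀)
    up zero    = overlap-r₀
    up (suc n) = Overlap-suc step (n + r₀) (up n)

-- `Large` holds up to some index r and then fails. If r ≥ r₀, covering refutes `Small` at r + 2,
-- and monotonicity in r refutes all four alternatives of the dichotomy for r + 1 and r + 2. If
-- `Large` already fails at r₀, the failure of `Small` at r₀ + 1 refutes the dichotomy for r₀ and r₀
-- + 1 in the same way.
no-two-solutions : ∀ i α β m Q Q′ r₀ → let j = suc i; k = suc j; K = k * k; X = 12 * K * K * (m * m); γ = α * β in
  Solution k α β m Q → Solution k α β m Q′ → 0 < m → 0 < Q → 0 < Q′ → 0 < γ →
  12 * K * (2 * X) ^ j ≤ Q ^ i → Overlapping k γ m Q r₀ →
  Large k γ m Q Q′ r₀ ⊎ (1 ≤ r₀ × ¬ Small k γ m Q Q′ (suc r₀)) → ⊥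
no-two-solutions i α β m Q Q′ r₀ S S′ 0<m 0<Q 0<Q′ 0<γ step overlap₀ large⊎¬small = from-start large⊎¬small
  where
  open ℕ.≤-Reasoning
  j k K X γ : ℕ
  j = suc i
  k = suc j
  K = k * k
  X = 12 * K * K * (m * m)
  γ = α * β

  0<X : 0 < X
  0<X = *-positive {12 * K * K} (s≤s z≤n) (*-positive 0<m 0<m)

  -- The factor 2 in the hypothesis on Q^i is there for this bound, which makes `Large` fail
  -- eventually.
  2X≤Q : 2 * X ≤ Q
  2X≤Q = ℕ.≮⇒≥ λ Q<2X → ℕ.<⇒≱ (begin-strict
    Q ^ i                       ≤⟨ ℕ.^-monoˡ-≤ i (ℕ.<⇒≤ Q<2X) ⟩
    (2 * X) ^ i                 <⟨ ℕ.m<m*n ((2 * X) ^ i) (2 * X) ⦃ >-nonZero (^-positive (2 * X) i (*-positive {2} (s≤s z≤n) 0<X)) ⦄ (ℕ.*-mono-≤ {2} {2} {1} {X} ℕ.≤-refl 0<X) ⟩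
    (2 * X) ^ i * (2 * X)       ≡⟨ ℕ.*-comm ((2 * X) ^ i) (2 * X) ⟩
    (2 * X) ^ j                 ≤⟨ ℕ.m≤n*m ((2 * X) ^ j) (12 * K) ⟩
    12 * K * (2 * X) ^ j ∎) step

  X≤Q : X ≤ Q
  X≤Q = ℕ.≤-trans (ℕ.m≤m+n X _) 2X≤Q

  step′ : 12 * K * X ^ j ≤ Q ^ i
  step′ = ℕ.≤-trans (ℕ.*-monoʳ-≤ (12 * K) (ℕ.^-monoˡ-≤ j (ℕ.m≤m+n X _))) step

  km≤Q : k * m ≤ Q
  km≤Q = ℕ.≤-trans (ℕ.*-mono-≤ {k} {12 * K * K} {m} {m * m} (ℕ.≤-trans (ℕ.m≤n*m k (12 * K * k)) (ℕ.≤-reflexive (ℕ.*-assoc (12 * K) k k))) (ℕ.m≤m*n m m ⦃ >-nonZero 0<m ⦄)) X≤Q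

  conclude : ∀ r → 1 ≤ r → ¬ Large k γ m Q Q′ r → ¬ Small k γ m Q Q′ (suc r) → ⊥
  conclude r 1≤r ¬large ¬small =
    [ [ ¬large , (λ small → ¬small (Small-suc i m Q Q′ γ 0<m 0<Q r small)) ]′
    , [ (λ large → ¬large (Large-pred i m Q Q′ γ 0<m 0<Q X≤Q r large)) , ¬small ]′ ]′
    (consecutive-dichotomy j α β m Q Q′ r (s≤s (s≤s z≤n)) 1≤r S S′ 0<m 0<Q′ km≤Q)

  large? : ∀ r → Dec (Large k γ m Q Q′ r)
  large? r = k ^ k * γ * Q ^ j * (Q ^ r) ^ k ℕ.≤? Q′ * (2 * suc k * m * X ^ r) ^ k

  from-large : Large k γ m Q Q′ r₀ → ⊥
  from-large large = at-bound (eventually-¬Large i m Q Q′ γ 0<m 0<Q 0<γ 2X≤Q)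
    where
    at-crossing : ∃[ r ] r₀ ≤ r × Large k γ m Q Q′ r × ¬ Large k γ m Q Q′ (suc r) → ⊥
    at-crossing (r , r₀≤r , large-r , ¬large-1+r) = conclude (suc r) (s≤s z≤n) ¬large-1+r
      (covering i m Q Q′ γ 0<m 0<Q r (Overlap-≥ i m Q Q′ γ 0<m 0<Q step′ r₀ r r₀≤r overlap₀) large-r)
    at-bound : ∃[ n ] ¬ Large k γ m Q Q′ n → ⊥
    at-bound (n , ¬large) = at-crossing (crossing large? n r₀ large (λ l → ¬large (Large-+ i m Q Q′ γ 0<m 0<Q X≤Q n r₀ l)))

  from-start : Large k γ m Q Q′ r₀ ⊎ (1 ≤ r₀ × ¬ Small k γ m Q Q′ (suc r₀)) → ⊥
  from-start (inj₁ large)           = from-large large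
  from-start (inj₂ (1≤r₀ , ¬small)) = split (large? r₀)
    where
    split : Dec (Large k γ m Q Q′ r₀) → ⊥
    split (yes large) = from-large large
    split (no ¬large) = conclude r₀ 1≤r₀ ¬large ¬small

-- The exponents k ≥ 6, 5, 4 and 3

-- At r = 0 the approximant is trivial, and `Large` is the gap principle weakened by the factor 2 (k
-- + 1) inside the power.
gap⇒Large : ∀ j γ m Q Q′ → let k = suc j in k ^ k * γ * Q ^ j ≤ Q′ * m ^ k → Large k γ m Q Q′ 0
gap⇒Large j γ m Q Q′ gap = begin
  k ^ k * γ * Q ^ j * 1 ^ k                     ≡⟨ trans (cong (k ^ k * γ * Q ^ j *_) (ℕ.^-zeroˡ k)) (ℕ.*-identityʳ _) ⟩
  k ^ k * γ * Q ^ j                             ≤⟨ gap ⟩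
  Q′ * m ^ k                                    ≤⟨ ℕ.*-monoʳ-≤ Q′ (ℕ.^-monoˡ-≤ k (ℕ.≤-trans (ℕ.m≤n*m m (2 * suc k)) (ℕ.≤-reflexive (sym (ℕ.*-identityʳ (2 * suc k * m)))))) ⟩
  Q′ * (2 * suc k * m * 1) ^ k ∎
  where
  open ℕ.≤-Reasoning
  k : ℕ
  k = suc j

-- Here g is the least member, h + 1 the third, and Q, Q′ belong to the fourth and fifth. With τ =
-- k^k h^k the hypotheses read (k m)^k ≤ g^(k-2) τ and Q ≥ g τ. Since k - 2 ≥ 4, the factor τ^4
-- produced by m and the constants fits into Q^(k-2); h ≥ 24 absorbs the powers of 24.
module Exponent≥6 (i₄ α β m g h Q Q′ : ℕ)
  (S : Solution (6 + i₄) α β m Q) (S′ : Solution (6 + i₄) α β m Q′) (Q<Q′ : Q < Q′) (0<m : 0 < m) (0<g : 0 < g) (g≤h : g ≤ h) (24≤h : 24 ≤ h)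
  (gh≤γ : g * h ≤ α * β) (m^k≤ : m ^ (6 + i₄) ≤ g ^ (4 + i₄) * h ^ (6 + i₄)) (Q≥ : (6 + i₄) ^ (6 + i₄) * (g * h ^ (6 + i₄)) ≤ Q) where
  open ℕ.≤-Reasoning
  private
    i j k γ K X τ : ℕ
    i = 4 + i₄
    j = suc i
    k = suc j
    γ = α * β
    K = k * k
    X = 12 * K * K * (m * m)
    τ = k ^ k * h ^ k
    0<h : 0 < h
    0<h = ℕ.≤-trans 0<g g≤h
    0<k^k : 0 < k ^ k
    0<k^k = ^-positive k k (s≤s z≤n)
    0<t : 0 < τ
    0<t = *-positive 0<k^k (^-positive h k 0<h)
    gt≤Q : g * τ ≤ Q
    gt≤Q = ℕ.≤-trans (ℕ.≤-reflexive (swap g (k ^ k) (h ^ k))) Q≥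
      where
      swap : ∀ a b c → a * (b * c) ≡ b * (a * c)
      swap = ℕ-Solver.solve-∀
    0<Q : 0 < Q
    0<Q = ℕ.≤-trans (*-positive 0<g 0<t) gt≤Q
    0<γ : 0 < γ
    0<γ = ℕ.≤-trans (*-positive 0<g 0<h) gh≤γ
    [km]^k≤ : (k * m) ^ k ≤ g ^ i * τ
    [km]^k≤ = begin
      (k * m) ^ k                   ≡⟨ ^-distrib-* k k m ⟩
      k ^ k * m ^ k                 ≤⟨ ℕ.*-monoʳ-≤ (k ^ k) m^k≤ ⟩
      k ^ k * (g ^ i * h ^ k)       ≡⟨ swap (k ^ k) (g ^ i) (h ^ k) ⟩
      g ^ i * τ ∎
      where
      swap : ∀ a b c → a * (b * c) ≡ b * (a * c)
      swap = ℕ-Solver.solve-∀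

    step : 12 * K * (2 * X) ^ j ≤ Q ^ i
    step = begin
      12 * K * (2 * X) ^ j
        ≡⟨ cong (λ z → 12 * K * z ^ j) (reshape k m) ⟩
      12 * K * (24 * (K * ((k * m) * (k * m)))) ^ j
        ≡⟨ cong (12 * K *_) (trans (^-distrib-* j 24 (K * ((k * m) * (k * m)))) (cong (24 ^ j *_) (trans (^-distrib-* j K ((k * m) * (k * m))) (cong (K ^ j *_) (^-distrib-* j (k * m) (k * m)))))) ⟩
      12 * K * (24 ^ j * (K ^ j * ((k * m) ^ j * (k * m) ^ j)))
        ≤⟨ ℕ.*-monoʳ-≤ (12 * K) (ℕ.*-monoʳ-≤ (24 ^ j) (ℕ.*-monoʳ-≤ (K ^ j) (ℕ.*-mono-≤ j-bound j-bound))) ⟩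
      12 * K * (24 ^ j * (K ^ j * ((g ^ i * τ) * (g ^ i * τ))))
        ≡⟨ regroup₁ K (24 ^ j) (K ^ j) (g ^ i) τ ⟩
      12 * 24 ^ j * g ^ i * (K * K ^ j) * (g ^ i * (τ * τ))
        ≤⟨ ℕ.*-monoˡ-≤ (g ^ i * (τ * τ)) constants ⟩
      τ * τ * (g ^ i * (τ * τ))
        ≡⟨ regroup₂ τ (g ^ i) ⟩
      g ^ i * (τ * (τ * (τ * (τ * 1))))
        ≤⟨ ℕ.*-monoʳ-≤ (g ^ i) (ℕ.^-monoʳ-≤ τ ⦃ >-nonZero 0<t ⦄ (ℕ.m≤m+n 4 i₄)) ⟩
      g ^ i * τ ^ i
        ≡⟨ ^-distrib-* i g τ ⟨
      (g * τ) ^ i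
        ≤⟨ ℕ.^-monoˡ-≤ i gt≤Q ⟩
      Q ^ i ∎
      where
      reshape : ∀ k m → 2 * (12 * (k * k) * (k * k) * (m * m)) ≡ 24 * (k * k * ((k * m) * (k * m)))
      reshape = ℕ-Solver.solve-∀
      regroup₁ : ∀ K c κ g τ → 12 * K * (c * (κ * ((g * τ) * (g * τ)))) ≡ 12 * c * g * (K * κ) * (g * (τ * τ))
      regroup₁ = ℕ-Solver.solve-∀
      regroup₂ : ∀ τ g → τ * τ * (g * (τ * τ)) ≡ g * (τ * (τ * (τ * (τ * 1))))
      regroup₂ = ℕ-Solver.solve-∀
      j-bound : (k * m) ^ j ≤ g ^ i * τ
      j-bound = ℕ.≤-trans (ℕ.^-monoʳ-≤ (k * m) ⦃ >-nonZero (*-positive {k} (s≤s z≤n) 0<m) ⦄ (ℕ.n≤1+n j)) [km]^k≤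
      constants : 12 * 24 ^ j * g ^ i * (K * K ^ j) ≤ τ * τ
      constants = begin
        12 * 24 ^ j * g ^ i * (K * K ^ j)
          ≤⟨ ℕ.*-mono-≤ (ℕ.*-mono-≤ (ℕ.*-mono-≤ (ℕ.≤-trans (ℕ.m≤m+n 12 12) 24≤h) (ℕ.^-monoˡ-≤ j 24≤h))
               (ℕ.≤-trans (ℕ.^-monoˡ-≤ i g≤h) (ℕ.^-monoʳ-≤ h ⦃ >-nonZero 0<h ⦄ {i} {k} (ℕ.m≤n+m i 2))))
             (ℕ.≤-reflexive (^-distrib-* k k k)) ⟩
        h * h ^ j * h ^ k * (k ^ k * k ^ k)
          ≡⟨ regroup₃ (h ^ k) (k ^ k) ⟩
        τ * τ ∎
        where
        regroup₃ : ∀ η κ → η * η * (κ * κ) ≡ κ * η * (κ * η)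
        regroup₃ = ℕ-Solver.solve-∀

    overlapping : Overlapping k γ m Q 0
    overlapping = begin-strict
      2 * m * (12 * K) ^ 2 * (2 * suc k * m * 1) ^ j * (Q * Q)
        ≡⟨ cong₂ (λ u v → 2 * m * u * v ^ j * (Q * Q)) (square K) (ℕ.*-identityʳ (2 * suc k * m)) ⟩
      2 * m * (144 * (K * K)) * (2 * suc k * m) ^ j * (Q * Q)
        ≤⟨ ℕ.*-monoˡ-≤ (Q * Q) (ℕ.*-mono-≤ (ℕ.*-monoˡ-≤ (144 * (K * K)) (ℕ.*-monoʳ-≤ 2 (ℕ.m≤n*m m (4 * k)))) (ℕ.^-monoˡ-≤ j 2[k+1]≤4k)) ⟩
      2 * (4 * k * m) * (144 * (K * K)) * (4 * k * m) ^ j * (Q * Q)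
        ≡⟨ regroup₁ (4 * k * m) K ((4 * k * m) ^ j) Q ⟩
      288 * (K * K) * ((4 * k * m) ^ k) * (Q * Q)
        ≡⟨ cong (λ z → 288 * (K * K) * z * (Q * Q)) (trans (cong (_^ k) (ℕ.*-assoc 4 k m)) (^-distrib-* k 4 (k * m))) ⟩
      288 * (K * K) * (4 ^ k * (k * m) ^ k) * (Q * Q)
        ≤⟨ ℕ.*-monoˡ-≤ (Q * Q) (ℕ.*-monoʳ-≤ (288 * (K * K)) (ℕ.*-monoʳ-≤ (4 ^ k) [km]^k≤)) ⟩
      288 * (K * K) * (4 ^ k * (g ^ i * τ)) * (Q * Q)
        <⟨ ℕ.*-monoˡ-< (Q * Q) ⦃ >-nonZero (*-positive 0<Q 0<Q) ⦄ core ⟩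
      k ^ k * γ * (Q * (Q * Q ^ i₄)) * (Q * Q)
        ≤⟨ ℕ.≤-reflexive (ℕ.*-assoc (k ^ k * γ) (Q * (Q * Q ^ i₄)) (Q * Q)) ⟩
      k ^ k * γ * (Q * (Q * Q ^ i₄) * (Q * Q))
        ≡⟨ cong (k ^ k * γ *_) (regroup₂ Q (Q ^ i₄)) ⟩
      k ^ k * γ * (Q ^ i) ^ 1 ∎
      where
      square : ∀ K → (12 * K) ^ 2 ≡ 144 * (K * K)
      square K = lemma K
        where
        lemma : ∀ K → 12 * K * (12 * K * 1) ≡ 144 * (K * K)
        lemma = ℕ-Solver.solve-∀
      2[k+1]≤4k : 2 * suc k * m ≤ 4 * k * m
      2[k+1]≤4k = ℕ.*-monoˡ-≤ m (ℕ.≤-trans (ℕ.*-monoʳ-≤ 2 {suc k} {2 * k} (ℕ.≤-trans (ℕ.≤-reflexive (ℕ.+-comm 1 k)) (ℕ.+-monoʳ-≤ k (s≤s z≤n)))) (ℕ.≤-reflexive (sym (ℕ.*-assoc 2 2 k))))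
      regroup₁ : ∀ u K v Q → 2 * u * (144 * (K * K)) * v * (Q * Q) ≡ 288 * (K * K) * (u * v) * (Q * Q)
      regroup₁ = ℕ-Solver.solve-∀
      regroup₂ : ∀ Q q → Q * (Q * q) * (Q * Q) ≡ Q * (Q * (Q * (Q * q))) * 1
      regroup₂ = ℕ-Solver.solve-∀
      core : 288 * (K * K) * (4 ^ k * (g ^ i * τ)) < k ^ k * γ * (Q * (Q * Q ^ i₄))
      core = begin-strict
        288 * (K * K) * (4 ^ k * (g ^ i * τ))
          ≡⟨ regroup₃ (K * K) (4 ^ k) (g ^ i₄) g τ ⟩
        288 * 4 ^ k * (K * K) * g * (g * (g ^ (2 + i₄) * τ))
          <⟨ ℕ.*-monoˡ-< (g * (g ^ (2 + i₄) * τ)) ⦃ >-nonZero (*-positive 0<g (*-positive (^-positive g (2 + i₄) 0<g) 0<t)) ⦄ constants ⟩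
        k ^ k * h * τ * (g * (g ^ (2 + i₄) * τ))
          ≡⟨ regroup₄ (k ^ k) h τ g (g ^ (2 + i₄)) ⟩
        k ^ k * (g * h) * (g ^ (2 + i₄) * (τ * (τ * 1)))
          ≤⟨ ℕ.*-mono-≤ (ℕ.*-monoʳ-≤ (k ^ k) gh≤γ) (ℕ.≤-trans (ℕ.*-monoʳ-≤ (g ^ (2 + i₄)) (ℕ.^-monoʳ-≤ τ ⦃ >-nonZero 0<t ⦄ (ℕ.m≤m+n 2 i₄)))
               (ℕ.≤-trans (ℕ.≤-reflexive (sym (^-distrib-* (2 + i₄) g τ))) (ℕ.^-monoˡ-≤ (2 + i₄) gt≤Q))) ⟩
        k ^ k * γ * (Q * (Q * Q ^ i₄)) ∎
        where
        regroup₃ : ∀ K f G g τ → 288 * K * (f * (g * (g * (g * (g * G))) * τ)) ≡ 288 * f * K * g * (g * (g * (g * G) * τ))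
        regroup₃ = ℕ-Solver.solve-∀
        regroup₄ : ∀ κ h τ g G → κ * h * τ * (g * (G * τ)) ≡ κ * (g * h) * (G * (τ * (τ * 1)))
        regroup₄ = ℕ-Solver.solve-∀
        constants : 288 * 4 ^ k * (K * K) * g < k ^ k * h * τ
        constants = begin-strict
          288 * 4 ^ k * (K * K) * g
            ≤⟨ ℕ.*-mono-≤ (ℕ.*-monoʳ-≤ (288 * 4 ^ k) K²≤k^k) g≤h ⟩
          288 * 4 ^ k * k ^ k * h
            <⟨ ℕ.*-monoˡ-< h ⦃ >-nonZero 0<h ⦄ (ℕ.*-monoˡ-< (k ^ k) ⦃ >-nonZero 0<k^k ⦄ 288*4^k<t) ⟩
          τ * k ^ k * h
            ≡⟨ regroup₅ τ (k ^ k) h ⟩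
          k ^ k * h * τ ∎
          where
          regroup₅ : ∀ τ κ h → τ * κ * h ≡ κ * h * τ
          regroup₅ = ℕ-Solver.solve-∀
          K²≤k^k : K * K ≤ k ^ k
          K²≤k^k = ℕ.≤-trans (ℕ.≤-reflexive (lemma k)) (ℕ.^-monoʳ-≤ k {4} {k} (ℕ.m≤m+n 4 (2 + i₄)))
            where
            lemma : ∀ k → k * k * (k * k) ≡ k * (k * (k * (k * 1)))
            lemma = ℕ-Solver.solve-∀
          288*4^k<t : 288 * 4 ^ k < τ
          288*4^k<t = begin-strict
            288 * 4 ^ k            <⟨ ℕ.*-monoˡ-< (4 ^ k) ⦃ >-nonZero (^-positive 4 k (s≤s z≤n)) ⦄ (ℕ.≤ᵇ⇒≤ 289 (6 ^ 4) _) ⟩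
            6 ^ 4 * 4 ^ k          ≤⟨ ℕ.*-mono-≤ (ℕ.≤-trans (ℕ.^-monoʳ-≤ 6 {4} {k} (ℕ.m≤m+n 4 (2 + i₄))) (ℕ.^-monoˡ-≤ k (ℕ.m≤m+n 6 i₄)))
                                        (ℕ.^-monoˡ-≤ k (ℕ.≤-trans (ℕ.m≤m+n 4 20) 24≤h)) ⟩
            τ ∎

  impossible : ⊥
  impossible = no-two-solutions i α β m Q Q′ 0 S S′ 0<m 0<Q (ℕ.<-trans 0<Q Q<Q′) 0<γ step overlapping
    (inj₁ (gap⇒Large j γ m Q Q′ (gap-principle j α β m Q Q′ 0<m Q<Q′ S S′)))

-- Here w stands for 5^5 and n for m^5, and q precedes Q. Each bound is multiplied by powers of w
-- and n so that `wn≤` trades n for γ and q; the gap then trades q for Q, and the surplus power of w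
-- absorbs the constant c.
module Inequalities₅ (w γ g q Q n : ℕ) (0<w : 0 < w) (0<γ : 0 < γ) (0<q : 0 < q) (0<n : 0 < n)
  (g²≤γ : g * g ≤ γ) (g≤q : g ≤ q) (wn≤ : w * n ≤ g * g * q) (gap : w * γ * q ^ 4 ≤ Q * n) where
  open ℕ.≤-Reasoning
  private
    wn≤γq : w * n ≤ γ * q
    wn≤γq = ℕ.≤-trans wn≤ (ℕ.*-monoˡ-≤ q g²≤γ)

  overlap-bound : ∀ c → c < w ^ 4 → c * n < w * γ * Q
  overlap-bound c c<w⁴ = ℕ.*-cancelˡ-< (w * w * n) (c * n) (w * γ * Q) (begin-strict
    w * w * n * (c * n)                   ≡⟨ regroup₁ w n c ⟩
    c * ((w * n) * (w * n))               ≤⟨ ℕ.*-monoʳ-≤ c (ℕ.*-mono-≤ wn≤γq wn≤γq) ⟩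
    c * ((γ * q) * (γ * q))               <⟨ ℕ.*-monoˡ-< ((γ * q) * (γ * q)) ⦃ >-nonZero (*-positive (*-positive 0<γ 0<q) (*-positive 0<γ 0<q)) ⦄ c<w⁴ ⟩
    w ^ 4 * ((γ * q) * (γ * q))           ≤⟨ ℕ.*-monoʳ-≤ (w ^ 4) (ℕ.m≤m*n _ (q * q) ⦃ >-nonZero (*-positive 0<q 0<q) ⦄) ⟩
    w ^ 4 * ((γ * q) * (γ * q) * (q * q)) ≡⟨ regroup₂ w γ q ⟩
    w * w * w * γ * (w * γ * q ^ 4)       ≤⟨ ℕ.*-monoʳ-≤ (w * w * w * γ) gap ⟩
    w * w * w * γ * (Q * n)               ≡⟨ regroup₃ w γ Q n ⟩
    w * w * n * (w * γ * Q) ∎)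
    where
    regroup₁ : ∀ w n c → w * w * n * (c * n) ≡ c * ((w * n) * (w * n))
    regroup₁ = ℕ-Solver.solve-∀
    regroup₂ : ∀ w γ q → w * (w * (w * (w * 1))) * ((γ * q) * (γ * q) * (q * q)) ≡ w * w * w * γ * (w * γ * (q * (q * (q * (q * 1)))))
    regroup₂ = ℕ-Solver.solve-∀
    regroup₃ : ∀ w γ Q n → w * w * w * γ * (Q * n) ≡ w * w * n * (w * γ * Q)
    regroup₃ = ℕ-Solver.solve-∀

  step-bound : ∀ c → c ≤ w ^ 8 → c * (n * n) ≤ Q * Q * Q
  step-bound c c≤w⁸ = cancelˡ (w ^ 5 * n ^ 3) (*-positive (^-positive w 5 0<w) (^-positive n 3 0<n)) (begin
    w ^ 5 * n ^ 3 * (c * (n * n))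
      ≡⟨ regroup₁ w n c ⟩
    c * ((w * n) ^ 3 * ((w * n) * (w * n)))
      ≤⟨ ℕ.*-mono-≤ c≤w⁸ (ℕ.*-mono-≤ (ℕ.^-monoˡ-≤ 3 wn≤γq) (ℕ.*-mono-≤ wn≤q³ wn≤q³)) ⟩
    w ^ 8 * ((γ * q) ^ 3 * ((q * q * q) * (q * q * q)))
      ≤⟨ ℕ.*-monoʳ-≤ (w ^ 8) (ℕ.m≤m*n _ (q * q * q) ⦃ >-nonZero (*-positive (*-positive 0<q 0<q) 0<q) ⦄) ⟩
    w ^ 8 * ((γ * q) ^ 3 * ((q * q * q) * (q * q * q)) * (q * q * q))
      ≡⟨ regroup₂ w γ q ⟩
    w ^ 5 * (w * γ * q ^ 4) ^ 3
      ≤⟨ ℕ.*-monoʳ-≤ (w ^ 5) (ℕ.^-monoˡ-≤ 3 gap) ⟩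
    w ^ 5 * (Q * n) ^ 3
      ≡⟨ regroup₃ (w ^ 5) Q n ⟩
    w ^ 5 * n ^ 3 * (Q * Q * Q) ∎)
    where
    wn≤q³ : w * n ≤ q * q * q
    wn≤q³ = ℕ.≤-trans wn≤ (ℕ.*-monoˡ-≤ q (ℕ.*-mono-≤ g≤q g≤q))
    regroup₁ : ∀ w n c → w * (w * (w * (w * (w * 1)))) * (n * (n * (n * 1))) * (c * (n * n)) ≡ c * ((w * n) * ((w * n) * ((w * n) * 1)) * ((w * n) * (w * n)))
    regroup₁ = ℕ-Solver.solve-∀
    regroup₂ : ∀ w γ q → w * (w * (w * (w * (w * (w * (w * (w * 1))))))) * ((γ * q) * ((γ * q) * ((γ * q) * 1)) * ((q * q * q) * (q * q * q)) * (q * q * q))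
      ≡ w * (w * (w * (w * (w * 1)))) * ((w * γ * (q * (q * (q * (q * 1))))) * ((w * γ * (q * (q * (q * (q * 1))))) * ((w * γ * (q * (q * (q * (q * 1))))) * 1)))
    regroup₂ = ℕ-Solver.solve-∀
    regroup₃ : ∀ w Q n → w * ((Q * n) * ((Q * n) * ((Q * n) * 1))) ≡ w * (n * (n * (n * 1))) * (Q * Q * Q)
    regroup₃ = ℕ-Solver.solve-∀

module Inequalities₄ (w γ g q Q Q′ n : ℕ) (0<w : 0 < w) (0<γ : 0 < γ) (0<g : 0 < g) (0<n : 0 < n) (w≤q : w ≤ q) (q≤Q : q ≤ Q)
  (g²≤γ : g * g ≤ γ) (wn≤ : w * n ≤ g * q) (gap : w * γ * q ^ 3 ≤ Q * n) (gap² : (w * γ) ^ 4 * Q ^ 9 ≤ Q′ * n ^ 4) where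
  open ℕ.≤-Reasoning
  private
    0<q : 0 < q
    0<q = ℕ.≤-trans 0<w w≤q
    0<Q : 0 < Q
    0<Q = ℕ.≤-trans 0<q q≤Q
    g≤γ : g ≤ γ
    g≤γ = ℕ.≤-trans (ℕ.m≤m*n g g ⦃ >-nonZero 0<g ⦄) g²≤γ

  overlap-bound : ∀ c → c < w ^ 9 → c * (n * n * n) < w * γ * (Q * Q)
  overlap-bound c c<w⁹ = ℕ.*-cancelˡ-< (w ^ 5 * (n * n)) (c * (n * n * n)) (w * γ * (Q * Q)) (begin-strict
    w ^ 5 * (n * n) * (c * (n * n * n))                  ≡⟨ regroup₁ w n c ⟩
    c * (w * n) ^ 5                                      ≤⟨ ℕ.*-monoʳ-≤ c (ℕ.^-monoˡ-≤ 5 wn≤) ⟩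
    c * (g * q) ^ 5                                      <⟨ ℕ.*-monoˡ-< ((g * q) ^ 5) ⦃ >-nonZero (^-positive (g * q) 5 (*-positive 0<g 0<q)) ⦄ c<w⁹ ⟩
    w ^ 9 * (g * q) ^ 5                                  ≤⟨ ℕ.*-monoʳ-≤ (w ^ 9) (ℕ.m≤m*n _ g ⦃ >-nonZero 0<g ⦄) ⟩
    w ^ 9 * ((g * q) ^ 5 * g)                            ≡⟨ regroup₂ w g q ⟩
    w ^ 8 * w * ((g * g) ^ 3 * q ^ 5)                    ≤⟨ ℕ.*-mono-≤ (ℕ.*-monoʳ-≤ (w ^ 8) w≤q) (ℕ.*-monoˡ-≤ (q ^ 5) (ℕ.^-monoˡ-≤ 3 g²≤γ)) ⟩
    w ^ 8 * q * (γ ^ 3 * q ^ 5)                          ≡⟨ regroup₃ w q γ ⟩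
    w ^ 6 * γ * (w * γ * q ^ 3) ^ 2                      ≤⟨ ℕ.*-monoʳ-≤ (w ^ 6 * γ) (ℕ.^-monoˡ-≤ 2 gap) ⟩
    w ^ 6 * γ * (Q * n) ^ 2                              ≡⟨ regroup₄ w γ Q n ⟩
    w ^ 5 * (n * n) * (w * γ * (Q * Q)) ∎)
    where
    regroup₁ : ∀ w n c → w * (w * (w * (w * (w * 1)))) * (n * n) * (c * (n * n * n)) ≡ c * ((w * n) * ((w * n) * ((w * n) * ((w * n) * ((w * n) * 1)))))
    regroup₁ = ℕ-Solver.solve-∀
    regroup₂ : ∀ w g q → w * (w * (w * (w * (w * (w * (w * (w * (w * 1)))))))) * ((g * q) * ((g * q) * ((g * q) * ((g * q) * ((g * q) * 1)))) * g)
      ≡ w * (w * (w * (w * (w * (w * (w * (w * 1))))))) * w * ((g * g) * ((g * g) * ((g * g) * 1)) * (q * (q * (q * (q * (q * 1))))))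
    regroup₂ = ℕ-Solver.solve-∀
    regroup₃ : ∀ w q γ → w * (w * (w * (w * (w * (w * (w * (w * 1))))))) * q * (γ * (γ * (γ * 1)) * (q * (q * (q * (q * (q * 1))))))
      ≡ w * (w * (w * (w * (w * (w * 1))))) * γ * ((w * γ * (q * (q * (q * 1)))) * ((w * γ * (q * (q * (q * 1)))) * 1))
    regroup₃ = ℕ-Solver.solve-∀
    regroup₄ : ∀ w γ Q n → w * (w * (w * (w * (w * (w * 1))))) * γ * ((Q * n) * ((Q * n) * 1)) ≡ w * (w * (w * (w * (w * 1)))) * (n * n) * (w * γ * (Q * Q))
    regroup₄ = ℕ-Solver.solve-∀

  step-bound : ∀ c → c ≤ w ^ 6 → c * (n * n) ≤ Q * Q
  step-bound c c≤w⁶ = cancelˡ (w ^ 4 * (n * n)) (*-positive (^-positive w 4 0<w) (*-positive 0<n 0<n)) (begin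
    w ^ 4 * (n * n) * (c * (n * n))                      ≡⟨ regroup₁ w n c ⟩
    c * (w * n) ^ 4                                      ≤⟨ ℕ.*-mono-≤ c≤w⁶ (ℕ.^-monoˡ-≤ 4 wn≤) ⟩
    w ^ 6 * (g * q) ^ 4                                  ≡⟨ regroup₂ (w ^ 6) g q ⟩
    w ^ 6 * ((g * g) * (g * g) * q ^ 4)                  ≤⟨ ℕ.*-monoʳ-≤ (w ^ 6) (ℕ.*-mono-≤ (ℕ.*-mono-≤ g²≤γ g²≤γ) (ℕ.^-monoʳ-≤ q ⦃ >-nonZero 0<q ⦄ {4} {6} (ℕ.m≤m+n 4 2))) ⟩
    w ^ 6 * (γ * γ * q ^ 6)                              ≡⟨ regroup₃ w γ q ⟩
    w ^ 4 * (w * γ * q ^ 3) ^ 2                          ≤⟨ ℕ.*-monoʳ-≤ (w ^ 4) (ℕ.^-monoˡ-≤ 2 gap) ⟩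
    w ^ 4 * (Q * n) ^ 2                                  ≡⟨ regroup₄ (w ^ 4) Q n ⟩
    w ^ 4 * (n * n) * (Q * Q) ∎)
    where
    regroup₁ : ∀ w n c → w * (w * (w * (w * 1))) * (n * n) * (c * (n * n)) ≡ c * ((w * n) * ((w * n) * ((w * n) * ((w * n) * 1))))
    regroup₁ = ℕ-Solver.solve-∀
    regroup₂ : ∀ w g q → w * ((g * q) * ((g * q) * ((g * q) * ((g * q) * 1)))) ≡ w * ((g * g) * (g * g) * (q * (q * (q * (q * 1)))))
    regroup₂ = ℕ-Solver.solve-∀
    regroup₃ : ∀ w γ q → w * (w * (w * (w * (w * (w * 1))))) * (γ * γ * (q * (q * (q * (q * (q * (q * 1)))))))
      ≡ w * (w * (w * (w * 1))) * ((w * γ * (q * (q * (q * 1)))) * ((w * γ * (q * (q * (q * 1)))) * 1))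
    regroup₃ = ℕ-Solver.solve-∀
    regroup₄ : ∀ w Q n → w * ((Q * n) * ((Q * n) * 1)) ≡ w * (n * n) * (Q * Q)
    regroup₄ = ℕ-Solver.solve-∀

  -- The hypothesis on c is `Small` at r = 2 with its constants collected. Cubing `gap²` makes Q′^3
  -- about Q^27, against Q^9 in the hypothesis; the surplus in Q pays for the powers of n and leaves
  -- w^26 ≤ c.
  start-bound : ∀ c → w * γ * Q′ ^ 3 ≤ c * (n * Q ^ 9) → w ^ 26 ≤ c
  start-bound c small = cancelˡ ((γ * Q) ^ 13) (^-positive (γ * Q) 13 (*-positive 0<γ 0<Q)) (begin
    (γ * Q) ^ 13 * w ^ 26
      ≡⟨ cong₂ _*_ (^-distrib-* 13 γ Q) (ℕ.^-distribˡ-+-* w 13 13) ⟩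
    γ ^ 13 * Q ^ 13 * (w ^ 13 * w ^ 13)
      ≤⟨ ℕ.*-monoˡ-≤ (w ^ 13 * w ^ 13) (ℕ.*-monoʳ-≤ (γ ^ 13) (ℕ.^-monoʳ-≤ Q ⦃ >-nonZero 0<Q ⦄ {13} {18} (ℕ.m≤m+n 13 5))) ⟩
    γ ^ 13 * Q ^ 18 * (w ^ 13 * w ^ 13)
      ≡⟨ trans (regroup₁ (γ ^ 13) (Q ^ 18) (w ^ 13)) (cong (λ z → w ^ 13 * (z * Q ^ 18)) (sym (^-distrib-* 13 w γ))) ⟩
    w ^ 13 * ((w * γ) ^ 13 * Q ^ 18)
      ≤⟨ ℕ.*-monoʳ-≤ (w ^ 13) reduced ⟩
    w ^ 13 * (c * n ^ 13)
      ≡⟨ trans (regroup₂ (w ^ 13) c (n ^ 13)) (cong (_* c) (sym (^-distrib-* 13 w n))) ⟩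
    (w * n) ^ 13 * c
      ≤⟨ ℕ.*-monoˡ-≤ c (ℕ.^-monoˡ-≤ 13 (ℕ.≤-trans wn≤ (ℕ.*-mono-≤ g≤γ q≤Q))) ⟩
    (γ * Q) ^ 13 * c ∎)
    where
    regroup₁ : ∀ a b w → a * b * (w * w) ≡ w * (w * a * b)
    regroup₁ = ℕ-Solver.solve-∀
    regroup₂ : ∀ a c b → a * (c * b) ≡ a * b * c
    regroup₂ = ℕ-Solver.solve-∀
    W : ℕ
    W = w * γ
    reduced : W ^ 13 * Q ^ 18 ≤ c * n ^ 13
    reduced = cancelˡ (Q ^ 9) (^-positive Q 9 0<Q) (begin
      Q ^ 9 * (W ^ 13 * Q ^ 18)
        ≡⟨ trans (swap (Q ^ 9) (W ^ 13) (Q ^ 18)) (cong (W ^ 13 *_) (sym (ℕ.^-distribˡ-+-* Q 9 18))) ⟩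
      W ^ 13 * Q ^ 27
        ≡⟨ trans (ℕ.*-assoc W (W ^ 12) (Q ^ 27)) (cong₂ (λ u v → W * (u * v)) (sym (ℕ.^-*-assoc W 4 3)) (sym (ℕ.^-*-assoc Q 9 3))) ⟩
      W * ((W ^ 4) ^ 3 * (Q ^ 9) ^ 3)
        ≡⟨ cong (W *_) (^-distrib-* 3 (W ^ 4) (Q ^ 9)) ⟨
      W * (W ^ 4 * Q ^ 9) ^ 3
        ≤⟨ ℕ.*-monoʳ-≤ W (ℕ.^-monoˡ-≤ 3 gap²) ⟩
      W * (Q′ * n ^ 4) ^ 3
        ≡⟨ trans (cong (W *_) (trans (^-distrib-* 3 Q′ (n ^ 4)) (cong (Q′ ^ 3 *_) (ℕ.^-*-assoc n 4 3)))) (sym (ℕ.*-assoc W (Q′ ^ 3) (n ^ 12))) ⟩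
      W * Q′ ^ 3 * n ^ 12
        ≤⟨ ℕ.*-monoˡ-≤ (n ^ 12) small ⟩
      c * (n * Q ^ 9) * n ^ 12
        ≡⟨ finish c n (Q ^ 9) (n ^ 12) ⟩
      Q ^ 9 * (c * n ^ 13) ∎)
      where
      swap : ∀ a b c → a * (b * c) ≡ b * (a * c)
      swap = ℕ-Solver.solve-∀
      finish : ∀ c n q N → c * (n * q) * N ≡ q * (c * (n * N))
      finish = ℕ-Solver.solve-∀

module Inequalities₃ (W Q Q′ m n ζ : ℕ) (0<W : 0 < W) (0<m : 0 < m) (n≡ : n ≡ m * (m * (m * 1))) (0<Q : 0 < Q)
  (ζ⁸n≤ : ζ ^ 8 * n ≤ W * Q) (gap³ : W ^ 7 * Q ^ 8 ≤ Q′ * n ^ 7) (v : ℕ) (0<v : 0 < v) (vm≤ζ : v * m ≤ ζ) where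
  open ℕ.≤-Reasoning
  private
    0<n : 0 < n
    0<n = subst (0 <_) (sym n≡) (^-positive m 3 0<m)
    0<ζ : 0 < ζ
    0<ζ = ℕ.≤-trans (*-positive 0<v 0<m) vm≤ζ

  overlap-bound : ∀ c → c < v ^ 8 → c * (m ^ 8 * n) < W * Q
  overlap-bound c c<v⁸ = begin-strict
    c * (m ^ 8 * n)          <⟨ ℕ.*-monoˡ-< (m ^ 8 * n) ⦃ >-nonZero (*-positive (^-positive m 8 0<m) 0<n) ⦄ c<v⁸ ⟩
    v ^ 8 * (m ^ 8 * n)      ≡⟨ ℕ.*-assoc (v ^ 8) (m ^ 8) n ⟨
    v ^ 8 * m ^ 8 * n        ≡⟨ cong (_* n) (^-distrib-* 8 v m) ⟨
    (v * m) ^ 8 * n          ≤⟨ ℕ.*-monoˡ-≤ n (ℕ.^-monoˡ-≤ 8 vm≤ζ) ⟩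
    ζ ^ 8 * n                ≤⟨ ζ⁸n≤ ⟩
    W * Q ∎

  -- The hypothesis on c is `Small` at r = 3 with its constants collected. Squaring `gap³` makes
  -- Q′^2 about Q^16, against Q^10 in the hypothesis. The surplus Q^6 becomes ζ^48 n^6 by `ζ⁸n≤`,
  -- and v m ≤ ζ disposes of the remaining n^9 = m^27.
  start-bound : ∀ c → W * Q′ ^ 2 ≤ c * (n * Q ^ 10) → v ^ 27 ≤ c
  start-bound c small = cancelˡ (m ^ 27) (^-positive m 27 0<m) (begin
    m ^ 27 * v ^ 27                ≡⟨ trans (ℕ.*-comm (m ^ 27) (v ^ 27)) (sym (^-distrib-* 27 v m)) ⟩
    (v * m) ^ 27                   ≤⟨ ℕ.^-monoˡ-≤ 27 vm≤ζ ⟩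
    ζ ^ 27                         ≤⟨ ℕ.^-monoʳ-≤ ζ ⦃ >-nonZero 0<ζ ⦄ {27} {48} (ℕ.m≤m+n 27 21) ⟩
    ζ ^ 48                         ≤⟨ ℕ.m≤n*m (ζ ^ 48) (W ^ 9) ⦃ >-nonZero (^-positive W 9 0<W) ⦄ ⟩
    W ^ 9 * ζ ^ 48                 ≤⟨ reduced ⟩
    c * n ^ 9                      ≡⟨ trans (ℕ.*-comm c (n ^ 9)) (cong (_* c) (trans (cong (_^ 9) n≡) (ℕ.^-*-assoc m 3 9))) ⟩
    m ^ 27 * c ∎)
    where
    swap : ∀ a b c → a * (b * c) ≡ b * (a * c)
    swap = ℕ-Solver.solve-∀
    finish : ∀ c n q N → c * (n * q) * N ≡ q * (c * (n * N))
    finish = ℕ-Solver.solve-∀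
    first : W ^ 15 * Q ^ 6 ≤ c * n ^ 15
    first = cancelˡ (Q ^ 10) (^-positive Q 10 0<Q) (begin
      Q ^ 10 * (W ^ 15 * Q ^ 6)
        ≡⟨ trans (swap (Q ^ 10) (W ^ 15) (Q ^ 6)) (cong (W ^ 15 *_) (sym (ℕ.^-distribˡ-+-* Q 10 6))) ⟩
      W ^ 15 * Q ^ 16
        ≡⟨ trans (ℕ.*-assoc W (W ^ 14) (Q ^ 16)) (cong₂ (λ u v → W * (u * v)) (sym (ℕ.^-*-assoc W 7 2)) (sym (ℕ.^-*-assoc Q 8 2))) ⟩
      W * ((W ^ 7) ^ 2 * (Q ^ 8) ^ 2)
        ≡⟨ cong (W *_) (^-distrib-* 2 (W ^ 7) (Q ^ 8)) ⟨
      W * (W ^ 7 * Q ^ 8) ^ 2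
        ≤⟨ ℕ.*-monoʳ-≤ W (ℕ.^-monoˡ-≤ 2 gap³) ⟩
      W * (Q′ * n ^ 7) ^ 2
        ≡⟨ trans (cong (W *_) (trans (^-distrib-* 2 Q′ (n ^ 7)) (cong (Q′ ^ 2 *_) (ℕ.^-*-assoc n 7 2)))) (sym (ℕ.*-assoc W (Q′ ^ 2) (n ^ 14))) ⟩
      W * Q′ ^ 2 * n ^ 14
        ≤⟨ ℕ.*-monoˡ-≤ (n ^ 14) small ⟩
      c * (n * Q ^ 10) * n ^ 14
        ≡⟨ finish c n (Q ^ 10) (n ^ 14) ⟩
      Q ^ 10 * (c * n ^ 15) ∎)
    reduced : W ^ 9 * ζ ^ 48 ≤ c * n ^ 9
    reduced = cancelˡ (n ^ 6) (^-positive n 6 0<n) (begin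
      n ^ 6 * (W ^ 9 * ζ ^ 48)
        ≡⟨ trans (swap (n ^ 6) (W ^ 9) (ζ ^ 48)) (cong (W ^ 9 *_) (trans (ℕ.*-comm (n ^ 6) (ζ ^ 48)) (trans (cong (_* n ^ 6) (sym (ℕ.^-*-assoc ζ 8 6))) (sym (^-distrib-* 6 (ζ ^ 8) n))))) ⟩
      W ^ 9 * (ζ ^ 8 * n) ^ 6
        ≤⟨ ℕ.*-monoʳ-≤ (W ^ 9) (ℕ.^-monoˡ-≤ 6 ζ⁸n≤) ⟩
      W ^ 9 * (W * Q) ^ 6
        ≡⟨ trans (cong (W ^ 9 *_) (^-distrib-* 6 W Q)) (trans (sym (ℕ.*-assoc (W ^ 9) (W ^ 6) (Q ^ 6))) (cong (_* Q ^ 6) (sym (ℕ.^-distribˡ-+-* W 9 6)))) ⟩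
      W ^ 15 * Q ^ 6
        ≤⟨ first ⟩
      c * n ^ 15
        ≡⟨ trans (cong (c *_) (ℕ.^-distribˡ-+-* n 6 9)) (swap c (n ^ 6) (n ^ 9)) ⟩
      n ^ 6 * (c * n ^ 9) ∎)

no-two-solutions-with : ∀ i α β m Q Q′ r₀ A B b w → let j = suc i; k = suc j; γ = α * β in
  A ≡ 12 * (k * k) → B ≡ 12 * (k * k) * (k * k) → b ≡ 2 * suc k → w ≡ k ^ k →
  Solution k α β m Q → Solution k α β m Q′ → 0 < m → 0 < Q → 0 < Q′ → 0 < γ →
  A * (2 * (B * (m * m))) ^ j ≤ Q ^ i →
  2 * m * A ^ (2 + r₀) * (b * m * (B * (m * m)) ^ r₀) ^ j * (Q * Q) < w * γ * (Q ^ i) ^ suc r₀ →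
  Large k γ m Q Q′ r₀ ⊎ (1 ≤ r₀ × ¬ (w * γ * Q′ ^ j ≤ Q * (2 * m * (A * Q) ^ suc r₀) ^ k)) → ⊥
no-two-solutions-with i α β m Q Q′ r₀ _ _ _ _ refl refl refl refl = no-two-solutions i α β m Q Q′ r₀

gap-principle-with : ∀ j α β m Q Q′ w → w ≡ suc j ^ suc j → 0 < m → Q < Q′ → Solution (suc j) α β m Q → Solution (suc j) α β m Q′ →
  w * (α * β) * Q ^ j ≤ Q′ * m ^ suc j
gap-principle-with j α β m Q Q′ _ refl = gap-principle j α β m Q Q′

-- The numerals are passed as variables A, B, b, w because conversion would unfold them when multiplied by a variable.
module Exponent5 (A B b w : ℕ) (A≡ : A ≡ 12 * (5 * 5)) (B≡ : B ≡ 12 * (5 * 5) * (5 * 5)) (b≡ : b ≡ 2 * 6) (w≡ : w ≡ 5 ^ 5) (0<w : 0 < w)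
  (step-constant : A * (2 * B) ^ 4 ≤ w ^ 8) (overlap-constant : 2 * A ^ 2 * b ^ 4 < w ^ 4)
  (α β m g h q Q Q′ : ℕ)
  (S₀ : Solution 5 α β m q) (S : Solution 5 α β m Q) (S′ : Solution 5 α β m Q′) (q<Q : q < Q) (Q<Q′ : Q < Q′)
  (0<m : 0 < m) (0<g : 0 < g) (g≤h : g ≤ h) (gh≤γ : g * h ≤ α * β) (m^k≤ : m ^ 5 ≤ g ^ 3 * h ^ 5) (q≥ : w * (g * h ^ 5) ≤ q) where
  open ℕ.≤-Reasoning
  private
    γ : ℕ
    γ = α * β
    0<h : 0 < h
    0<h = ℕ.≤-trans 0<g g≤h
    gh^5≤q : g * h ^ 5 ≤ q
    gh^5≤q = ℕ.≤-trans (ℕ.m≤n*m (g * h ^ 5) w ⦃ >-nonZero 0<w ⦄) q≥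
    g≤q : g ≤ q
    g≤q = ℕ.≤-trans (ℕ.m≤m*n g (h ^ 5) ⦃ >-nonZero (^-positive h 5 0<h) ⦄) gh^5≤q
    0<q : 0 < q
    0<q = ℕ.≤-trans 0<g g≤q
    0<Q : 0 < Q
    0<Q = ℕ.<-trans 0<q q<Q
    0<γ : 0 < γ
    0<γ = ℕ.≤-trans (*-positive 0<g 0<h) gh≤γ
    wn≤ : w * m ^ 5 ≤ g * g * q
    wn≤ = begin
      w * m ^ 5                       ≤⟨ ℕ.*-monoʳ-≤ w m^k≤ ⟩
      w * (g ^ 3 * h ^ 5)             ≡⟨ regroup w g (h ^ 5) ⟩
      g * g * (w * (g * h ^ 5))       ≤⟨ ℕ.*-monoʳ-≤ (g * g) q≥ ⟩
      g * g * q ∎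
      where
      regroup : ∀ w g H → w * (g * (g * (g * 1)) * H) ≡ g * g * (w * (g * H))
      regroup = ℕ-Solver.solve-∀
    open Inequalities₅ w γ g q Q (m ^ 5) 0<w 0<γ 0<q (^-positive m 5 0<m) (ℕ.≤-trans (ℕ.*-monoʳ-≤ g g≤h) gh≤γ) g≤q wn≤
      (gap-principle-with 4 α β m q Q w w≡ 0<m q<Q S₀ S)
    step : A * (2 * (B * (m * m))) ^ 4 ≤ Q ^ 3
    step = begin
      A * (2 * (B * (m * m))) ^ 4                ≡⟨ regroup A B m ⟩
      A * (2 * B) ^ 4 * m ^ 8                    ≤⟨ ℕ.*-monoʳ-≤ (A * (2 * B) ^ 4) (ℕ.^-monoʳ-≤ m ⦃ >-nonZero 0<m ⦄ {8} {10} (ℕ.m≤m+n 8 2)) ⟩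
      A * (2 * B) ^ 4 * m ^ 10                   ≡⟨ cong (A * (2 * B) ^ 4 *_) (ℕ.^-distribˡ-+-* m 5 5) ⟩
      A * (2 * B) ^ 4 * (m ^ 5 * m ^ 5)          ≤⟨ step-bound (A * (2 * B) ^ 4) step-constant ⟩
      Q * Q * Q                                  ≡⟨ cube Q ⟩
      Q ^ 3 ∎
      where
      regroup : ∀ A B m → A * ((2 * (B * (m * m))) * ((2 * (B * (m * m))) * ((2 * (B * (m * m))) * ((2 * (B * (m * m))) * 1))))
        ≡ A * ((2 * B) * ((2 * B) * ((2 * B) * ((2 * B) * 1)))) * (m * (m * (m * (m * (m * (m * (m * (m * 1))))))))
      regroup = ℕ-Solver.solve-∀
      cube : ∀ Q → Q * Q * Q ≡ Q * (Q * (Q * 1))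
      cube = ℕ-Solver.solve-∀
    overlapping : 2 * m * A ^ 2 * (b * m * 1) ^ 4 * (Q * Q) < w * γ * (Q ^ 3) ^ 1
    overlapping = begin-strict
      2 * m * A ^ 2 * (b * m * 1) ^ 4 * (Q * Q)      ≡⟨ regroup A b m Q ⟩
      2 * A ^ 2 * b ^ 4 * m ^ 5 * (Q * Q)            <⟨ ℕ.*-monoˡ-< (Q * Q) ⦃ >-nonZero (*-positive 0<Q 0<Q) ⦄
                                                           (overlap-bound (2 * A ^ 2 * b ^ 4) overlap-constant) ⟩
      w * γ * Q * (Q * Q)                             ≡⟨ finish w γ Q ⟩
      w * γ * (Q ^ 3) ^ 1 ∎
      where
      regroup : ∀ A b m Q → 2 * m * (A * (A * 1)) * ((b * m * 1) * ((b * m * 1) * ((b * m * 1) * ((b * m * 1) * 1)))) * (Q * Q)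
        ≡ 2 * (A * (A * 1)) * (b * (b * (b * (b * 1)))) * (m * (m * (m * (m * (m * 1))))) * (Q * Q)
      regroup = ℕ-Solver.solve-∀
      finish : ∀ w γ Q → w * γ * Q * (Q * Q) ≡ w * γ * ((Q * (Q * (Q * 1))) * 1)
      finish = ℕ-Solver.solve-∀

  impossible : ⊥
  impossible = no-two-solutions-with 3 α β m Q Q′ 0 A B b w A≡ B≡ b≡ w≡ S S′ 0<m 0<Q (ℕ.<-trans 0<Q Q<Q′) 0<γ step overlapping
    (inj₁ (gap⇒Large 4 γ m Q Q′ (gap-principle 4 α β m Q Q′ 0<m Q<Q′ S S′)))

-- At r = 0 both sides of `Overlapping` have Q², so the approximants start at r₀ = 1 and `Small` at
-- 2 has to be refuted. It allows Q′ up to about Q^3, exactly the order that one gap guarantees; Q₁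
-- supplies a second gap and makes Q′ about Q^9.
module Exponent4 (A B b w : ℕ) (A≡ : A ≡ 12 * (4 * 4)) (B≡ : B ≡ 12 * (4 * 4) * (4 * 4)) (b≡ : b ≡ 2 * 5) (w≡ : w ≡ 4 ^ 4) (0<w : 0 < w)
  (step-constant : A * (2 * B) ^ 3 ≤ w ^ 6) (overlap-constant : 2 * A ^ 3 * (b * B) ^ 3 < w ^ 9) (start-constant : 2 ^ 4 * A ^ 8 < w ^ 26)
  (α β m g h q Q Q₁ Q′ : ℕ)
  (S₀ : Solution 4 α β m q) (S : Solution 4 α β m Q) (S₁ : Solution 4 α β m Q₁) (S′ : Solution 4 α β m Q′)
  (q<Q : q < Q) (Q<Q₁ : Q < Q₁) (Q₁<Q′ : Q₁ < Q′)
  (0<m : 0 < m) (0<g : 0 < g) (g≤h : g ≤ h) (gh≤γ : g * h ≤ α * β) (m^k≤ : m ^ 4 ≤ g ^ 2 * h ^ 4) (q≥ : w * (g * h ^ 4) ≤ q) where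
  open ℕ.≤-Reasoning
  private
    γ n W : ℕ
    γ = α * β
    n = m ^ 4
    W = w * γ
    0<h : 0 < h
    0<h = ℕ.≤-trans 0<g g≤h
    w≤q : w ≤ q
    w≤q = ℕ.≤-trans (ℕ.m≤m*n w (g * h ^ 4) ⦃ >-nonZero (*-positive 0<g (^-positive h 4 0<h)) ⦄) q≥
    0<Q : 0 < Q
    0<Q = ℕ.≤-<-trans z≤n q<Q
    0<γ : 0 < γ
    0<γ = ℕ.≤-trans (*-positive 0<g 0<h) gh≤γ
    wn≤ : w * n ≤ g * q
    wn≤ = begin
      w * n                           ≤⟨ ℕ.*-monoʳ-≤ w m^k≤ ⟩
      w * (g ^ 2 * h ^ 4)             ≡⟨ regroup w g (h ^ 4) ⟩
      g * (w * (g * h ^ 4))           ≤⟨ ℕ.*-monoʳ-≤ g q≥ ⟩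
      g * q ∎
      where
      regroup : ∀ w g H → w * (g * (g * 1) * H) ≡ g * (w * (g * H))
      regroup = ℕ-Solver.solve-∀
    gap² : W ^ 4 * Q ^ 9 ≤ Q′ * n ^ 4
    gap² = begin
      W ^ 4 * Q ^ 9                   ≡⟨ trans (ℕ.*-assoc W (W ^ 3) (Q ^ 9)) (cong (W *_) (trans (cong (W ^ 3 *_) (sym (ℕ.^-*-assoc Q 3 3))) (sym (^-distrib-* 3 W (Q ^ 3))))) ⟩
      W * (W * Q ^ 3) ^ 3             ≤⟨ ℕ.*-monoʳ-≤ W (ℕ.^-monoˡ-≤ 3 (gap-principle-with 3 α β m Q Q₁ w w≡ 0<m Q<Q₁ S S₁)) ⟩
      W * (Q₁ * n) ^ 3                ≡⟨ trans (cong (W *_) (^-distrib-* 3 Q₁ n)) (sym (ℕ.*-assoc W (Q₁ ^ 3) (n ^ 3))) ⟩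
      W * Q₁ ^ 3 * n ^ 3              ≤⟨ ℕ.*-monoˡ-≤ (n ^ 3) (gap-principle-with 3 α β m Q₁ Q′ w w≡ 0<m Q₁<Q′ S₁ S′) ⟩
      Q′ * n * n ^ 3                  ≡⟨ ℕ.*-assoc Q′ n (n ^ 3) ⟩
      Q′ * n ^ 4 ∎
    open Inequalities₄ w γ g q Q Q′ n 0<w 0<γ 0<g (^-positive m 4 0<m) w≤q (ℕ.<⇒≤ q<Q) (ℕ.≤-trans (ℕ.*-monoʳ-≤ g g≤h) gh≤γ) wn≤
      (gap-principle-with 3 α β m q Q w w≡ 0<m q<Q S₀ S) gap²
    step : A * (2 * (B * (m * m))) ^ 3 ≤ Q ^ 2
    step = begin
      A * (2 * (B * (m * m))) ^ 3                ≡⟨ regroup A B m ⟩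
      A * (2 * B) ^ 3 * m ^ 6                    ≤⟨ ℕ.*-monoʳ-≤ (A * (2 * B) ^ 3) (ℕ.^-monoʳ-≤ m ⦃ >-nonZero 0<m ⦄ {6} {8} (ℕ.m≤m+n 6 2)) ⟩
      A * (2 * B) ^ 3 * m ^ 8                    ≡⟨ cong (A * (2 * B) ^ 3 *_) (ℕ.^-distribˡ-+-* m 4 4) ⟩
      A * (2 * B) ^ 3 * (n * n)                  ≤⟨ step-bound (A * (2 * B) ^ 3) step-constant ⟩
      Q * Q                                      ≡⟨ cong (Q *_) (ℕ.*-identityʳ Q) ⟨
      Q ^ 2 ∎
      where
      regroup : ∀ A B m → A * ((2 * (B * (m * m))) * ((2 * (B * (m * m))) * ((2 * (B * (m * m))) * 1)))
        ≡ A * ((2 * B) * ((2 * B) * ((2 * B) * 1))) * (m * (m * (m * (m * (m * (m * 1))))))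
      regroup = ℕ-Solver.solve-∀
    c₁ : ℕ
    c₁ = 2 * A ^ 3 * (b * B) ^ 3
    overlapping : 2 * m * A ^ 3 * (b * m * (B * (m * m)) ^ 1) ^ 3 * (Q * Q) < w * γ * (Q ^ 2) ^ 2
    overlapping = begin-strict
      2 * m * A ^ 3 * (b * m * (B * (m * m)) ^ 1) ^ 3 * (Q * Q)      ≡⟨ regroup A B b m Q ⟩
      2 * A ^ 3 * (b * B) ^ 3 * m ^ 10 * (Q * Q)     ≤⟨ ℕ.*-monoˡ-≤ (Q * Q) (ℕ.*-monoʳ-≤ c₁ (ℕ.^-monoʳ-≤ m ⦃ >-nonZero 0<m ⦄ {10} {12} (ℕ.m≤m+n 10 2))) ⟩
      c₁ * m ^ 12 * (Q * Q)                           ≡⟨ cong (λ z → c₁ * z * (Q * Q)) (trans (sym (ℕ.^-*-assoc m 4 3)) (cube n)) ⟩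
      c₁ * (n * n * n) * (Q * Q)                      <⟨ ℕ.*-monoˡ-< (Q * Q) ⦃ >-nonZero (*-positive 0<Q 0<Q) ⦄
                                                           (overlap-bound c₁ overlap-constant) ⟩
      w * γ * (Q * Q) * (Q * Q)                       ≡⟨ finish w γ Q ⟩
      w * γ * (Q ^ 2) ^ 2 ∎
      where
      regroup : ∀ A B b m Q → 2 * m * (A * (A * (A * 1))) * ((b * m * ((B * (m * m)) * 1)) * ((b * m * ((B * (m * m)) * 1)) * ((b * m * ((B * (m * m)) * 1)) * 1))) * (Q * Q)
        ≡ 2 * (A * (A * (A * 1))) * ((b * B) * ((b * B) * ((b * B) * 1))) * (m * (m * (m * (m * (m * (m * (m * (m * (m * (m * 1)))))))))) * (Q * Q)
      regroup = ℕ-Solver.solve-∀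
      cube : ∀ n → n * (n * (n * 1)) ≡ n * n * n
      cube = ℕ-Solver.solve-∀
      finish : ∀ w γ Q → w * γ * (Q * Q) * (Q * Q) ≡ w * γ * ((Q * (Q * 1)) * ((Q * (Q * 1)) * 1))
      finish = ℕ-Solver.solve-∀
    ¬small : ¬ (w * γ * Q′ ^ 3 ≤ Q * (2 * m * (A * Q) ^ 2) ^ 4)
    ¬small small = ℕ.<⇒≱ start-constant (start-bound (2 ^ 4 * A ^ 8) (ℕ.≤-trans small (ℕ.≤-reflexive reshape)))
      where
      reshape : Q * (2 * m * (A * Q) ^ 2) ^ 4 ≡ 2 ^ 4 * A ^ 8 * (m ^ 4 * Q ^ 9)
      reshape = begin-equality
        Q * (2 * m * (A * Q) ^ 2) ^ 4
          ≡⟨ cong (Q *_) (trans (^-distrib-* 4 (2 * m) ((A * Q) ^ 2)) (cong₂ _*_ (^-distrib-* 4 2 m) (trans (ℕ.^-*-assoc (A * Q) 2 4) (^-distrib-* 8 A Q)))) ⟩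
        Q * (2 ^ 4 * m ^ 4 * (A ^ 8 * Q ^ 8))
          ≡⟨ regroup Q (2 ^ 4) (m ^ 4) (A ^ 8) (Q ^ 8) ⟩
        2 ^ 4 * A ^ 8 * (m ^ 4 * Q ^ 9) ∎
        where
        regroup : ∀ Q a m b q → Q * (a * m * (b * q)) ≡ a * b * (m * (Q * q))
        regroup = ℕ-Solver.solve-∀

  impossible : ⊥
  impossible = no-two-solutions-with 2 α β m Q Q′ 1 A B b w A≡ B≡ b≡ w≡ S S′ 0<m 0<Q (ℕ.≤-<-trans z≤n Q₁<Q′) 0<γ step overlapping (inj₂ (s≤s z≤n , ¬small))

-- For k = 3 the gap principle says that W Q / n is at least squared from one member to the next; ζ
-- is a lower bound for this ratio.
ratio-squares : ∀ W n ζ Q Q⁺ → ζ * n ≤ W * Q → W * Q ^ 2 ≤ Q⁺ * n → 0 < n → ζ * ζ * n ≤ W * Q⁺ × ζ * Q ≤ Q⁺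
ratio-squares W n ζ Q Q⁺ ζn≤WQ gap 0<n = (begin
    ζ * ζ * n              ≡⟨ ℕ.*-assoc ζ ζ n ⟩
    ζ * (ζ * n)            ≤⟨ ℕ.*-monoʳ-≤ ζ ζn≤WQ ⟩
    ζ * (W * Q)            ≡⟨ swap ζ W Q ⟩
    W * (ζ * Q)            ≤⟨ ℕ.*-monoʳ-≤ W ζQ≤Q⁺ ⟩
    W * Q⁺ ∎) , ζQ≤Q⁺
  where
  open ℕ.≤-Reasoning
  swap : ∀ a b c → a * (b * c) ≡ b * (a * c)
  swap = ℕ-Solver.solve-∀
  ζQ≤Q⁺ : ζ * Q ≤ Q⁺
  ζQ≤Q⁺ = cancelˡ n 0<n (begin
    n * (ζ * Q)            ≡⟨ regroup₁ n ζ Q ⟩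
    ζ * n * Q              ≤⟨ ℕ.*-monoˡ-≤ Q ζn≤WQ ⟩
    W * Q * Q              ≡⟨ regroup₂ W Q ⟩
    W * Q ^ 2              ≤⟨ gap ⟩
    Q⁺ * n                 ≡⟨ ℕ.*-comm Q⁺ n ⟩
    n * Q⁺ ∎)
    where
    regroup₁ : ∀ n ζ Q → n * (ζ * Q) ≡ ζ * n * Q
    regroup₁ = ℕ-Solver.solve-∀
    regroup₂ : ∀ W Q → W * Q * Q ≡ W * (Q * (Q * 1))
    regroup₂ = ℕ-Solver.solve-∀

-- Indices are positions in the sorted tuple. Three squarings from Q₄ to Q₇ turn the ratio ζ into
-- ζ^8 and make Q₇ large. The approximants start at r₀ = 2, and `Small` at 3 allows Q₁₀ up to about
-- Q₇^5; two gaps give only Q₇^4, so three are taken, giving Q₇^8.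
module Exponent3 (A B b w : ℕ) (A≡ : A ≡ 12 * (3 * 3)) (B≡ : B ≡ 12 * (3 * 3) * (3 * 3)) (b≡ : b ≡ 2 * 4) (w≡ : w ≡ 3 ^ 3) (0<w : 0 < w)
  (step-constant : A * (2 * B) ^ 2 ≤ (w * w) ^ 4) (overlap-constant : 2 * A ^ 4 * (b * (B * B)) ^ 2 < (w * w) ^ 8) (start-constant : 2 ^ 3 * A ^ 9 < (w * w) ^ 27)
  (α β m g h Q₄ Q₅ Q₆ Q₇ Q₈ Q₉ Q₁₀ : ℕ)
  (S₄ : Solution 3 α β m Q₄) (S₅ : Solution 3 α β m Q₅) (S₆ : Solution 3 α β m Q₆) (S₇ : Solution 3 α β m Q₇)
  (S₈ : Solution 3 α β m Q₈) (S₉ : Solution 3 α β m Q₉) (S₁₀ : Solution 3 α β m Q₁₀)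
  (Q₄<Q₅ : Q₄ < Q₅) (Q₅<Q₆ : Q₅ < Q₆) (Q₆<Q₇ : Q₆ < Q₇) (Q₇<Q₈ : Q₇ < Q₈) (Q₈<Q₉ : Q₈ < Q₉) (Q₉<Q₁₀ : Q₉ < Q₁₀)
  (0<m : 0 < m) (0<g : 0 < g) (g≤h : g ≤ h) (gh≤γ : g * h ≤ α * β) (m^k≤ : m ^ 3 ≤ g ^ 1 * h ^ 3) (Q₄≥ : w * (g * h ^ 3) ≤ Q₄) where
  open ℕ.≤-Reasoning
  private
    γ n W ζ v : ℕ
    γ = α * β
    n = m ^ 3
    W = w * γ
    ζ = w * W
    v = w * w
    0<h : 0 < h
    0<h = ℕ.≤-trans 0<g g≤h
    0<γ : 0 < γ
    0<γ = ℕ.≤-trans (*-positive 0<g 0<h) gh≤γ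
    0<n : 0 < n
    0<n = ^-positive m 3 0<m
    0<Q₇ : 0 < Q₇
    0<Q₇ = ℕ.≤-<-trans z≤n Q₆<Q₇
    m≤γ : m ≤ γ
    m≤γ = root-≤ 2 m γ (begin
      m ^ 3                    ≤⟨ m^k≤ ⟩
      g ^ 1 * h ^ 3            ≤⟨ ℕ.*-monoˡ-≤ (h ^ 3) (ℕ.^-monoʳ-≤ g ⦃ >-nonZero 0<g ⦄ {1} {3} (ℕ.m≤m+n 1 2)) ⟩
      g ^ 3 * h ^ 3            ≡⟨ ^-distrib-* 3 g h ⟨
      (g * h) ^ 3              ≤⟨ ℕ.^-monoˡ-≤ 3 gh≤γ ⟩
      γ ^ 3 ∎)
    vm≤ζ : v * m ≤ ζ
    vm≤ζ = ℕ.≤-trans (ℕ.≤-reflexive (ℕ.*-assoc w w m)) (ℕ.*-monoʳ-≤ w (ℕ.*-monoʳ-≤ w m≤γ))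
    gap : ∀ {Q Q⁺} → Q < Q⁺ → Solution 3 α β m Q → Solution 3 α β m Q⁺ → W * Q ^ 2 ≤ Q⁺ * n
    gap {Q} {Q⁺} Q<Q⁺ S S⁺ = gap-principle-with 2 α β m Q Q⁺ w w≡ 0<m Q<Q⁺ S S⁺
    ratio₄ : ζ * n ≤ W * Q₄
    ratio₄ = begin
      w * W * n                       ≡⟨ regroup₁ w W n ⟩
      W * (w * n)                     ≤⟨ ℕ.*-monoʳ-≤ W (ℕ.*-monoʳ-≤ w m^k≤) ⟩
      W * (w * (g ^ 1 * h ^ 3))       ≡⟨ cong (λ z → W * (w * (z * h ^ 3))) (ℕ.^-identityʳ g) ⟩
      W * (w * (g * h ^ 3))           ≤⟨ ℕ.*-monoʳ-≤ W Q₄≥ ⟩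
      W * Q₄ ∎
      where
      regroup₁ : ∀ w W n → w * W * n ≡ W * (w * n)
      regroup₁ = ℕ-Solver.solve-∀
    ratio₅ : ζ * ζ * n ≤ W * Q₅
    ratio₅ = proj₁ (ratio-squares W n ζ Q₄ Q₅ ratio₄ (gap Q₄<Q₅ S₄ S₅) 0<n)
    ratio₆ : (ζ * ζ) * (ζ * ζ) * n ≤ W * Q₆
    ratio₆ = proj₁ (ratio-squares W n (ζ * ζ) Q₅ Q₆ ratio₅ (gap Q₅<Q₆ S₅ S₆) 0<n)
    ratio₇ : ζ ^ 8 * n ≤ W * Q₇ × (ζ * ζ) * (ζ * ζ) * Q₆ ≤ Q₇
    ratio₇ with ratio-squares W n ((ζ * ζ) * (ζ * ζ)) Q₆ Q₇ ratio₆ (gap Q₆<Q₇ S₆ S₇) 0<n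
    ... | p , q = ℕ.≤-trans (ℕ.≤-reflexive (cong (_* n) (eighth ζ))) p , q
      where
      eighth : ∀ ζ → ζ * (ζ * (ζ * (ζ * (ζ * (ζ * (ζ * (ζ * 1))))))) ≡ (ζ * ζ) * (ζ * ζ) * ((ζ * ζ) * (ζ * ζ))
      eighth = ℕ-Solver.solve-∀
    gap³ : W ^ 7 * Q₇ ^ 8 ≤ Q₁₀ * n ^ 7
    gap³ = begin
      W ^ 7 * Q₇ ^ 8                        ≡⟨ cong₂ (λ u v → W * u * v) (sym (ℕ.^-*-assoc W 3 2)) (sym (ℕ.^-*-assoc Q₇ 4 2)) ⟩
      W * (W ^ 3) ^ 2 * (Q₇ ^ 4) ^ 2        ≡⟨ trans (ℕ.*-assoc W ((W ^ 3) ^ 2) ((Q₇ ^ 4) ^ 2)) (cong (W *_) (sym (^-distrib-* 2 (W ^ 3) (Q₇ ^ 4)))) ⟩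
      W * (W ^ 3 * Q₇ ^ 4) ^ 2              ≤⟨ ℕ.*-monoʳ-≤ W (ℕ.^-monoˡ-≤ 2 two) ⟩
      W * (Q₉ * n ^ 3) ^ 2                  ≡⟨ trans (cong (W *_) (trans (^-distrib-* 2 Q₉ (n ^ 3)) (cong (Q₉ ^ 2 *_) (ℕ.^-*-assoc n 3 2)))) (sym (ℕ.*-assoc W (Q₉ ^ 2) (n ^ 6))) ⟩
      W * Q₉ ^ 2 * n ^ 6                    ≤⟨ ℕ.*-monoˡ-≤ (n ^ 6) (gap Q₉<Q₁₀ S₉ S₁₀) ⟩
      Q₁₀ * n * n ^ 6                       ≡⟨ ℕ.*-assoc Q₁₀ n (n ^ 6) ⟩
      Q₁₀ * n ^ 7 ∎
      where
      two : W ^ 3 * Q₇ ^ 4 ≤ Q₉ * n ^ 3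
      two = begin
        W ^ 3 * Q₇ ^ 4                      ≡⟨ regroup₁ W Q₇ ⟩
        W * (W * Q₇ ^ 2) ^ 2                ≤⟨ ℕ.*-monoʳ-≤ W (ℕ.^-monoˡ-≤ 2 (gap Q₇<Q₈ S₇ S₈)) ⟩
        W * (Q₈ * n) ^ 2                    ≡⟨ regroup₂ W Q₈ n ⟩
        W * Q₈ ^ 2 * n ^ 2                  ≤⟨ ℕ.*-monoˡ-≤ (n ^ 2) (gap Q₈<Q₉ S₈ S₉) ⟩
        Q₉ * n * n ^ 2                      ≡⟨ ℕ.*-assoc Q₉ n (n ^ 2) ⟩
        Q₉ * n ^ 3 ∎
        where
        regroup₁ : ∀ W Q → W * (W * (W * 1)) * (Q * (Q * (Q * (Q * 1)))) ≡ W * ((W * (Q * (Q * 1))) * ((W * (Q * (Q * 1))) * 1))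
        regroup₁ = ℕ-Solver.solve-∀
        regroup₂ : ∀ W Q n → W * ((Q * n) * ((Q * n) * 1)) ≡ W * (Q * (Q * 1)) * (n * (n * 1))
        regroup₂ = ℕ-Solver.solve-∀
    open Inequalities₃ W Q₇ Q₁₀ m n ζ (*-positive 0<w 0<γ) 0<m refl 0<Q₇ (proj₁ ratio₇) gap³ v (*-positive 0<w 0<w) vm≤ζ
    step : A * (2 * (B * (m * m))) ^ 2 ≤ Q₇ ^ 1
    step = begin
      A * (2 * (B * (m * m))) ^ 2                ≡⟨ regroup A B m ⟩
      A * (2 * B) ^ 2 * m ^ 4                    ≤⟨ ℕ.*-monoˡ-≤ (m ^ 4) step-constant ⟩
      v ^ 4 * m ^ 4                              ≡⟨ ^-distrib-* 4 v m ⟨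
      (v * m) ^ 4                                ≤⟨ ℕ.^-monoˡ-≤ 4 vm≤ζ ⟩
      ζ ^ 4                                      ≡⟨ fourth ζ ⟩
      (ζ * ζ) * (ζ * ζ)                          ≤⟨ ℕ.m≤m*n _ Q₆ ⦃ >-nonZero (ℕ.≤-<-trans z≤n Q₅<Q₆) ⦄ ⟩
      (ζ * ζ) * (ζ * ζ) * Q₆                     ≤⟨ proj₂ ratio₇ ⟩
      Q₇                                         ≡⟨ ℕ.^-identityʳ Q₇ ⟨
      Q₇ ^ 1 ∎
      where
      regroup : ∀ A B m → A * ((2 * (B * (m * m))) * ((2 * (B * (m * m))) * 1)) ≡ A * ((2 * B) * ((2 * B) * 1)) * (m * (m * (m * (m * 1))))
      regroup = ℕ-Solver.solve-∀
      fourth : ∀ ζ → ζ * (ζ * (ζ * (ζ * 1))) ≡ (ζ * ζ) * (ζ * ζ)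
      fourth = ℕ-Solver.solve-∀
    c₁ : ℕ
    c₁ = 2 * A ^ 4 * (b * (B * B)) ^ 2
    overlapping : 2 * m * A ^ 4 * (b * m * (B * (m * m)) ^ 2) ^ 2 * (Q₇ * Q₇) < w * γ * (Q₇ ^ 1) ^ 3
    overlapping = begin-strict
      2 * m * A ^ 4 * (b * m * (B * (m * m)) ^ 2) ^ 2 * (Q₇ * Q₇)      ≡⟨ regroup (A ^ 4) B b m (Q₇ * Q₇) ⟩
      c₁ * (m ^ 8 * n) * (Q₇ * Q₇)                    <⟨ ℕ.*-monoˡ-< (Q₇ * Q₇) ⦃ >-nonZero (*-positive 0<Q₇ 0<Q₇) ⦄
                                                           (overlap-bound c₁ overlap-constant) ⟩
      w * γ * Q₇ * (Q₇ * Q₇)                          ≡⟨ finish w γ Q₇ ⟩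
      w * γ * (Q₇ ^ 1) ^ 3 ∎
      where
      regroup : ∀ A B b m q → 2 * m * A * ((b * m * ((B * (m * m)) * ((B * (m * m)) * 1))) * ((b * m * ((B * (m * m)) * ((B * (m * m)) * 1))) * 1)) * q
        ≡ 2 * A * ((b * (B * B)) * ((b * (B * B)) * 1)) * (m * (m * (m * (m * (m * (m * (m * (m * 1))))))) * (m * (m * (m * 1)))) * q
      regroup = ℕ-Solver.solve-∀
      finish : ∀ w γ Q → w * γ * Q * (Q * Q) ≡ w * γ * ((Q * 1) * ((Q * 1) * ((Q * 1) * 1)))
      finish = ℕ-Solver.solve-∀
    ¬small : ¬ (w * γ * Q₁₀ ^ 2 ≤ Q₇ * (2 * m * (A * Q₇) ^ 3) ^ 3)
    ¬small small = ℕ.<⇒≱ start-constant (start-bound (2 ^ 3 * A ^ 9) (ℕ.≤-trans small (ℕ.≤-reflexive reshape)))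
      where
      reshape : Q₇ * (2 * m * (A * Q₇) ^ 3) ^ 3 ≡ 2 ^ 3 * A ^ 9 * (m ^ 3 * Q₇ ^ 10)
      reshape = begin-equality
        Q₇ * (2 * m * (A * Q₇) ^ 3) ^ 3
          ≡⟨ cong (Q₇ *_) (trans (^-distrib-* 3 (2 * m) ((A * Q₇) ^ 3)) (cong₂ _*_ (^-distrib-* 3 2 m) (trans (ℕ.^-*-assoc (A * Q₇) 3 3) (^-distrib-* 9 A Q₇)))) ⟩
        Q₇ * (2 ^ 3 * m ^ 3 * (A ^ 9 * Q₇ ^ 9))
          ≡⟨ regroup Q₇ (2 ^ 3) (m ^ 3) (A ^ 9) (Q₇ ^ 9) ⟩
        2 ^ 3 * A ^ 9 * (m ^ 3 * Q₇ ^ 10) ∎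
        where
        regroup : ∀ Q a m b q → Q * (a * m * (b * q)) ≡ a * b * (m * (Q * q))
        regroup = ℕ-Solver.solve-∀

  impossible : ⊥
  impossible = no-two-solutions-with 1 α β m Q₇ Q₁₀ 2 A B b w A≡ B≡ b≡ w≡ S₇ S₁₀ 0<m 0<Q₇ (ℕ.≤-<-trans z≤n Q₉<Q₁₀) 0<γ step overlapping (inj₂ (s≤s z≤n , ¬small))

-- Diophantine tuples

-- The equations satisfied by the further members c of a tuple that contains a < b.
record System (P : ℕ → ℕ → Set) (k N a b : ℕ) : Set where
  field
    α β      : ℕ
    αβ≡ab    : α * β ≡ a * b
    Q        : ℕ → ℕ
    Q-lower  : ∀ c → a * b * c ≤ Q c + b * N
    Q-upper  : ∀ c → Q c ≤ a * b * c + a * N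
    Q-mono   : ∀ {c d} → N ≤ a * c → c < d → Q c < Q d
    solution : ∀ c → P a c → P b c → Solution k α β (N * (b ∸ a)) (Q c)
    powers   : ∀ c → 0 < c → P a c → P b c → ∃[ x ] ∃[ y ] a * c ≤ x ^ k + N × x ^ k < y ^ k × y ^ k ≤ b * c + N

-- The cases n = N and n = - N over ℕ; the second puts N beside the power to avoid truncated
-- subtraction.
PlusPower MinusPower : ℕ → ℕ → ℕ → ℕ → Set
PlusPower  k N c d = ∃[ z ] z ^ k ≡ c * d + N
MinusPower k N c d = ∃[ z ] z ^ k + N ≡ c * d

-- Eliminating c from x^k = a c + N and y^k = b c + N leaves b x^k - a y^k = N (b - a).
plus-system : ∀ k N a b → 0 < a → a < b → System (PlusPower k N) k N a b
plus-system k N a b 0<a a<b = record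
  { α = b ; β = a
  ; αβ≡ab = ℕ.*-comm b a
  ; Q = λ c → a * (b * c + N)
  ; Q-lower = λ c → ℕ.≤-trans (ℕ.≤-reflexive (ℕ.*-assoc a b c)) (ℕ.≤-trans (ℕ.*-monoʳ-≤ a (ℕ.m≤m+n (b * c) N)) (ℕ.m≤m+n _ (b * N)))
  ; Q-upper = λ c → ℕ.≤-reflexive (trans (ℕ.*-distribˡ-+ a (b * c) N) (cong (_+ a * N) (sym (ℕ.*-assoc a b c))))
  ; Q-mono = λ _ c<d → ℕ.*-monoʳ-< a ⦃ >-nonZero 0<a ⦄ (ℕ.+-monoˡ-< N (ℕ.*-monoʳ-< b ⦃ >-nonZero 0<b ⦄ c<d))
  ; solution = λ { c (x , x^k) (y , y^k) → record
      { x = x ; y = y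
      ; αx^k = trans (cong (b *_) x^k) (difference c b (b ∸ a) (sym (ℕ.m+[n∸m]≡n (ℕ.<⇒≤ a<b))))
      ; βy^k = cong (a *_) y^k } }
  ; powers = λ { c 0<c (x , x^k) (y , y^k) → x , y
      , ℕ.≤-trans (ℕ.m≤m+n (a * c) N) (ℕ.≤-trans (ℕ.≤-reflexive (sym x^k)) (ℕ.m≤m+n _ N))
      , subst₂ _<_ (sym x^k) (sym y^k) (ℕ.+-monoˡ-< N (ℕ.*-monoˡ-< c ⦃ >-nonZero 0<c ⦄ a<b))
      , ℕ.≤-reflexive y^k }
  }
  where
  0<b : 0 < b
  0<b = ℕ.<-trans 0<a a<b
  difference : ∀ c b d → b ≡ a + d → b * (a * c + N) ≡ a * (b * c + N) + N * d
  difference c _ d refl = lemma a c d N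
    where
    lemma : ∀ a c d N → (a + d) * (a * c + N) ≡ a * ((a + d) * c + N) + N * d
    lemma = ℕ-Solver.solve-∀

-- Here elimination gives a y^k - b x^k = N (b - a): to keep the right side positive, α and β trade
-- places and so do x and y. As Q contains a truncated difference, strict growth of Q relies on N ≤
-- a c.
minus-system : ∀ k N a b → 0 < a → a < b → System (MinusPower k N) k N a b
minus-system k N a b 0<a a<b = record
  { α = a ; β = b
  ; αβ≡ab = refl
  ; Q = λ c → b * (a * c ∸ N)
  ; Q-lower = λ c → ℕ.≤-trans (ℕ.≤-reflexive (swap a b c)) (ℕ.≤-trans (ℕ.*-monoʳ-≤ b (ℕ.m≤n+m∸n (a * c) N))
      (ℕ.≤-reflexive (trans (ℕ.*-distribˡ-+ b N (a * c ∸ N)) (ℕ.+-comm (b * N) _))))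
  ; Q-upper = λ c → ℕ.≤-trans (ℕ.*-monoʳ-≤ b (ℕ.m∸n≤m (a * c) N)) (ℕ.≤-trans (ℕ.≤-reflexive (sym (swap a b c))) (ℕ.m≤m+n _ (a * N)))
  ; Q-mono = λ N≤ac c<d → ℕ.*-monoʳ-< b ⦃ >-nonZero 0<b ⦄ (ℕ.∸-monoˡ-< (ℕ.*-monoʳ-< a ⦃ >-nonZero 0<a ⦄ c<d) N≤ac)
  ; solution = λ { c (x , x^k) (y , y^k) → record
      { x = y ; y = x
      ; αx^k = ℕ.+-cancelʳ-≡ (a * N) _ _ (trans (sym (ℕ.*-distribˡ-+ a (y ^ k) N)) (trans (cong (a *_) y^k)
          (trans (difference c b (b ∸ a) (x ^ k) (sym (ℕ.m+[n∸m]≡n (ℕ.<⇒≤ a<b))) x^k)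
            (cong (λ z → b * z + N * (b ∸ a) + a * N) (minus x c x^k)))))
      ; βy^k = cong (b *_) (minus x c x^k) } }
  ; powers = λ { c 0<c (x , x^k) (y , y^k) → x , y
      , ℕ.≤-reflexive (sym x^k)
      , ℕ.+-cancelʳ-< N (x ^ k) (y ^ k) (subst₂ _<_ (sym x^k) (sym y^k) (ℕ.*-monoˡ-< c ⦃ >-nonZero 0<c ⦄ a<b))
      , ℕ.≤-trans (ℕ.m≤m+n (y ^ k) N) (ℕ.≤-trans (ℕ.≤-reflexive y^k) (ℕ.m≤m+n (b * c) N)) }
  }
  where
  0<b : 0 < b
  0<b = ℕ.<-trans 0<a a<b
  swap : ∀ a b c → a * b * c ≡ b * (a * c)
  swap = ℕ-Solver.solve-∀
  minus : ∀ x c → x ^ k + N ≡ a * c → x ^ k ≡ a * c ∸ N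
  minus x c p = trans (sym (ℕ.m+n∸n≡m (x ^ k) N)) (cong (_∸ N) p)
  difference : ∀ c b d X → b ≡ a + d → X + N ≡ a * c → a * (b * c) ≡ b * X + N * d + a * N
  difference c _ d X refl p = trans (sym (swap′ a d c)) (trans (cong ((a + d) *_) (sym p)) (lemma a d X N))
    where
    swap′ : ∀ a d c → (a + d) * (a * c) ≡ a * ((a + d) * c)
    swap′ = ℕ-Solver.solve-∀
    lemma : ∀ a d X N → (a + d) * (X + N) ≡ (a + d) * X + N * d + a * N
    lemma = ℕ-Solver.solve-∀

-- The members are g < b < c < d with c = h + 1. The predecessor h is convenient because it bounds c
-- - b, as b ≥ 1, and because g b h ≤ Q c holds with the lower-order term b N already absorbed.
module FirstMembers (P : ℕ → ℕ → Set) (i′ N : ℕ)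
  (system : ∀ a b → 0 < a → a < b → System P (3 + i′) N a b)
  (g b h d : ℕ) (0<N : 0 < N) (0<g : 0 < g) (g<b : g < b) (b≤h : b ≤ h) (h<d : suc h < d) (N^k≤g^i : N ^ (3 + i′) ≤ g ^ suc i′)
  (Pgc : P g (suc h)) (Pbc : P b (suc h)) (Pgd : P g d) (Pbd : P b d) where
  open ℕ.≤-Reasoning
  private
    i j k c m : ℕ
    i = suc i′
    j = suc i
    k = suc j
    c = suc h
    m = N * (c ∸ b)
    0<b : 0 < b
    0<b = ℕ.<-trans 0<g g<b
    0<h : 0 < h
    0<h = ℕ.<-≤-trans 0<b b≤h

  N≤g : N ≤ g
  N≤g = root-≤ j N g (ℕ.≤-trans N^k≤g^i (ℕ.^-monoʳ-≤ g ⦃ >-nonZero 0<g ⦄ (ℕ.m≤n+m i 2)))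

  g≤h : g ≤ h
  g≤h = ℕ.≤-trans (ℕ.<⇒≤ g<b) b≤h

  0<m : 0 < m
  0<m = *-positive 0<N (ℕ.m<n⇒0<n∸m (s≤s b≤h))

  m^k≤ : m ^ k ≤ g ^ i * h ^ k
  m^k≤ = begin
    (N * (c ∸ b)) ^ k        ≡⟨ ^-distrib-* k N (c ∸ b) ⟩
    N ^ k * (c ∸ b) ^ k      ≤⟨ ℕ.*-mono-≤ N^k≤g^i (ℕ.^-monoˡ-≤ k (ℕ.∸-monoʳ-≤ c 0<b)) ⟩
    g ^ i * h ^ k ∎

  private
    module S₁ = System (system g b 0<g g<b)
    e : ℕ
    e = g * b
    0<e : 0 < e
    0<e = *-positive 0<g 0<b
    N≤gc : N ≤ g * c
    N≤gc = ℕ.≤-trans N≤g (ℕ.m≤m*n g c)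

    eh≤Q : e * h ≤ S₁.Q c
    eh≤Q = ℕ.+-cancelʳ-≤ (b * N) (e * h) (S₁.Q c) (begin
      e * h + b * N       ≤⟨ ℕ.+-monoʳ-≤ (e * h) (ℕ.≤-trans (ℕ.*-monoʳ-≤ b N≤g) (ℕ.≤-reflexive (ℕ.*-comm b g))) ⟩
      e * h + e           ≡⟨ trans (ℕ.+-comm (e * h) e) (sym (ℕ.*-suc e h)) ⟩
      e * c               ≤⟨ S₁.Q-lower c ⟩
      S₁.Q c + b * N ∎)

    Q≤e[1+d] : S₁.Q d ≤ e * suc d
    Q≤e[1+d] = begin
      S₁.Q d              ≤⟨ S₁.Q-upper d ⟩
      e * d + g * N       ≤⟨ ℕ.+-monoʳ-≤ (e * d) (ℕ.*-monoʳ-≤ g (ℕ.≤-trans N≤g (ℕ.<⇒≤ g<b))) ⟩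
      e * d + e           ≡⟨ trans (ℕ.+-comm (e * d) e) (sym (ℕ.*-suc e d)) ⟩
      e * suc d ∎

    -- The gap principle for the smaller pair g, b and its solutions c, d. It shows that d is
    -- already far from c, before the pair b, c with its larger m comes into play.
    d-bound : k ^ k * (g * h ^ j) ≤ suc d * b
    d-bound = cancelˡ (e * (g ^ i * b ^ j)) (*-positive 0<e (*-positive (^-positive g i 0<g) (^-positive b j 0<b))) (begin
      e * (g ^ i * b ^ j) * (k ^ k * (g * h ^ j))
        ≡⟨ regroup₁ e (g ^ i) (b ^ j) (k ^ k) g (h ^ j) ⟩
      k ^ k * e * (g * g ^ i * b ^ j * h ^ j)
        ≡⟨ cong (k ^ k * e *_) (trans (^-distrib-* j e h) (cong (_* h ^ j) (^-distrib-* j g b))) ⟨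
      k ^ k * e * (e * h) ^ j
        ≤⟨ ℕ.*-monoʳ-≤ (k ^ k * e) (ℕ.^-monoˡ-≤ j eh≤Q) ⟩
      k ^ k * e * S₁.Q c ^ j
        ≡⟨ cong (λ z → k ^ k * z * S₁.Q c ^ j) S₁.αβ≡ab ⟨
      k ^ k * (S₁.α * S₁.β) * S₁.Q c ^ j
        ≤⟨ gap-principle j S₁.α S₁.β (N * (b ∸ g)) (S₁.Q c) (S₁.Q d) (*-positive 0<N (ℕ.m<n⇒0<n∸m g<b)) (S₁.Q-mono N≤gc h<d) (S₁.solution c Pgc Pbc) (S₁.solution d Pgd Pbd) ⟩
      S₁.Q d * (N * (b ∸ g)) ^ k
        ≡⟨ cong (S₁.Q d *_) (^-distrib-* k N (b ∸ g)) ⟩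
      S₁.Q d * (N ^ k * (b ∸ g) ^ k)
        ≤⟨ ℕ.*-mono-≤ Q≤e[1+d] (ℕ.*-mono-≤ N^k≤g^i (ℕ.^-monoˡ-≤ k (ℕ.m∸n≤m b g))) ⟩
      e * suc d * (g ^ i * (b * b ^ j))
        ≡⟨ regroup₂ e (suc d) (g ^ i) b (b ^ j) ⟩
      e * (g ^ i * b ^ j) * (suc d * b) ∎)
      where
      regroup₁ : ∀ e G B κ g H → e * (G * B) * (κ * (g * H)) ≡ κ * e * (g * G * B * H)
      regroup₁ = ℕ-Solver.solve-∀
      regroup₂ : ∀ e d G b B → e * d * (G * (b * B)) ≡ e * (G * B) * (d * b)
      regroup₂ = ℕ-Solver.solve-∀

  0<c : 0 < c
  0<c = s≤s z≤n

  module S₂ = System (system b (suc h) 0<b (s≤s b≤h))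

  gh≤γ : g * h ≤ S₂.α * S₂.β
  gh≤γ = ℕ.≤-trans (ℕ.*-mono-≤ (ℕ.<⇒≤ g<b) (ℕ.n≤1+n h)) (ℕ.≤-reflexive (sym S₂.αβ≡ab))

  Q-mono : ∀ {c′ d′} → 0 < c′ → c′ < d′ → S₂.Q c′ < S₂.Q d′
  Q-mono {c′} 0<c′ = S₂.Q-mono (ℕ.≤-trans N≤g (ℕ.≤-trans (ℕ.<⇒≤ g<b) (ℕ.m≤m*n b c′ ⦃ >-nonZero 0<c′ ⦄)))

  -- For the pair b, c the quantity Q d is about b c d, and c = h + 1 times `d-bound` gives k^k g
  -- h^k with a surplus k^k g h^(k-1). That surplus outweighs the lower-order terms, which are at
  -- most 4 h².
  Q-large : k ^ k * (g * h ^ k) ≤ S₂.Q d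
  Q-large = ℕ.+-cancelʳ-≤ (4 * (h * h)) _ _ (begin
    k ^ k * (g * h ^ k) + 4 * (h * h)
      ≤⟨ ℕ.+-monoʳ-≤ (k ^ k * (g * h ^ k)) lower-order ⟩
    k ^ k * (g * h ^ k) + k ^ k * (g * h ^ j)
      ≡⟨ regroup₁ (k ^ k) g h (h ^ j) ⟩
    c * (k ^ k * (g * h ^ j))
      ≤⟨ ℕ.*-monoʳ-≤ c d-bound ⟩
    c * (suc d * b)
      ≡⟨ regroup₂ c d b ⟩
    b * c * d + b * c
      ≤⟨ ℕ.+-monoˡ-≤ (b * c) (S₂.Q-lower d) ⟩
    S₂.Q d + c * N + b * c
      ≤⟨ ℕ.+-mono-≤ (ℕ.+-monoʳ-≤ (S₂.Q d) (ℕ.*-monoʳ-≤ c (ℕ.≤-trans N≤g g≤h))) (ℕ.*-monoˡ-≤ c b≤h) ⟩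
    S₂.Q d + c * h + h * c
      ≡⟨ regroup₃ (S₂.Q d) h ⟩
    S₂.Q d + (2 * (h * h) + 2 * h)
      ≤⟨ ℕ.+-monoʳ-≤ (S₂.Q d) (ℕ.≤-trans (ℕ.+-monoʳ-≤ (2 * (h * h)) (ℕ.*-monoʳ-≤ 2 (ℕ.m≤m*n h h ⦃ >-nonZero 0<h ⦄))) (ℕ.≤-reflexive (regroup₄ (h * h)))) ⟩
    S₂.Q d + 4 * (h * h) ∎)
    where
    regroup₁ : ∀ κ g h H → κ * (g * (h * H)) + κ * (g * H) ≡ (1 + h) * (κ * (g * H))
    regroup₁ = ℕ-Solver.solve-∀
    regroup₂ : ∀ c d b → c * ((1 + d) * b) ≡ b * c * d + b * c
    regroup₂ = ℕ-Solver.solve-∀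
    regroup₃ : ∀ Q h → Q + (1 + h) * h + h * (1 + h) ≡ Q + (2 * (h * h) + 2 * h)
    regroup₃ = ℕ-Solver.solve-∀
    regroup₄ : ∀ x → 2 * x + 2 * x ≡ 4 * x
    regroup₄ = ℕ-Solver.solve-∀
    4≤k^k : 4 ≤ k ^ k
    4≤k^k = ℕ.≤-trans (ℕ.^-monoˡ-≤ 2 {2} {k} (s≤s (s≤s z≤n))) (ℕ.^-monoʳ-≤ k {2} {k} (s≤s (s≤s z≤n)))
    lower-order : 4 * (h * h) ≤ k ^ k * (g * h ^ j)
    lower-order = ℕ.*-mono-≤ 4≤k^k (begin
      h * h               ≡⟨ cong (h *_) (ℕ.*-identityʳ h) ⟨
      h ^ 2               ≤⟨ ℕ.^-monoʳ-≤ h ⦃ >-nonZero 0<h ⦄ {2} {j} (s≤s (s≤s z≤n)) ⟩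
      h ^ j               ≤⟨ ℕ.m≤n*m (h ^ j) g ⦃ >-nonZero 0<g ⦄ ⟩
      g * h ^ j ∎)

  Q-large-with : ∀ w → w ≡ k ^ k → w * (g * h ^ k) ≤ S₂.Q d
  Q-large-with _ refl = Q-large

  -- The k-th powers attached to {g, c} and {b, c} are at least 2^k and 3^k.
  h-large : 6 ≤ k → 24 ≤ h
  h-large 6≤k = ℕ.≮⇒≥ λ h<24 → from-powers h<24 (S₁.powers c 0<c Pgc Pbc)
    where
    from-powers : h < 24 → (∃[ x ] ∃[ y ] g * c ≤ x ^ k + N × x ^ k < y ^ k × y ^ k ≤ b * c + N) → ⊥
    from-powers h<24 (x , y , gc≤ , x^k<y^k , y^k≤) = ℕ.<⇒≱ (ℕ.≤ᵇ⇒≤ 576 (3 ^ 6) _) (begin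
      3 ^ 6               ≤⟨ ℕ.^-monoʳ-≤ 3 6≤k ⟩
      3 ^ k               ≤⟨ ℕ.^-monoˡ-≤ k (ℕ.≤-<-trans 2≤x x<y) ⟩
      y ^ k               ≤⟨ y^k≤ ⟩
      b * c + N           ≤⟨ ℕ.+-mono-≤ (ℕ.*-mono-≤ (ℕ.≤-trans b≤h (ℕ.≤-pred h<24)) h<24) (ℕ.≤-trans N≤g (ℕ.≤-trans g≤h (ℕ.≤-pred h<24))) ⟩
      23 * 24 + 23 ∎)
      where
      x<y : x < y
      x<y = ℕ.≰⇒> λ y≤x → ℕ.<⇒≱ x^k<y^k (ℕ.^-monoˡ-≤ k y≤x)
      2≤h : 2 ≤ h
      2≤h = ℕ.≤-trans (ℕ.≤-trans (s≤s 0<g) g<b) b≤h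
      h≤x^k : h ≤ x ^ k
      h≤x^k = ℕ.+-cancelʳ-≤ g h (x ^ k) (begin
        h + g             ≤⟨ ℕ.+-monoˡ-≤ g (ℕ.m≤n*m h g ⦃ >-nonZero 0<g ⦄) ⟩
        g * h + g         ≡⟨ trans (ℕ.+-comm (g * h) g) (sym (ℕ.*-suc g h)) ⟩
        g * c             ≤⟨ gc≤ ⟩
        x ^ k + N         ≤⟨ ℕ.+-monoʳ-≤ (x ^ k) N≤g ⟩
        x ^ k + g ∎)
      2≤x : 2 ≤ x
      2≤x = ℕ.≰⇒> λ x≤1 → ℕ.<⇒≱ 2≤h (ℕ.≤-trans h≤x^k (ℕ.≤-trans (ℕ.^-monoˡ-≤ k x≤1) (ℕ.≤-reflexive (ℕ.^-zeroˡ k))))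

module IncreasingTuple (P : ℕ → ℕ → Set) (i′ N : ℕ)
  (system : ∀ a b → 0 < a → a < b → System P (3 + i′) N a b)
  (g b h : ℕ) (e : ℕ → ℕ) (M : ℕ) (0<N : 0 < N) (0<g : 0 < g) (g<b : g < b) (b≤h : b ≤ h) (h<e₀ : suc h < e 0) (N^k≤ : N ^ (3 + i′) ≤ g ^ suc i′)
  (Pgc : P g (suc h)) (Pbc : P b (suc h)) (Pge : P g (e 0)) (Pbe : ∀ i → i ≤ M → P b (e i)) (Pce : ∀ i → i ≤ M → P (suc h) (e i))
  (e-mono : ∀ i → i < M → e i < e (suc i)) where

  open FirstMembers P i′ N system g b h (e 0) 0<N 0<g g<b b≤h h<e₀ N^k≤ Pgc Pbc Pge (Pbe 0 z≤n) public

  private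
    k m : ℕ
    k = 3 + i′
    m = N * (suc h ∸ b)

  Q : ℕ → ℕ
  Q i = S₂.Q (e i)

  0<e : ∀ i → i ≤ M → 0 < e i
  0<e zero    _   = ℕ.≤-<-trans z≤n h<e₀
  0<e (suc i) i<M = ℕ.≤-<-trans z≤n (e-mono i i<M)

  Q-increasing : ∀ i → i < M → Q i < Q (suc i)
  Q-increasing i i<M = Q-mono (0<e i (ℕ.<⇒≤ i<M)) (e-mono i i<M)

  solution-at : ∀ i → i ≤ M → Solution k S₂.α S₂.β m (Q i)
  solution-at i i≤M = S₂.solution (e i) (Pbe i i≤M) (Pce i i≤M)

module Cases (P : ℕ → ℕ → Set) (N g b h : ℕ) (e : ℕ → ℕ) (0<N : 0 < N) (0<g : 0 < g) (g<b : g < b) (b≤h : b ≤ h) (h<e₀ : suc h < e 0)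
  (Pgc : P g (suc h)) (Pbc : P b (suc h)) (Pge : P g (e 0)) where

  -- The members after the third are e 0, ..., e M. So M = 1, 2, 3 and 6 correspond to tuples of 5,
  -- 6, 7 and 10 elements, one more than r_k allows.
  Members : ℕ → Set
  Members M = (∀ i → i ≤ M → P b (e i)) × (∀ i → i ≤ M → P (suc h) (e i)) × (∀ i → i < M → e i < e (suc i))

  exponent≥6 : ∀ i₄ → let k = 6 + i₄ in (∀ a b → 0 < a → a < b → System P k N a b) → N ^ k ≤ g ^ (4 + i₄) → Members 1 → ⊥
  exponent≥6 i₄ system N^k≤ (Pbe , Pce , e-mono) = Exponent≥6.impossible i₄ S₂.α S₂.β (N * (suc h ∸ b)) g h (Q 0) (Q 1)
      (solution-at 0 z≤n) (solution-at 1 (s≤s z≤n)) (Q-increasing 0 (s≤s z≤n)) 0<m 0<g g≤h (h-large (ℕ.m≤m+n 6 i₄)) gh≤γ m^k≤ Q-large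
    where open IncreasingTuple P (3 + i₄) N system g b h e 1 0<N 0<g g<b b≤h h<e₀ N^k≤ Pgc Pbc Pge Pbe Pce e-mono

  exponent5 : ∀ A B b′ w → A ≡ 12 * (5 * 5) → B ≡ 12 * (5 * 5) * (5 * 5) → b′ ≡ 2 * 6 → w ≡ 5 ^ 5 → 0 < w →
    A * (2 * B) ^ 4 ≤ w ^ 8 → 2 * A ^ 2 * b′ ^ 4 < w ^ 4 →
    (∀ a b → 0 < a → a < b → System P 5 N a b) → N ^ 5 ≤ g ^ 3 → Members 2 → ⊥
  exponent5 A B b′ w A≡ B≡ b≡ w≡ 0<w c₁ c₂ system N^k≤ (Pbe , Pce , e-mono) =
    Exponent5.impossible A B b′ w A≡ B≡ b≡ w≡ 0<w c₁ c₂ S₂.α S₂.β (N * (suc h ∸ b)) g h (Q 0) (Q 1) (Q 2)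
      (solution-at 0 z≤n) (solution-at 1 (s≤s z≤n)) (solution-at 2 (s≤s (s≤s z≤n)))
      (Q-increasing 0 (s≤s z≤n)) (Q-increasing 1 (s≤s (s≤s z≤n))) 0<m 0<g g≤h gh≤γ m^k≤ (Q-large-with w w≡)
    where open IncreasingTuple P 2 N system g b h e 2 0<N 0<g g<b b≤h h<e₀ N^k≤ Pgc Pbc Pge Pbe Pce e-mono

  exponent4 : ∀ A B b′ w → A ≡ 12 * (4 * 4) → B ≡ 12 * (4 * 4) * (4 * 4) → b′ ≡ 2 * 5 → w ≡ 4 ^ 4 → 0 < w →
    A * (2 * B) ^ 3 ≤ w ^ 6 → 2 * A ^ 3 * (b′ * B) ^ 3 < w ^ 9 → 2 ^ 4 * A ^ 8 < w ^ 26 →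
    (∀ a b → 0 < a → a < b → System P 4 N a b) → N ^ 4 ≤ g ^ 2 → Members 3 → ⊥
  exponent4 A B b′ w A≡ B≡ b≡ w≡ 0<w c₁ c₂ c₃ system N^k≤ (Pbe , Pce , e-mono) =
    Exponent4.impossible A B b′ w A≡ B≡ b≡ w≡ 0<w c₁ c₂ c₃ S₂.α S₂.β (N * (suc h ∸ b)) g h (Q 0) (Q 1) (Q 2) (Q 3)
      (solution-at 0 z≤n) (solution-at 1 (s≤s z≤n)) (solution-at 2 (s≤s (s≤s z≤n))) (solution-at 3 ℕ.≤-refl)
      (Q-increasing 0 (s≤s z≤n)) (Q-increasing 1 (s≤s (s≤s z≤n))) (Q-increasing 2 ℕ.≤-refl) 0<m 0<g g≤h gh≤γ m^k≤ (Q-large-with w w≡)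
    where open IncreasingTuple P 1 N system g b h e 3 0<N 0<g g<b b≤h h<e₀ N^k≤ Pgc Pbc Pge Pbe Pce e-mono

  exponent3 : ∀ A B b′ w → A ≡ 12 * (3 * 3) → B ≡ 12 * (3 * 3) * (3 * 3) → b′ ≡ 2 * 4 → w ≡ 3 ^ 3 → 0 < w →
    A * (2 * B) ^ 2 ≤ (w * w) ^ 4 → 2 * A ^ 4 * (b′ * (B * B)) ^ 2 < (w * w) ^ 8 → 2 ^ 3 * A ^ 9 < (w * w) ^ 27 →
    (∀ a b → 0 < a → a < b → System P 3 N a b) → N ^ 3 ≤ g ^ 1 → Members 6 → ⊥
  exponent3 A B b′ w A≡ B≡ b≡ w≡ 0<w c₁ c₂ c₃ system N^k≤ (Pbe , Pce , e-mono) =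
    Exponent3.impossible A B b′ w A≡ B≡ b≡ w≡ 0<w c₁ c₂ c₃ S₂.α S₂.β (N * (suc h ∸ b)) g h (Q 0) (Q 1) (Q 2) (Q 3) (Q 4) (Q 5) (Q 6)
      (solution-at 0 z≤n) (solution-at 1 (within 1)) (solution-at 2 (within 2)) (solution-at 3 (within 3)) (solution-at 4 (within 4)) (solution-at 5 (within 5)) (solution-at 6 (within 6))
      (Q-increasing 0 (within 1)) (Q-increasing 1 (within 2)) (Q-increasing 2 (within 3)) (Q-increasing 3 (within 4)) (Q-increasing 4 (within 5)) (Q-increasing 5 (within 6))
      0<m 0<g g≤h gh≤γ m^k≤ (Q-large-with w w≡)
    where
    open IncreasingTuple P 0 N system g b h e 6 0<N 0<g g<b b≤h h<e₀ N^k≤ Pgc Pbc Pge Pbe Pce e-mono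
    within : ∀ i {_ : Bool.T (i ℕ.≤ᵇ 6)} → i ≤ 6
    within i {p} = ℕ.≤ᵇ⇒≤ i 6 p

-- 0 beyond the end of the list.
nth : List ℕ → ℕ → ℕ
nth []       _       = 0
nth (c ∷ cs) zero    = c
nth (c ∷ cs) (suc i) = nth cs i

nth-All : ∀ {P : ℕ → Set} cs i → All P cs → i < length cs → P (nth cs i)
nth-All (c ∷ cs) zero    (p ∷ ps) _         = p
nth-All (c ∷ cs) (suc i) (p ∷ ps) (s≤s i<n) = nth-All cs i ps i<n

nth-AllPairs : ∀ {R : ℕ → ℕ → Set} cs i j → AllPairs R cs → i < j → j < length cs → R (nth cs i) (nth cs j)
nth-AllPairs (c ∷ cs) zero    (suc j) (r ∷ _)  _         (s≤s j<n) = nth-All cs j r j<n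
nth-AllPairs (c ∷ cs) (suc i) (suc j) (_ ∷ rs) (s≤s i<j) (s≤s j<n) = nth-AllPairs cs i j rs i<j j<n

r≤u : ∀ i′ → r (3 + i′) ≤ u (3 + i′)
r≤u 0 = ℕ.m≤m+n 9 6
r≤u 1 = ℕ.m≤m+n 6 4
r≤u 2 = ℕ.m≤m+n 5 1
r≤u (suc (suc (suc i))) with 6 + i ℕ.<ᵇ 15
... | true  = ℕ.m≤m+n 4 4
... | false = ℕ.m≤m+n 4 1

module SortedTuple (P : ℕ → ℕ → Set) (N : ℕ) (0<N : 0 < N) (cs : List ℕ)
  (positive : All (0 <_) cs) (increasing : AllPairs (λ c d → c < d × P c d) cs) where
  private
    c : ℕ → ℕ
    c = nth cs

  excluded : ∀ i′ → (∀ a b → 0 < a → a < b → System P (3 + i′) N a b) → All (λ c → N ^ (3 + i′) ≤ c ^ suc i′) cs → ¬ (r (3 + i′) < length cs)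
  excluded i′ system large r<length = split (c 2) refl
    where
    pair : ∀ i j → i < j → j < length cs → c i < c j × P (c i) (c j)
    pair i j = nth-AllPairs cs i j increasing
    4≤r : ∀ i′ → 4 ≤ r (3 + i′)
    4≤r 0 = ℕ.m≤m+n 4 5
    4≤r 1 = ℕ.m≤m+n 4 2
    4≤r 2 = ℕ.m≤m+n 4 1
    4≤r (suc (suc (suc i))) = ℕ.≤-refl
    4<length : 4 < length cs
    4<length = ℕ.≤-<-trans (4≤r i′) r<length
    early : ∀ i {_ : Bool.T (i ℕ.≤ᵇ 3)} → i < length cs
    early i {p} = ℕ.≤-<-trans (ℕ.≤-trans (ℕ.≤ᵇ⇒≤ i 3 p) (ℕ.n≤1+n 3)) 4<length
    0<c₀ : 0 < c 0
    0<c₀ = nth-All cs 0 positive (early 0)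
    c₀<c₁ : c 0 < c 1
    c₀<c₁ = proj₁ (pair 0 1 (s≤s z≤n) (early 1))
    -- The third member is matched against `suc h` to obtain its predecessor; it is not 0 since it
    -- exceeds the second.
    split : ∀ c₂ → c₂ ≡ c 2 → ⊥
    split zero    eq = ℕ.n≮0 (subst (c 1 <_) (sym eq) (proj₁ (pair 1 2 (s≤s (s≤s z≤n)) (early 2))))
    split (suc h) eq = case i′ system large r<length
      where
      e : ℕ → ℕ
      e i = c (3 + i)
      members : ∀ M → 3 + M < length cs → Cases.Members P N (c 0) (c 1) h e 0<N 0<c₀ c₀<c₁
        (ℕ.≤-pred (subst (c 1 <_) (sym eq) (proj₁ (pair 1 2 (s≤s (s≤s z≤n)) (early 2)))))
        (subst (_< c 3) (sym eq) (proj₁ (pair 2 3 (s≤s (s≤s (s≤s z≤n))) (early 3))))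
        (subst (P (c 0)) (sym eq) (proj₂ (pair 0 2 (s≤s z≤n) (early 2))))
        (subst (P (c 1)) (sym eq) (proj₂ (pair 1 2 (s≤s (s≤s z≤n)) (early 2))))
        (proj₂ (pair 0 3 (s≤s z≤n) (early 3))) M
      members M M<n = (λ i i≤M → proj₂ (pair 1 (3 + i) (s≤s (s≤s z≤n)) (ℕ.≤-<-trans (ℕ.+-monoʳ-≤ 3 i≤M) M<n)))
        , (λ i i≤M → subst (λ z → P z (e i)) (sym eq) (proj₂ (pair 2 (3 + i) (s≤s (s≤s (s≤s z≤n))) (ℕ.≤-<-trans (ℕ.+-monoʳ-≤ 3 i≤M) M<n))))
        , (λ i i<M → proj₁ (pair (3 + i) (4 + i) ℕ.≤-refl (ℕ.≤-<-trans (ℕ.+-monoʳ-≤ 3 i<M) M<n)))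
      open Cases P N (c 0) (c 1) h e 0<N 0<c₀ c₀<c₁
        (ℕ.≤-pred (subst (c 1 <_) (sym eq) (proj₁ (pair 1 2 (s≤s (s≤s z≤n)) (early 2)))))
        (subst (_< c 3) (sym eq) (proj₁ (pair 2 3 (s≤s (s≤s (s≤s z≤n))) (early 3))))
        (subst (P (c 0)) (sym eq) (proj₂ (pair 0 2 (s≤s z≤n) (early 2))))
        (subst (P (c 1)) (sym eq) (proj₂ (pair 1 2 (s≤s (s≤s z≤n)) (early 2))))
        (proj₂ (pair 0 3 (s≤s z≤n) (early 3)))
      compare : ∀ a b {_ : Bool.T (a ℕ.≤ᵇ b)} → a ≤ b
      compare a b {p} = ℕ.≤ᵇ⇒≤ a b p
      case : ∀ i′ → (∀ a b → 0 < a → a < b → System P (3 + i′) N a b) → All (λ c → N ^ (3 + i′) ≤ c ^ suc i′) cs → r (3 + i′) < length cs → ⊥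
      case 0 system large r<length = exponent3 (12 * (3 * 3)) (12 * (3 * 3) * (3 * 3)) (2 * 4) (3 ^ 3) refl refl refl refl (s≤s z≤n)
        (compare (12 * (3 * 3) * (2 * (12 * (3 * 3) * (3 * 3))) ^ 2) ((3 ^ 3 * 3 ^ 3) ^ 4))
        (compare (suc (2 * (12 * (3 * 3)) ^ 4 * (2 * 4 * (12 * (3 * 3) * (3 * 3) * (12 * (3 * 3) * (3 * 3)))) ^ 2)) ((3 ^ 3 * 3 ^ 3) ^ 8))
        (compare (suc (2 ^ 3 * (12 * (3 * 3)) ^ 9)) ((3 ^ 3 * 3 ^ 3) ^ 27))
        system (nth-All cs 0 large (early 0)) (members 6 r<length)
      case 1 system large r<length = exponent4 (12 * (4 * 4)) (12 * (4 * 4) * (4 * 4)) (2 * 5) (4 ^ 4) refl refl refl refl (s≤s z≤n)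
        (compare (12 * (4 * 4) * (2 * (12 * (4 * 4) * (4 * 4))) ^ 3) ((4 ^ 4) ^ 6))
        (compare (suc (2 * (12 * (4 * 4)) ^ 3 * (2 * 5 * (12 * (4 * 4) * (4 * 4))) ^ 3)) ((4 ^ 4) ^ 9))
        (compare (suc (2 ^ 4 * (12 * (4 * 4)) ^ 8)) ((4 ^ 4) ^ 26))
        system (nth-All cs 0 large (early 0)) (members 3 r<length)
      case 2 system large r<length = exponent5 (12 * (5 * 5)) (12 * (5 * 5) * (5 * 5)) (2 * 6) (5 ^ 5) refl refl refl refl (s≤s z≤n)
        (compare (12 * (5 * 5) * (2 * (12 * (5 * 5) * (5 * 5))) ^ 4) ((5 ^ 5) ^ 8))
        (compare (suc (2 * (12 * (5 * 5)) ^ 2 * (2 * 6) ^ 4)) ((5 ^ 5) ^ 4))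
        system (nth-All cs 0 large (early 0)) (members 2 r<length)
      case (suc (suc (suc i₄))) system large r<length = exponent≥6 i₄ system (nth-All cs 0 large (early 0)) (members 1 r<length)

-- Reordering preserves a pairwise relation only if it is symmetric, which holds for R and for
-- distinctness; sortedness and distinctness together give strict increase.
sort-tuple : ∀ {R : ℕ → ℕ → Set} {S : ℕ → Set} cs → (∀ {c d} → R c d → R d c) → AllPairs _≢_ cs → All S cs → AllPairs R cs →
  ∃[ ds ] length ds ≡ length cs × All S ds × AllPairs (λ c d → c < d × R c d) ds
sort-tuple {R} {S} cs R-sym distinct all-S all-R = ds , ↭-length (sort-↭ cs) , All-resp-↭ cs↭ds all-S
    , AllPairs.zipWith (λ { (c≤d , c≢d , r) → ℕ.≤∧≢⇒< c≤d c≢d , r })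
        ( Linked⇒AllPairs ℕ.≤-trans (sort-↗ cs)
        , AllPairs-resp-↭ (λ { (c≢d , r) → (λ d≡c → c≢d (sym d≡c)) , R-sym r }) (≡.resp₂ _) (↭⇒↭ₛ cs↭ds) (AllPairs.zip (distinct , all-R)))
  where
  open Data.List.Sort ℕ.≤-decTotalOrder using (sort; sort-↭; sort-↗)
  open Data.List.Relation.Binary.Permutation.Setoid.Properties (≡.setoid ℕ) using (AllPairs-resp-↭)
  ds : List ℕ
  ds = sort cs
  cs↭ds : cs ↭ ds
  cs↭ds = ↭-sym (sort-↭ cs)

abs-^ : ∀ z k → ∣ z ^ᶻ k ∣ ≡ ∣ z ∣ ^ k
abs-^ z zero    = refl
abs-^ z (suc k) = trans (ℤ.abs-* z (z ^ᶻ k)) (cong (∣ z ∣ *_) (abs-^ z k))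

-- For even k the integer root may be negative; its absolute value serves because c d + N ≥ 0.
plus-power : ∀ k N c d → IsKthPower k (pos c ⊗ pos d ⊕ pos N) → PlusPower k N c d
plus-power k N c d (z , z^k) = ∣ z ∣ , trans (sym (abs-^ z k)) (cong ∣_∣ (trans z^k (trans (cong (_⊕ pos N) (sym (ℤ.pos-* c d))) (sym (ℤ.pos-+ (c * d) N)))))

-- The bound N ≤ c d ensures that c d - N is nonnegative, so that passing to absolute values
-- preserves the equation.
minus-power : ∀ k N′ c d → suc N′ ≤ c * d → IsKthPower k (pos c ⊗ pos d ⊕ -[1+ N′ ]) → MinusPower k (suc N′) c d
minus-power k N′ c d N≤cd (z , z^k) = ∣ z ∣ , trans (cong (_+ suc N′) (trans (sym (abs-^ z k)) (cong ∣_∣ (trans z^k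
    (trans (cong (_⊕ -[1+ N′ ]) (sym (ℤ.pos-* c d))) (ℤ.⊖-≥ N≤cd)))))) (ℕ.m∸n+n≡m N≤cd)

tuple-bound : ∀ i′ n → n ≢ 0ℤ → (cs : List ℕ) → HasPropertyD (3 + i′) n cs → All (λ c → ∣ n ∣ ^ (3 + i′) ≤ c ^ suc i′) cs → length cs ≤ r (3 + i′)
tuple-bound i′ n n≢0 cs (distinct , positive , powers) large = from-sorted n n≢0
    (sort-tuple {λ c d → IsKthPower k (pos c ⊗ pos d ⊕ n)} {λ c → 0 < c × ∣ n ∣ ^ k ≤ c ^ suc i′} cs
      (λ {c} {d} → subst (λ z → IsKthPower k (z ⊕ n)) (ℤ.*-comm (pos c) (pos d))) distinct (All.zip (positive , large)) powers)
  where
  k : ℕ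
  k = 3 + i′
  from-sorted : ∀ n → n ≢ 0ℤ → (∃[ ds ] length ds ≡ length cs × All (λ c → 0 < c × ∣ n ∣ ^ k ≤ c ^ suc i′) ds × AllPairs (λ c d → c < d × IsKthPower k (pos c ⊗ pos d ⊕ n)) ds) →
    length cs ≤ r k
  from-sorted (pos zero)    n≢0 _ = ⊥-elim (n≢0 refl)
  from-sorted (pos (suc N′)) n≢0 (ds , length≡ , all , pairs) = ℕ.≮⇒≥ λ r<length →
    SortedTuple.excluded (PlusPower k (suc N′)) (suc N′) (s≤s z≤n) ds (All.map proj₁ all)
      (AllPairs.map (λ {c} {d} → λ { (c<d , p) → c<d , plus-power k (suc N′) c d p }) pairs)
      i′ (plus-system k (suc N′)) (All.map proj₂ all) (subst (r k <_) (sym length≡) r<length)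
  from-sorted -[1+ N′ ]     n≢0 (ds , length≡ , all , pairs) = ℕ.≮⇒≥ λ r<length →
    SortedTuple.excluded (MinusPower k (suc N′)) (suc N′) (s≤s z≤n) ds (All.map proj₁ all)
      (convert ds all pairs)
      i′ (minus-system k (suc N′)) (All.map proj₂ all) (subst (r k <_) (sym length≡) r<length)
    where
    N≤ : ∀ c → 0 < c × suc N′ ^ k ≤ c ^ suc i′ → suc N′ ≤ c
    N≤ c (0<c , N^k≤) = root-≤ (2 + i′) (suc N′) c (ℕ.≤-trans N^k≤ (ℕ.^-monoʳ-≤ c ⦃ >-nonZero 0<c ⦄ (ℕ.m≤n+m (suc i′) 2)))
    convert : ∀ ds → All (λ c → 0 < c × suc N′ ^ k ≤ c ^ suc i′) ds → AllPairs (λ c d → c < d × IsKthPower k (pos c ⊗ pos d ⊕ -[1+ N′ ])) ds →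
      AllPairs (λ c d → c < d × MinusPower k (suc N′) c d) ds
    convert []       []        []           = []
    convert (c ∷ ds) (q ∷ all) (qs ∷ pairs) = All.zipWith (λ { {d} ((0<d , _) , (c<d , p)) →
        c<d , minus-power k N′ c d (ℕ.≤-trans (N≤ c q) (ℕ.m≤m*n c d ⦃ >-nonZero 0<d ⦄)) p }) (all , qs) ∷ convert ds all pairs

-- The suprema are bounded through all finite lists, and c ≥ |n|^(k/(k-2)) is expressed by integers
-- as `∣ n ∣ ^ k ≤ c ^ (k ∸ 2)`.
theorem2p4 : (k : ℕ) → 3 ≤ k → (n : ℤ) → n ≢ 0ℤ →
    ((∣ n ∣ ≡ 1 → (cs : List ℕ) → HasPropertyD k n cs → length cs ≤ r k) ×
    (2 ≤ ∣ n ∣ → (cs : List ℕ) → HasPropertyD k n cs →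
    All (λ c → ∣ n ∣ ^ k ≤ c ^ (k ∸ 2)) cs → length cs ≤ u k))
theorem2p4 (suc (suc (suc i′))) (s≤s (s≤s (s≤s z≤n))) n n≢0 =
    (λ ∣n∣≡1 cs D → tuple-bound i′ n n≢0 cs D (All.map (trivial ∣n∣≡1) (proj₁ (proj₂ D))))
  , (λ _ cs D large → ℕ.≤-trans (tuple-bound i′ n n≢0 cs D large) (r≤u i′))
  where
  trivial : ∣ n ∣ ≡ 1 → ∀ {c} → 1 ≤ c → ∣ n ∣ ^ (3 + i′) ≤ c ^ suc i′
  trivial ∣n∣≡1 {c} 1≤c = ℕ.≤-trans (ℕ.≤-reflexive (trans (cong (_^ (3 + i′)) ∣n∣≡1) (ℕ.^-zeroˡ (3 + i′)))) (^-positive c (suc i′) 1≤c)
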